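{- For every prime $p$ and every integer $k \geq 1$ there is an integer $N_p(k)$ such that, if $M$ is a simple $\mathrm{GF}(p)$-representable matroid with rank $r(M) \geq N_p(k)$, then $M$ contains a rank-$k$ flat $F$ such that either $F$ is independent in $M$, or $M|F \cong \mathrm{AG}(k-1,p)$, or $M|F \cong \mathrm{PG}(k-1,p)$.
   Context: Matroids are finite. $\mathrm{GF}(p)$ is the field with $p$ elements. $M|F$ denotes the restriction of $M$ to $F$. $\mathrm{PG}(k-1,p)$ is the rank-$k$ projective geometry over $\mathrm{GF}(p)$: the simple matroid whose elements are the one-dimensional subspaces of $\mathrm{GF}(p)^k$, with linear independence. $\mathrm{AG}(k-1,p)$ is the rank-$k$ affine geometry over $\mathrm{GF}(p)$: the restriction of $\mathrm{PG}(k-1,p)$ to the complement of a hyperplane. -}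

module Defs where

open import Algebra.Bundles using (CommutativeRing)
open import Algebra.Structures using (IsCommutativeRing)
open import Data.Empty using (⊥-elim)
open import Data.Fin.Base using (Fin; zero; suc; toℕ; combine; splitAt; _↑ˡ_; _↑ʳ_; finToFun; funToFin)
open import Data.Fin.Properties
  using (_≟_; any?; all?; toℕ-injective; toℕ-fromℕ<; toℕ<n; splitAt⁻¹-↑ˡ; splitAt⁻¹-↑ʳ;
         splitAt-↑ˡ; splitAt-↑ʳ; finToFun-funToFin; funToFin-finToFin)
open import Data.Fin.Subset using
  (Subset; inside; outside; ⊤; ⊥; ⁅_⁆; _∈_; _∉_; _⊆_; _∩_; _∪_; _─_; ∣_∣)
open import Data.Fin.Subset.Properties
open import Data.List.Base using (List; []; _∷_; _++_; map; filter)
open import Data.List.Extrema.Nat using (max)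
open import Data.Nat.Base as ℕ using (ℕ; zero; suc; NonZero; _≤_; _<_; _^_; _%_; s≤s)
open import Data.Nat.Coprimality using (coprime-Bézout; prime⇒coprime)
open import Data.Nat.DivMod
  using (_mod_; m%n<n; n%n≡0; m<n⇒m%n≡m; %-distribˡ-+; %-distribˡ-*; m*n%n≡0)
open import Data.Nat.GCD using (module Bézout)
open import Data.Nat.Primality using (Prime; prime⇒nonZero; prime⇒nonTrivial)
import Data.Nat.Properties as ℕₚ
open import Data.Product.Base using (∃; ∃-syntax; _×_; _,_; proj₁; proj₂)
open import Data.Sum.Base using (_⊎_; inj₁; inj₂; [_,_]′)
open import Data.Vec.Base using ([]; _∷_; here; there)
open import Data.Vec.Functional as Vector using ()
open import Function.Base using (_∘_; case_of_)
open import Function.Bundles using (_⇔_; _↔_; Inverse)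
open import Level using (0ℓ)
open import Relation.Binary.PropositionalEquality
open import Relation.Nullary using (Dec; yes; no; ¬_; contradiction; ¬?; _×-dec_)
open import Relation.Nullary.Decidable using (_→-dec_)
open import Relation.Unary using (Decidable)

private
  variable
    m n d : ℕ

------------------------------------------------------------------------
-- Matroids

-- A finite matroid, given by its independent sets.  The ground set E is a
-- subset of an ambient Fin n, so that a restriction keeps the names of its
-- elements.

record Matroid (n : ℕ) : Set₁ where
  field
    E          : Subset n
    Indep      : Subset n → Set
    indep?     : Decidable Indep
    indep⊆E    : ∀ {I} → Indep I → I ⊆ E
    ∅-indep    : Indep ⊥
    hereditary : ∀ {I J} → I ⊆ J → Indep J → Indep I
    augment    : ∀ {I J} → Indep I → Indep J → ∣ I ∣ < ∣ J ∣ →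
                 ∃[ e ] e ∈ J × e ∉ I × Indep (I ∪ ⁅ e ⁆)

open Matroid

subsets : ∀ n → List (Subset n)
subsets zero    = [] ∷ []
subsets (suc n) = map (outside ∷_) (subsets n) ++ map (inside ∷_) (subsets n)

rank : Matroid n → Subset n → ℕ
rank {n} M X =
  max 0 (map ∣_∣ (filter (λ I → (I ⊆? X) ×-dec indep? M I) (subsets n)))

-- No loops and no parallel pairs.
Simple : Matroid n → Set
Simple M = (∀ {e} → e ∈ E M → Indep M ⁅ e ⁆)
         × (∀ {e f} → e ∈ E M → f ∈ E M → e ≢ f → Indep M (⁅ e ⁆ ∪ ⁅ f ⁆))

Flat : Matroid n → Subset n → Set
Flat M F = F ⊆ E M × (∀ {e} → e ∈ E M → e ∉ F → rank M F < rank M (F ∪ ⁅ e ⁆))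

Hyperplane : Matroid n → Subset n → Set
Hyperplane M H = Flat M H × suc (rank M H) ≡ rank M (E M)

infixl 6 _↾_

_↾_ : Matroid n → Subset n → Matroid n
M ↾ F = record
  { E          = E M ∩ F
  ; Indep      = λ I → Indep M I × I ⊆ F
  ; indep?     = λ I → indep? M I ×-dec (I ⊆? F)
  ; indep⊆E    = λ (i , I⊆F) x∈I → x∈p∩q⁺ (indep⊆E M i x∈I , I⊆F x∈I)
  ; ∅-indep    = ∅-indep M , λ x∈⊥ → ⊥-elim (∉⊥ x∈⊥)
  ; hereditary = λ I⊆J (j , J⊆F) → hereditary M I⊆J j , λ x∈I → J⊆F (I⊆J x∈I)
  ; augment    = λ {I} (i , I⊆F) (j , J⊆F) I<J →
      let (e , e∈J , e∉I , i+e) = augment M i j I<J in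
      e , e∈J , e∉I , i+e ,
      λ x∈I+e → case x∈p∪q⁻ I ⁅ e ⁆ x∈I+e of λ where
        (inj₁ x∈I) → I⊆F x∈I
        (inj₂ x∈e) → subst (_∈ F) (sym (x∈⁅y⁆⇒x≡y e x∈e)) (J⊆F e∈J)
  }

Element : Matroid n → Set
Element M = ∃[ e ] e ∈ E M

infix 4 _≅_

record _≅_ (M : Matroid m) (N : Matroid n) : Set where
  field
    bijection : Element M ↔ Element N

  open Inverse bijection using (to)

  -- The hypothesis on elements says that Y is the image of X.
  field
    preserves : ∀ {X Y} → X ⊆ E M → Y ⊆ E N →
                (∀ e → proj₁ e ∈ X ⇔ proj₁ (to e) ∈ Y) →
                Indep M X ⇔ Indep N Y

------------------------------------------------------------------------
-- Finite fields

record FiniteField (q : ℕ) : Set where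
  field
    _+_ _*_ : Fin q → Fin q → Fin q
    -_      : Fin q → Fin q
    0# 1#   : Fin q
    isCommutativeRing : IsCommutativeRing _≡_ _+_ _*_ -_ 0# 1#
    1≢0               : 1# ≢ 0#
    invertible        : ∀ {a} → a ≢ 0# → ∃[ b ] b * a ≡ 1#

  commutativeRing : CommutativeRing 0ℓ 0ℓ
  commutativeRing = record { isCommutativeRing = isCommutativeRing }

------------------------------------------------------------------------
-- The ring of integers modulo p, on the carrier Fin p

module Modular (p : ℕ) .{{_ : NonZero p}} where

  infixl 6 _+_
  infixl 7 _*_
  infix  8 -_

  0# 1# : Fin p
  0# = 0 mod p
  1# = 1 mod p

  _+_ _*_ : Fin p → Fin p → Fin p
  a + b = (toℕ a ℕ.+ toℕ b) mod p
  a * b = (toℕ a ℕ.* toℕ b) mod p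

  -_ : Fin p → Fin p
  - a = (p ℕ.∸ toℕ a) mod p

  toℕ-mod : ∀ a → toℕ (a mod p) ≡ a % p
  toℕ-mod a = toℕ-fromℕ< (m%n<n a p)

  mod-cong : ∀ {a b} → a % p ≡ b % p → a mod p ≡ b mod p
  mod-cong {a} {b} eq =
    toℕ-injective (trans (toℕ-mod a) (trans eq (sym (toℕ-mod b))))

  mod-toℕ : ∀ a → toℕ a mod p ≡ a
  mod-toℕ a = toℕ-injective (trans (toℕ-mod (toℕ a)) (m<n⇒m%n≡m (toℕ<n a)))

  mod-+ : ∀ a b → a mod p + b mod p ≡ (a ℕ.+ b) mod p
  mod-+ a b = mod-cong (trans
    (cong₂ (λ x y → (x ℕ.+ y) % p) (toℕ-mod a) (toℕ-mod b))
    (sym (%-distribˡ-+ a b p)))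

  mod-* : ∀ a b → (a mod p) * (b mod p) ≡ (a ℕ.* b) mod p
  mod-* a b = mod-cong (trans
    (cong₂ (λ x y → (x ℕ.* y) % p) (toℕ-mod a) (toℕ-mod b))
    (sym (%-distribˡ-* a b p)))

  p-mod : p mod p ≡ 0#
  p-mod = mod-cong (trans (n%n≡0 p) (sym (m*n%n≡0 0 p)))

  private
    +ˡ : ∀ a c → a mod p + c ≡ (a ℕ.+ toℕ c) mod p
    +ˡ a c = trans (cong (a mod p +_) (sym (mod-toℕ c))) (mod-+ a (toℕ c))

    +ʳ : ∀ c a → c + a mod p ≡ (toℕ c ℕ.+ a) mod p
    +ʳ c a = trans (cong (_+ a mod p) (sym (mod-toℕ c))) (mod-+ (toℕ c) a)

    *ˡ : ∀ a c → (a mod p) * c ≡ (a ℕ.* toℕ c) mod p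
    *ˡ a c = trans (cong ((a mod p) *_) (sym (mod-toℕ c))) (mod-* a (toℕ c))

    *ʳ : ∀ c a → c * (a mod p) ≡ (toℕ c ℕ.* a) mod p
    *ʳ c a = trans (cong (_* (a mod p)) (sym (mod-toℕ c))) (mod-* (toℕ c) a)

  +-comm : ∀ a b → a + b ≡ b + a
  +-comm a b = cong (_mod p) (ℕₚ.+-comm (toℕ a) (toℕ b))

  *-comm : ∀ a b → a * b ≡ b * a
  *-comm a b = cong (_mod p) (ℕₚ.*-comm (toℕ a) (toℕ b))

  +-assoc : ∀ a b c → a + b + c ≡ a + (b + c)
  +-assoc a b c = trans (+ˡ _ c) (trans
    (cong (_mod p) (ℕₚ.+-assoc (toℕ a) (toℕ b) (toℕ c))) (sym (+ʳ a _)))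

  *-assoc : ∀ a b c → a * b * c ≡ a * (b * c)
  *-assoc a b c = trans (*ˡ _ c) (trans
    (cong (_mod p) (ℕₚ.*-assoc (toℕ a) (toℕ b) (toℕ c))) (sym (*ʳ a _)))

  +-identityˡ : ∀ a → 0# + a ≡ a
  +-identityˡ a = trans (+ˡ 0 a) (mod-toℕ a)

  *-identityˡ : ∀ a → 1# * a ≡ a
  *-identityˡ a = trans (*ˡ 1 a)
    (trans (cong (_mod p) (ℕₚ.*-identityˡ (toℕ a))) (mod-toℕ a))

  +-inverseʳ : ∀ a → a + - a ≡ 0#
  +-inverseʳ a = trans (+ʳ a _) (trans
    (cong (_mod p) (ℕₚ.m+[n∸m]≡n (ℕₚ.<⇒≤ (toℕ<n a)))) p-mod)

  *-distribˡ-+ : ∀ a b c → a * (b + c) ≡ a * b + a * c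
  *-distribˡ-+ a b c = trans (*ʳ a _) (trans
    (cong (_mod p) (ℕₚ.*-distribˡ-+ (toℕ a) (toℕ b) (toℕ c)))
    (sym (mod-+ (toℕ a ℕ.* toℕ b) (toℕ a ℕ.* toℕ c))))

  private
    fromˡ : ∀ (_∙_ : Fin p → Fin p → Fin p) (f : Fin p → Fin p) →
            (∀ a b → a ∙ b ≡ b ∙ a) →
            (g : Fin p → Fin p) → (∀ a → f a ∙ a ≡ g a) → ∀ a → a ∙ f a ≡ g a
    fromˡ _∙_ f comm g eq a = trans (comm a (f a)) (eq a)

  ring : CommutativeRing 0ℓ 0ℓ
  ring = record
    { Carrier = Fin p ; _≈_ = _≡_ ; _+_ = _+_ ; _*_ = _*_ ; -_ = -_
    ; 0# = 0# ; 1# = 1#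
    ; isCommutativeRing = record
      { isRing = record
        { +-isAbelianGroup = record
          { isGroup = record
            { isMonoid = record
              { isSemigroup = record
                { isMagma = record { isEquivalence = isEquivalence ; ∙-cong = cong₂ _+_ }
                ; assoc = +-assoc }
              ; identity = +-identityˡ , fromˡ _+_ (λ _ → 0#) +-comm (λ a → a) +-identityˡ }
            ; inverse = (λ a → trans (+-comm (- a) a) (+-inverseʳ a)) , +-inverseʳ
            ; ⁻¹-cong = cong -_ }
          ; comm = +-comm }
        ; *-cong = cong₂ _*_
        ; *-assoc = *-assoc
        ; *-identity = *-identityˡ , fromˡ _*_ (λ _ → 1#) *-comm (λ a → a) *-identityˡ
        ; distrib = *-distribˡ-+ , λ a b c → trans (*-comm (b + c) a)
            (trans (*-distribˡ-+ a b c) (cong₂ _+_ (*-comm a b) (*-comm a c))) }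
      ; *-comm = *-comm }
    }

GF : ∀ {p} → Prime p → FiniteField p
GF {p} p-prime = record
  { isCommutativeRing = CommutativeRing.isCommutativeRing (Modular.ring p)
  ; 1≢0               = 1≢0
  ; invertible        = invertible
  }
  where
  instance
    p≢0 : NonZero p
    p≢0 = prime⇒nonZero p-prime

  open CommutativeRing (Modular.ring p) hiding (refl; sym; trans; zero)
  open ≡-Reasoning

  1≢0 : 1# ≢ 0#
  1≢0 eq = ℕₚ.1+n≢0 {0} (begin
    1              ≡⟨ m<n⇒m%n≡m (ℕ.nonTrivial⇒n>1 p {{prime⇒nonTrivial p-prime}}) ⟨
    1 % p          ≡⟨ Modular.toℕ-mod p 1 ⟨
    toℕ 1#          ≡⟨ cong toℕ eq ⟩
    toℕ 0#          ≡⟨ Modular.toℕ-mod p 0 ⟩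
    0 % p          ≡⟨ m*n%n≡0 0 p ⟩
    0              ∎)

  invertible : ∀ {a} → a ≢ 0# → ∃[ b ] b * a ≡ 1#
  invertible {a} a≢0 = fromBézout (coprime-Bézout (prime⇒coprime p-prime {{a≢0ℕ}} (toℕ<n a)))
    where
    open Modular p using (mod-toℕ; mod-+; mod-*; p-mod; mod-cong)

    a≢0ℕ : NonZero (toℕ a)
    a≢0ℕ = ℕ.≢-nonZero λ eq → a≢0 (trans (sym (mod-toℕ a)) (cong (_mod p) eq))

    multiple : ∀ x → (x ℕ.* p) mod p ≡ 0#
    multiple x = mod-cong (trans (m*n%n≡0 x p) (sym (m*n%n≡0 0 p)))

    times-a : ∀ y → (y ℕ.* toℕ a) mod p ≡ (y mod p) * a
    times-a y = trans (sym (mod-* y (toℕ a))) (cong ((y mod p) *_) (mod-toℕ a))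

    fromBézout : Bézout.Identity 1 p (toℕ a) → ∃[ b ] b * a ≡ 1#
    fromBézout (Bézout.-+ x y eq) = y mod p , (begin
      (y mod p) * a                   ≡⟨ times-a y ⟨
      (y ℕ.* toℕ a) mod p             ≡⟨ cong (_mod p) eq ⟨
      (1 ℕ.+ x ℕ.* p) mod p           ≡⟨ mod-+ 1 (x ℕ.* p) ⟨
      1# + (x ℕ.* p) mod p            ≡⟨ cong (1# +_) (multiple x) ⟩
      1# + 0#                         ≡⟨ +-identityʳ 1# ⟩
      1#                              ∎)
    fromBézout (Bézout.+- x y eq) = - (y mod p) , (begin
      - b * a                         ≡⟨ +-identityˡ _ ⟨
      0# + - b * a                    ≡⟨ cong (_+ - b * a) 1+ba≡0 ⟨
      1# + b * a + - b * a            ≡⟨ +-assoc 1# (b * a) (- b * a) ⟩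
      1# + (b * a + - b * a)          ≡⟨ cong (1# +_) (distribʳ a b (- b)) ⟨
      1# + (b + - b) * a              ≡⟨ cong (λ z → 1# + z * a) (-‿inverseʳ b) ⟩
      1# + 0# * a                     ≡⟨ cong (1# +_) (zeroˡ a) ⟩
      1# + 0#                         ≡⟨ +-identityʳ 1# ⟩
      1#                              ∎)
      where
      b = y mod p
      1+ba≡0 : 1# + b * a ≡ 0#
      1+ba≡0 = begin
        1# + b * a                    ≡⟨ cong (1# +_) (times-a y) ⟨
        1# + (y ℕ.* toℕ a) mod p      ≡⟨ mod-+ 1 (y ℕ.* toℕ a) ⟩
        (1 ℕ.+ y ℕ.* toℕ a) mod p     ≡⟨ cong (_mod p) eq ⟩
        (x ℕ.* p) mod p               ≡⟨ multiple x ⟩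
        0#                            ∎

------------------------------------------------------------------------
-- Linear algebra over a finite field

module _ {q : ℕ} (𝔽 : FiniteField q) where

  open FiniteField 𝔽 using (commutativeRing; 1≢0; invertible)
  open CommutativeRing commutativeRing hiding (refl; sym; trans; zero)
  open import Algebra.Properties.Ring (CommutativeRing.ring commutativeRing)
    using (-‿distribˡ-*)
  open import Algebra.Properties.Semiring.Sum (CommutativeRing.semiring commutativeRing)
    using (sum; sum-syntax; sum-cong-≗; ∑-distrib-+; ∑-comm; *-distribˡ-sum; *-distribʳ-sum;
           sum-replicate-zero)
  open ≡-Reasoning

  LinearlyIndependent : (Fin n → Fin d → Carrier) → Subset n → Set
  LinearlyIndependent {n} v X =
    ∀ (c : Fin n → Carrier) → (∀ i → i ∉ X → c i ≡ 0#) →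
    (∀ j → ∑[ i < n ] (c i * v i j) ≡ 0#) → ∀ i → c i ≡ 0#

  private
    δ : Fin n → Fin n → Carrier
    δ i j with i ≟ j
    ... | yes _ = 1#
    ... | no  _ = 0#

    δ-same : (i : Fin n) → δ i i ≡ 1#
    δ-same i with i ≟ i
    ... | yes _  = refl
    ... | no i≢i = contradiction refl i≢i

    δ-diff : (i j : Fin n) → i ≢ j → δ i j ≡ 0#
    δ-diff i j i≢j with i ≟ j
    ... | yes i≡j = contradiction i≡j i≢j
    ... | no _    = refl

    δ-suc : (i j : Fin n) → δ (suc i) (suc j) ≡ δ i j
    δ-suc i j = compare (i ≟ j)
      where
      compare : Dec (i ≡ j) → δ (suc i) (suc j) ≡ δ i j
      compare (yes refl) = trans (δ-same (suc i)) (sym (δ-same i))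
      compare (no i≢j)   = trans (δ-diff (suc i) (suc j) λ { refl → i≢j refl }) (sym (δ-diff i j i≢j))

    infix 8 _·_
    _·_ : (Fin n → Carrier) → (Fin n → Carrier) → Carrier
    _·_ {n} c f = ∑[ i < n ] (c i * f i)

    ·-congˡ : {c c′ : Fin n → Carrier} (f : Fin n → Carrier) → c ≗ c′ → c · f ≡ c′ · f
    ·-congˡ f eq = sum-cong-≗ λ i → cong (_* f i) (eq i)

    ·-zero : (c f : Fin n → Carrier) → (∀ i → c i * f i ≡ 0#) → c · f ≡ 0#
    ·-zero {n} c f eq = trans (sum-cong-≗ eq) (sum-replicate-zero n)

    ·-comm : (c f : Fin n → Carrier) → c · f ≡ f · c
    ·-comm c f = sum-cong-≗ λ i → *-comm (c i) (f i)

    δ-· : (i : Fin n) (f : Fin n → Carrier) → δ i · f ≡ f i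
    δ-· {suc n} zero f = begin
      δ {suc n} zero · f              ≡⟨ cong₂ _+_ (cong (_* f zero) (δ-same {suc n} zero))
                                          (·-zero (δ {suc n} zero ∘ suc) (f ∘ suc)
                                            λ j → trans (cong (_* f (suc j)) (δ-diff zero (suc j) λ ())) (zeroˡ _)) ⟩
      1# * f zero + 0#                ≡⟨ +-identityʳ _ ⟩
      1# * f zero                     ≡⟨ *-identityˡ _ ⟩
      f zero                          ∎
    δ-· {suc n} (suc i) f = begin
      δ (suc i) · f                   ≡⟨ cong₂ _+_ (trans (cong (_* f zero) (δ-diff (suc i) zero λ ())) (zeroˡ _))
                                          (·-congˡ (f ∘ suc) (δ-suc i)) ⟩
      0# + δ i · (f ∘ suc)            ≡⟨ +-identityˡ _ ⟩
      δ i · (f ∘ suc)                 ≡⟨ δ-· i (f ∘ suc) ⟩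
      f (suc i)                       ∎

    ·-linear : (c : Fin n → Carrier) (t : Carrier) (e f : Fin n → Carrier) →
               (λ i → c i + t * e i) · f ≡ c · f + t * (e · f)
    ·-linear c t e f = begin
      (λ i → c i + t * e i) · f       ≡⟨ sum-cong-≗ (λ i → trans (distribʳ (f i) (c i) (t * e i))
                                          (cong (c i * f i +_) (*-assoc t (e i) (f i)))) ⟩
      sum (λ i → c i * f i + t * (e i * f i))
                                      ≡⟨ ∑-distrib-+ _ (λ i → t * (e i * f i)) ⟩
      c · f + sum (λ i → t * (e i * f i))
                                      ≡⟨ cong (c · f +_) (*-distribˡ-sum t (λ i → e i * f i)) ⟨
      c · f + t * (e · f)             ∎

    SupportedOn : Subset n → (Fin n → Carrier) → Set
    SupportedOn X c = ∀ i → i ∉ X → c i ≡ 0#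

    -- A homogeneous system with fewer equations than unknowns has a
    -- nontrivial solution.
    solve : ∀ m (F : Fin m → Fin n → Carrier) (X : Subset n) → m < ∣ X ∣ →
            ∃[ c ] SupportedOn X c × (∃[ i ] c i ≢ 0#) × (∀ k → c · F k ≡ 0#)
    solve {n} zero F X 0<∣X∣ with nonempty? X
    ... | no empty = contradiction
          (trans (cong ∣_∣ (Empty-unique empty)) (∣⊥∣≡0 n)) (ℕₚ.>⇒≢ 0<∣X∣)
    ... | yes (x , x∈X) = δ x , (λ i i∉X → δ-diff x i λ { refl → i∉X x∈X })
                        , (x , λ eq → 1≢0 (trans (sym (δ-same x)) eq)) , λ ()
    solve {n} (suc m) F X m<∣X∣
      with any? (λ i → (i ∈? X) ×-dec ¬? (F zero i ≟ 0#))
    ... | no f≡0 =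
          let (c , sup , nz , sols) = solve m (F ∘ suc) X (ℕₚ.<-trans (ℕₚ.n<1+n _) m<∣X∣) in
          c , sup , nz , λ { zero → ·-zero c f (vanish c sup) ; (suc k) → sols k }
      where
      f = F zero
      vanish : ∀ c → SupportedOn X c → ∀ i → c i * f i ≡ 0#
      vanish c sup i with i ∈? X
      ... | no i∉X = trans (cong (_* f i) (sup i i∉X)) (zeroˡ _)
      ... | yes i∈X with f i ≟ 0#
      ...   | yes fi≡0 = trans (cong (c i *_) fi≡0) (zeroʳ _)
      ...   | no fi≢0  = contradiction (i , i∈X , fi≢0) f≡0
    ... | yes (y , y∈X , fy≢0) = c⁺ , sup⁺ , nz⁺ , λ { zero → sol-f ; (suc k) → sol (sols k) }
      where
      f = F zero
      u = proj₁ (invertible fy≢0)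
      ufy≡1 = proj₂ (invertible fy≢0)

      reduce : (Fin n → Carrier) → (Fin n → Carrier)
      reduce g i = g i + - (g y * u) * f i

      smaller : m < ∣ X ─ ⁅ y ⁆ ∣
      smaller = ℕₚ.≤-pred (ℕₚ.≤-trans m<∣X∣ (size X y∈X))
        where
        size : ∀ {k} (Z : Subset k) {z} → z ∈ Z → ∣ Z ∣ ≤ suc ∣ Z ─ ⁅ z ⁆ ∣
        size (_ ∷ Z) here = s≤s (ℕₚ.≤-reflexive (cong ∣_∣ (sym (p─⊥≡p Z))))
        size (outside ∷ Z) (there z∈Z) = size Z z∈Z
        size (inside  ∷ Z) (there z∈Z) = s≤s (size Z z∈Z)

      rec  = solve m (reduce ∘ F ∘ suc) (X ─ ⁅ y ⁆) smaller
      c    = proj₁ rec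
      sup  = proj₁ (proj₂ rec)
      nz   = proj₁ (proj₂ (proj₂ rec))
      sols = proj₂ (proj₂ (proj₂ rec))
      t    = - (u * (c · f))

      c⁺ : Fin n → Carrier
      c⁺ i = c i + t * δ y i

      y∉X-y : y ∉ X ─ ⁅ y ⁆
      y∉X-y = x∉p-x X y
        where
        x∉p-x : ∀ {k} (Z : Subset k) z → z ∉ Z ─ ⁅ z ⁆
        x∉p-x (inside  ∷ Z) zero    ()
        x∉p-x (outside ∷ Z) zero    ()
        x∉p-x (_ ∷ Z)       (suc z) (there h) = x∉p-x Z z h

      c⁺≡c : ∀ {i} → i ≢ y → c⁺ i ≡ c i
      c⁺≡c {i} i≢y = begin
        c i + t * δ y i  ≡⟨ cong (λ z → c i + t * z) (δ-diff y i (i≢y ∘ sym)) ⟩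
        c i + t * 0#     ≡⟨ cong (c i +_) (zeroʳ t) ⟩
        c i + 0#         ≡⟨ +-identityʳ _ ⟩
        c i              ∎

      sup⁺ : SupportedOn X c⁺
      sup⁺ i i∉X = trans (c⁺≡c λ { refl → i∉X y∈X })
                         (sup i (i∉X ∘ p─q⊆p X ⁅ y ⁆))

      nz⁺ : ∃[ i ] c⁺ i ≢ 0#
      nz⁺ = let (i , ci≢0) = nz in
        i , λ eq → ci≢0 (trans (sym (c⁺≡c λ i≡y → ci≢0 (sup i (subst (_∉ X ─ ⁅ y ⁆) (sym i≡y) y∉X-y)))) eq)

      c⁺· : ∀ g → c⁺ · g ≡ c · g + t * g y
      c⁺· g = trans (·-linear c t (δ y) g) (cong (λ z → c · g + t * z) (δ-· y g))

      sol-f : c⁺ · f ≡ 0#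
      sol-f = begin
        c⁺ · f                            ≡⟨ c⁺· f ⟩
        c · f + - (u * (c · f)) * f y     ≡⟨ cong (c · f +_) (-‿distribˡ-* _ (f y)) ⟨
        c · f + - (u * (c · f) * f y)     ≡⟨ cong (λ z → c · f + - z) (trans (cong (_* f y) (*-comm u (c · f)))
                                               (trans (*-assoc (c · f) u (f y)) (cong (c · f *_) ufy≡1))) ⟩
        c · f + - (c · f * 1#)            ≡⟨ cong (λ z → c · f + - z) (*-identityʳ (c · f)) ⟩
        c · f + - (c · f)                 ≡⟨ -‿inverseʳ _ ⟩
        0#                                ∎

      sol : ∀ {g} → c · reduce g ≡ 0# → c⁺ · g ≡ 0#
      sol {g} eq = begin
        c⁺ · g                            ≡⟨ c⁺· g ⟩
        c · g + - (u * (c · f)) * g y     ≡⟨ cong (c · g +_) (-‿distribˡ-* _ (g y)) ⟨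
        c · g + - (u * (c · f) * g y)     ≡⟨ cong (λ z → c · g + - z) (trans (*-comm _ (g y)) (sym (*-assoc (g y) u (c · f)))) ⟩
        c · g + - (g y * u * (c · f))     ≡⟨ cong (c · g +_) (-‿distribˡ-* _ (c · f)) ⟩
        c · g + - (g y * u) * (c · f)     ≡⟨ cong₂ (λ a b → a + - (g y * u) * b) (·-comm c g) (·-comm c f) ⟩
        g · c + - (g y * u) * (f · c)     ≡⟨ ·-linear g (- (g y * u)) f c ⟨
        reduce g · c                      ≡⟨ ·-comm (reduce g) c ⟩
        c · reduce g                      ≡⟨ eq ⟩
        0#                                ∎

    elements : (X : Subset n) → ∃[ x ] (∀ {i} → i ∈ X → ∃[ k ] x k ≡ i)
    elements X = enum X , enum-surjective X
      where
      enum : (X : Subset m) → Fin ∣ X ∣ → Fin m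
      enum (outside ∷ X) k       = suc (enum X k)
      enum (inside  ∷ X) zero    = zero
      enum (inside  ∷ X) (suc k) = suc (enum X k)

      enum-surjective : (X : Subset m) → ∀ {i} → i ∈ X → ∃[ k ] enum X k ≡ i
      enum-surjective (inside  ∷ X) here      = zero , refl
      enum-surjective (outside ∷ X) (there h) =
        let (k , eq) = enum-surjective X h in k , cong suc eq
      enum-surjective (inside  ∷ X) (there h) =
        let (k , eq) = enum-surjective X h in suc k , cong suc eq

  module _ (v : Fin n → Fin d → Carrier) where

    Relation : Subset n → (Fin n → Carrier) → Set
    Relation X c = (∀ i → i ∉ X → c i ≡ 0#) × (∀ j → ∑[ i < n ] (c i * v i j) ≡ 0#)
                 × (∃[ i ] c i ≢ 0#)

    independentOrRelation : ∀ X → LinearlyIndependent v X ⊎ ∃ (Relation X)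
    independentOrRelation X with any? (λ a → relation? (finToFun {q} {n} a))
      where
      relation? : ∀ c → Dec (Relation X c)
      relation? c = all? (λ i → ¬? (i ∈? X) →-dec (c i ≟ 0#))
        ×-dec all? (λ j → ∑[ i < n ] (c i * v i j) ≟ 0#)
        ×-dec any? (λ i → ¬? (c i ≟ 0#))
    ... | yes (a , rel) = inj₂ (finToFun a , rel)
    ... | no none = inj₁ independent
      where
      independent : LinearlyIndependent v X
      independent c sup eq i with c i ≟ 0#
      ... | yes ci≡0 = ci≡0
      ... | no  ci≢0 = contradiction
        ( funToFin c
        , (λ i i∉X → trans (finToFun-funToFin c i) (sup i i∉X))
        , (λ j → trans (·-congˡ (λ i → v i j) (finToFun-funToFin c)) (eq j))
        , i , λ ci≡0 → ci≢0 (trans (sym (finToFun-funToFin c i)) ci≡0)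
        ) none

    linearlyIndependent? : Decidable (LinearlyIndependent v)
    linearlyIndependent? X with independentOrRelation X
    ... | inj₁ ind = yes ind
    ... | inj₂ (c , sup , eq , i , ci≢0) = no λ ind → ci≢0 (ind c sup eq i)

    InSpan : Subset n → Fin n → Set
    InSpan X x = ∃ λ (a : Fin n → Carrier) →
      (∀ i → i ∉ X → a i ≡ 0#) × (∀ j → ∑[ i < n ] (a i * v i j) ≡ v x j)

    private
      inSpan : ∀ {I} x → LinearlyIndependent v I →
               (x ∉ I → ¬ LinearlyIndependent v (I ∪ ⁅ x ⁆)) → InSpan I x
      inSpan {I} x ind dep with x ∈? I
      ... | yes x∈I = δ x , (λ i i∉I → δ-diff x i λ { refl → i∉I x∈I }) , λ j → δ-· x (λ i → v i j)
      ... | no x∉I with independentOrRelation (I ∪ ⁅ x ⁆)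
      ...   | inj₁ ind⁺ = contradiction ind⁺ (dep x∉I)
      ...   | inj₂ (c , sup , eq , k , ck≢0) = a , supₐ , eqₐ
        where
        supᵢ : ∀ {i} → i ∉ I → i ≢ x → c i ≡ 0#
        supᵢ {i} i∉I i≢x = sup i λ h → case x∈p∪q⁻ I ⁅ x ⁆ h of λ where
          (inj₁ i∈I) → i∉I i∈I
          (inj₂ i∈x) → i≢x (x∈⁅y⁆⇒x≡y x i∈x)

        cx≢0 : c x ≢ 0#
        cx≢0 cx≡0 = ck≢0 (ind c sup′ eq k)
          where
          sup′ : ∀ i → i ∉ I → c i ≡ 0#
          sup′ i i∉I with i ≟ x
          ... | yes refl = cx≡0
          ... | no i≢x   = supᵢ i∉I i≢x

        u = proj₁ (invertible cx≢0)

        a : Fin n → Carrier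
        a i = δ x i + - u * c i

        supₐ : ∀ i → i ∉ I → a i ≡ 0#
        supₐ i i∉I with i ≟ x
        ... | yes refl = begin
          δ x x + - u * c x    ≡⟨ cong₂ _+_ (δ-same x) (sym (-‿distribˡ-* u (c x))) ⟩
          1# + - (u * c x)     ≡⟨ cong (λ z → 1# + - z) (proj₂ (invertible cx≢0)) ⟩
          1# + - 1#            ≡⟨ -‿inverseʳ 1# ⟩
          0#                   ∎
        ... | no i≢x = begin
          δ x i + - u * c i    ≡⟨ cong₂ (λ y z → y + - u * z) (δ-diff x i (i≢x ∘ sym)) (supᵢ i∉I i≢x) ⟩
          0# + - u * 0#        ≡⟨ +-identityˡ _ ⟩
          - u * 0#             ≡⟨ zeroʳ _ ⟩
          0#                   ∎

        eqₐ : ∀ j → a · (λ i → v i j) ≡ v x j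
        eqₐ j = begin
          a · (λ i → v i j)    ≡⟨ ·-linear (δ x) (- u) c (λ i → v i j) ⟩
          δ x · (λ i → v i j) + - u * (c · (λ i → v i j))
                               ≡⟨ cong₂ (λ y z → y + - u * z) (δ-· x (λ i → v i j)) (eq j) ⟩
          v x j + - u * 0#     ≡⟨ cong (v x j +_) (zeroʳ _) ⟩
          v x j + 0#           ≡⟨ +-identityʳ _ ⟩
          v x j                ∎

      steinitz : ∀ {I J} → LinearlyIndependent v J → (∀ x → x ∈ J → InSpan I x) →
                 ¬ ∣ I ∣ < ∣ J ∣
      steinitz {I} {J} ind span I<J = ck≢0 (ind c sup zero-combination k)
        where
        A : Fin n → Fin n → Carrier
        A x with x ∈? J
        ... | yes x∈J = proj₁ (span x x∈J)
        ... | no _    = λ _ → 0#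

        A-sup : ∀ x i → i ∉ I → A x i ≡ 0#
        A-sup x i i∉I with x ∈? J
        ... | yes x∈J = proj₁ (proj₂ (span x x∈J)) i i∉I
        ... | no _    = refl

        A-span : ∀ {x} → x ∈ J → ∀ j → A x · (λ i → v i j) ≡ v x j
        A-span {x} x∈J with x ∈? J
        ... | yes x∈J = proj₂ (proj₂ (span x x∈J))
        ... | no x∉J  = contradiction x∈J x∉J

        e        = proj₁ (elements I)
        e-surj   = proj₂ (elements I)
        solution = solve ∣ I ∣ (λ k x → A x (e k)) J I<J
        c    = proj₁ solution
        sup  = proj₁ (proj₂ solution)
        k    = proj₁ (proj₁ (proj₂ (proj₂ solution)))
        ck≢0 = proj₂ (proj₁ (proj₂ (proj₂ solution)))
        sols = proj₂ (proj₂ (proj₂ solution))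

        c·A : ∀ i → c · (λ x → A x i) ≡ 0#
        c·A i with i ∈? I
        ... | yes i∈I = let (k , eₖ≡i) = e-surj i∈I in
                        subst (λ i → c · (λ x → A x i) ≡ 0#) eₖ≡i (sols k)
        ... | no i∉I  = ·-zero c (λ x → A x i)
                          λ x → trans (cong (c x *_) (A-sup x i i∉I)) (zeroʳ _)

        expand : ∀ j x → c x * v x j ≡ ∑[ i < n ] (c x * (A x i * v i j))
        expand j x with x ∈? J
        ... | yes x∈J = trans (cong (c x *_) (sym (proj₂ (proj₂ (span x x∈J)) j))) (*-distribˡ-sum (c x) (λ i → proj₁ (span x x∈J) i * v i j))
        ... | no x∉J = trans (vanish (v x j)) (sym (trans
                         (sum-cong-≗ (λ i → vanish (0# * v i j))) (sum-replicate-zero n)))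
          where
          vanish : ∀ z → c x * z ≡ 0#
          vanish z = trans (cong (_* z) (sup x x∉J)) (zeroˡ z)

        zero-combination : ∀ j → c · (λ x → v x j) ≡ 0#
        zero-combination j = begin
          ∑[ x < n ] (c x * v x j)                           ≡⟨ sum-cong-≗ (expand j) ⟩
          ∑[ x < n ] (∑[ i < n ] (c x * (A x i * v i j)))    ≡⟨ ∑-comm (λ x i → c x * (A x i * v i j)) ⟩
          ∑[ i < n ] (∑[ x < n ] (c x * (A x i * v i j)))    ≡⟨ sum-cong-≗ (λ i → sum-cong-≗ (λ x → sym (*-assoc (c x) (A x i) (v i j)))) ⟩
          ∑[ i < n ] (∑[ x < n ] (c x * A x i * v i j))      ≡⟨ sum-cong-≗ (λ i → sym (*-distribʳ-sum (v i j) (λ x → c x * A x i))) ⟩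
          ∑[ i < n ] (c · (λ x → A x i) * v i j)             ≡⟨ sum-cong-≗ (λ i → trans (cong (_* v i j) (c·A i)) (zeroˡ _)) ⟩
          ∑[ i < n ] 0#                                      ≡⟨ sum-replicate-zero n ⟩
          0#                                                 ∎

    linearMatroid : Matroid n
    linearMatroid = record
      { E          = ⊤
      ; Indep      = LinearlyIndependent v
      ; indep?     = linearlyIndependent?
      ; indep⊆E    = λ _ _ → ∈⊤
      ; ∅-indep    = λ c sup _ i → sup i ∉⊥
      ; hereditary = λ I⊆J ind c sup → ind c λ i i∉J → sup i (i∉J ∘ I⊆J)
      ; augment    = augment′
      }
      where
      augment′ : ∀ {I J} → LinearlyIndependent v I → LinearlyIndependent v J →
                 ∣ I ∣ < ∣ J ∣ → ∃[ e ] e ∈ J × e ∉ I × LinearlyIndependent v (I ∪ ⁅ e ⁆)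
      augment′ {I} {J} indI indJ I<J
        with any? (λ e → (e ∈? J) ×-dec ¬? (e ∈? I) ×-dec linearlyIndependent? (I ∪ ⁅ e ⁆))
      ... | yes found = found
      ... | no none   = contradiction I<J (steinitz {I} {J} indJ
              λ x x∈J → inSpan x indI λ x∉I ind → none (x , x∈J , x∉I , ind))

  Representable : Matroid n → Set
  Representable {n} M = ∃[ d ] ∃[ v ] ∀ X →
    Indep M X ⇔ (X ⊆ E M × LinearlyIndependent {n} {d} v X)

------------------------------------------------------------------------
-- Projective and affine geometries

  -- A one-dimensional subspace of 𝔽ᵏ is represented by its unique vector
  -- whose first nonzero entry is 1, and point enumerates these vectors.
  -- The three lemmas after it show that every one-dimensional subspace is
  -- represented exactly once.

  #points : ℕ → ℕ
  #points zero    = 0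
  #points (suc k) = q ^ k ℕ.+ #points k

  point : ∀ k → Fin (#points k) → Fin k → Carrier
  point (suc k) i =
    [ (λ a → 1# Vector.∷ finToFun {q} {k} a) , (λ b → 0# Vector.∷ point k b) ]′ (splitAt (q ^ k) i)

  point-nonzero : ∀ k i → ∃[ j ] point k i j ≢ 0#
  point-nonzero (suc k) i with splitAt (q ^ k) i
  ... | inj₁ a = zero , 1≢0
  ... | inj₂ b = let (j , nz) = point-nonzero k b in suc j , nz

  point-exists : ∀ k (w : Fin k → Carrier) → (∃[ j ] w j ≢ 0#) →
                 ∃[ i ] ∃[ s ] (∀ j → w j ≡ s * point k i j)
  point-exists (suc k) w (j₀ , wj₀≢0) with w zero ≟ 0#
  ... | no w₀≢0 = a ↑ˡ #points k , w zero , scaled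
    where
    u = proj₁ (invertible w₀≢0)
    a = funToFin (λ j → u * w (suc j))
    scaled : ∀ j → w j ≡ w zero * point (suc k) (a ↑ˡ #points k) j
    scaled j rewrite splitAt-↑ˡ (q ^ k) a (#points k) with j
    ... | zero  = sym (*-identityʳ (w zero))
    ... | suc j = sym (begin
      w zero * finToFun {q} {k} a j   ≡⟨ cong (w zero *_) (finToFun-funToFin (λ j → u * w (suc j)) j) ⟩
      w zero * (u * w (suc j))        ≡⟨ *-assoc (w zero) u (w (suc j)) ⟨
      w zero * u * w (suc j)          ≡⟨ cong (_* w (suc j)) (trans (*-comm (w zero) u) (proj₂ (invertible w₀≢0))) ⟩
      1# * w (suc j)                  ≡⟨ *-identityˡ _ ⟩
      w (suc j)                       ∎)
  ... | yes w₀≡0 = (q ^ k) ↑ʳ i , s , scaled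
    where
    tail-nonzero : ∀ j → w j ≢ 0# → ∃[ j ] w (suc j) ≢ 0#
    tail-nonzero zero    nz = contradiction w₀≡0 nz
    tail-nonzero (suc j) nz = j , nz
    rec = point-exists k (w ∘ suc) (tail-nonzero j₀ wj₀≢0)
    i   = proj₁ rec
    s   = proj₁ (proj₂ rec)
    scaled : ∀ j → w j ≡ s * point (suc k) ((q ^ k) ↑ʳ i) j
    scaled j rewrite splitAt-↑ʳ (q ^ k) (#points k) i with j
    ... | zero  = trans w₀≡0 (sym (zeroʳ s))
    ... | suc j = proj₂ (proj₂ rec) j

  private
    funToFin-cong : {f g : Fin m → Fin n} → f ≗ g → funToFin f ≡ funToFin g
    funToFin-cong {zero}  eq = refl
    funToFin-cong {suc m} eq = cong₂ combine (eq zero) (funToFin-cong (eq ∘ suc))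

  point-unique : ∀ k i i′ s → (∀ j → point k i j ≡ s * point k i′ j) → i ≡ i′
  point-unique (suc k) i i′ s eq
    with splitAt (q ^ k) i in e | splitAt (q ^ k) i′ in e′
  ... | inj₁ a | inj₁ a′ = begin
        i               ≡⟨ splitAt⁻¹-↑ˡ e ⟨
        a ↑ˡ #points k  ≡⟨ cong (_↑ˡ #points k) a≡a′ ⟩
        a′ ↑ˡ #points k ≡⟨ splitAt⁻¹-↑ˡ e′ ⟩
        i′              ∎
    where
    s≡1 : s ≡ 1#
    s≡1 = trans (sym (*-identityʳ s)) (sym (eq zero))
    a≡a′ : a ≡ a′
    a≡a′ = begin
      a                              ≡⟨ funToFin-finToFin {k} {q} a ⟨
      funToFin (finToFun {q} {k} a)  ≡⟨ funToFin-cong (λ j → trans (eq (suc j))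
                                          (trans (cong (_* finToFun {q} {k} a′ j) s≡1) (*-identityˡ _))) ⟩
      funToFin (finToFun {q} {k} a′) ≡⟨ funToFin-finToFin {k} {q} a′ ⟩
      a′                             ∎
  ... | inj₁ a | inj₂ b′ = contradiction (trans (eq zero) (zeroʳ s)) 1≢0
  ... | inj₂ b | inj₁ a′ = contradiction (trans (eq (suc (proj₁ nz)))
          (trans (cong (_* finToFun {q} {k} a′ (proj₁ nz)) (trans (sym (*-identityʳ s)) (sym (eq zero))))
                 (zeroˡ _)))
          (proj₂ nz)
    where nz = point-nonzero k b
  ... | inj₂ b | inj₂ b′ = begin
        i               ≡⟨ splitAt⁻¹-↑ʳ e ⟨
        (q ^ k) ↑ʳ b    ≡⟨ cong ((q ^ k) ↑ʳ_) (point-unique k b b′ s (eq ∘ suc)) ⟩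
        (q ^ k) ↑ʳ b′   ≡⟨ splitAt⁻¹-↑ʳ e′ ⟩
        i′              ∎

  -- PG k is the geometry of rank k, that is, of projective dimension k - 1.
  PG : ∀ k → Matroid (#points k)
  PG k = linearMatroid (point k)

  -- The choice of the hyperplane H does not affect the isomorphism type.
  IsAffineGeometry : ℕ → Matroid n → Set
  IsAffineGeometry k M =
    ∃[ H ] Hyperplane (PG k) H × M ≅ (PG k ↾ (E (PG k) ─ H))

{-# OPTIONS --safe #-}
-- Let S be the set of nonzero multiples of the vectors that represent the
-- elements of M. Suppose that M has no independent flat of rank k, so that any
-- k independent vectors of S have a further combination in S.
--
-- Combining such relations gives vectors of S with many nonzero coefficients in
-- a basis of M (long-vector). If the set of admissible coefficients does not
-- depend on the choice of the basis elements, which a Ramsey argument ensures,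
-- then exchanging basis elements yields a cube u + Σ εᵢ dᵢ in S with
-- coefficients εᵢ in {0,1} (cube). Among many such u with the same dᵢ, the
-- Hales–Jewett theorem finds a combination e₁, …, e_R, with at least p nonzero
-- coefficients, that lies in S for all choices of the words ε, for suitable
-- sums of the dᵢ in place of the dᵢ. As p is prime, the sums of subsets of the
-- eᵢ cover GF(p), so that S contains an affine subspace x₀ + D (cube⇒affine).
--
-- By Ramsey's theorem for points of projective spaces, D contains a subspace of
-- rank k inside S, which gives PG(k-1,p), or a subspace D′ of rank k - 1 outside
-- S, and then x₀ and D′ span AG(k-1,p).

module Submission where

open import Defs
open import Algebra.Bundles using (CommutativeRing)
open import Data.Bool.Base using (true)
open import Data.Fin.Base using (Fin; zero; suc; toℕ; combine; remQuot; funToFin; finToFun; inject≤; _↑ˡ_; _↑ʳ_)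
open import Data.Fin.Properties
  using (_≟_; any?; injective⇒≤; finToFun-funToFin; funToFin-finToFin; suc-injective; 0≢1+n;
         combine-remQuot; remQuot-combine; combine-injective; inject≤-injective; ↑ˡ-injective; ↑ʳ-injective)
open import Data.Fin.Subset as Subset using (Subset; inside; outside; ⁅_⁆; ∣_∣; _⊆_; _∪_; _─_; ⊤)
open import Data.Fin.Subset.Properties
  using (∣p∣≤n; x∈p⇒∣p-x∣<∣p∣; x∈p∧x≢y⇒x∈p-y; p⊆q⇒∣p∣≤∣q∣; p⊂q⇒∣p∣<∣q∣; ∣⁅x⁆∣≡1; x∈⁅y⁆⇒x≡y; x∈⁅x⁆;
         x∈p∩q⁺; x∈p∩q⁻; x∈p∪q⁺; x∈p∪q⁻; x∈p∧x∉q⇒x∈p─q; ∈⊤; ∉⊥; _∈?_; _⊆?_; anySubset?)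
open import Data.List.Base as List using ()
open import Data.List.Extrema.Nat using (v≤max⁺; max≤v⁺)
import Data.List.Membership.Propositional as List
import Data.List.Membership.Propositional.Properties as Listₚ
open import Data.List.Relation.Unary.All as All using (All)
import Data.List.Relation.Unary.Any as ListAny
open import Data.Maybe.Base as Maybe using (Maybe; just; nothing; fromMaybe)
open import Data.Nat.Base as ℕ using (ℕ; zero; suc; _≤_; _<_; NonZero)
open import Data.Nat.DivMod using (_mod_)
open import Data.Nat.Primality using (Prime; prime⇒nonZero)
import Data.Nat.Properties as ℕₚ
open import Data.Product.Base as Product using (∃; ∃-syntax; _×_; _,_; proj₁; proj₂; uncurry)
open import Data.Sum.Base as Sum using (_⊎_; inj₁; inj₂; [_,_]′)
open import Data.Vec.Base as Vec
  using (Vec; []; _∷_; _++_; map; concat; head; lookup; replicate; tabulate; zipWith; here; there)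
open import Data.Vec.Membership.Propositional using (_∈_)
open import Data.Vec.Membership.Propositional.Properties using (∈-++⁺ˡ; ∈-++⁺ʳ; ∈-map⁺; ∈-tabulate⁺)
open import Data.Vec.Properties
  using (∷-injectiveˡ; ∷-injectiveʳ; ≡-dec; []=⇒lookup; lookup⇒[]=; lookup-map; lookup-replicate; lookup-zipWith;
         lookup∘tabulate; map-++; map-concat; map-cong; map-const; map-id; map-∘;
         tabulate-cong; tabulate-∘; tabulate∘lookup)
open import Data.Vec.Properties.WithK using ([]=-irrelevant)
open import Data.Vec.Relation.Unary.Any as Any using (here; there)
import Data.Vec.Relation.Unary.Any.Properties as Anyₚ
open import Function.Base using (_∘_; id; const; case_of_)
open import Function.Bundles using (_⇔_; mk⇔; mk↔ₛ′; Equivalence)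
open import Relation.Binary.PropositionalEquality
open import Relation.Nullary using (Dec; yes; no; does; ¬_; contradiction; ¬?; _×-dec_)
open import Relation.Nullary.Decidable using (map′)
open import Relation.Unary using (Decidable)

-- The coefficients of a relation in `S` depend on the vectors for which it was found, so exchanging
-- one of those vectors may lead out of `S`. Both exchange steps avoid this by colouring a choice of
-- vectors with the set of all coefficient vectors whose combination lies in `S`; the number of
-- colours depends only on how many vectors are combined. Once Hales-Jewett has made this set
-- constant, a long vector is sought at one choice only, and whatever it turns out to be, it works
-- at all of them.
--
-- The length pays for freedom. In the first step each nonzero coefficient but one yields a
-- direction of the cube. In the second, many choices of 0 or 1 are traded for one arbitrary field
-- element; over a nonprime field this fails when all coefficients lie in a proper subfield, since
-- their subset sums stay there.
--
-- Everything is read in coordinates: a subspace is an injective linear map, `S` is pulled back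
-- along it, and the three outcomes are pushed forward by composition. The bounds therefore depend
-- neither on `M` nor on its representation.

-- Finite alphabets and monochromatic combinatorial subspaces

module HalesJewett where

  private
    variable
      A B : Set
      a c k m n r : ℕ

  record Finite (A : Set) : Set where
    field
      size          : ℕ
      encode        : A → Fin size
      decode        : Fin size → A
      decode-encode : ∀ x → decode (encode x) ≡ x

    encode-injective : ∀ {x y} → encode x ≡ encode y → x ≡ y
    encode-injective {x} {y} eq =
      trans (sym (decode-encode x)) (trans (cong decode eq) (decode-encode y))

    any-finite? : ∀ {P : A → Set} → Decidable P → Dec (∃ P)
    any-finite? {P} P? = map′ (λ (i , p) → decode i , p)
      (λ (x , p) → encode x , subst P (sym (decode-encode x)) p) (any? (P? ∘ decode))

  Fin-finite : Finite (Fin n)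
  Fin-finite = record { encode = id ; decode = id ; decode-encode = λ _ → refl }

  Vec-finite : Finite A → Finite (Vec A n)
  Vec-finite {n = n} fin = record
    { size          = size ℕ.^ n
    ; encode        = λ xs → funToFin (encode ∘ lookup xs)
    ; decode        = λ i → tabulate (decode ∘ finToFun i)
    ; decode-encode = λ xs → trans
        (tabulate-cong λ j → trans (cong decode (finToFun-funToFin (encode ∘ lookup xs) j))
                                   (decode-encode (lookup xs j)))
        (tabulate∘lookup xs)
    }
    where open Finite fin

  -- The Hales–Jewett theorem

  fill : Vec (Maybe A) n → A → Vec A n
  fill P x = map (fromMaybe x) P

  fill-just : (xs : Vec A n) (x : A) → fill (map just xs) x ≡ xs
  fill-just xs x = trans (sym (map-∘ (fromMaybe x) just xs)) (map-id xs)

  MonochromaticLine : (Vec (Fin a) n → Fin c) → Set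
  MonochromaticLine {a} {n} χ =
    ∃[ P ] nothing ∈ P × (∀ (x y : Fin a) → χ (fill {n = n} P x) ≡ χ (fill P y))

  -- Lines with a common end point at the letter zero that are monochromatic
  -- away from it, in distinct colours which also differ from that of the end
  -- point.
  record Focused (χ : Vec (Fin (suc a)) n → Fin c) (r : ℕ) : Set where
    field
      focus    : Vec (Fin (suc a)) n
      line     : Fin r → Vec (Maybe (Fin (suc a))) n
      colour   : Fin r → Fin c
      active   : ∀ i → nothing ∈ line i
      end      : ∀ i → fill (line i) zero ≡ focus
      body     : ∀ i x → χ (fill (line i) (suc x)) ≡ colour i
      distinct : ∀ {i j} → colour i ≡ colour j → i ≡ j
      fresh    : ∀ i → colour i ≢ χ focus

  -- While the prefix moves along `P` away from its end point, `χ` sees only the suffix. So each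
  -- focused line of `χ′` can move together with `P`, and `P` followed by the old focus is one more
  -- line, whose colour `χ′ focus` is new by `fresh`. If the new focus repeats one of the `suc r`
  -- colours, that line is monochromatic.
  extend : (χ : Vec (Fin (suc a)) (m ℕ.+ n) → Fin c) (χ′ : Vec (Fin (suc a)) n → Fin c)
           (P : Vec (Maybe (Fin (suc a))) m) → nothing ∈ P →
           (∀ x ys → χ (fill P (suc x) ++ ys) ≡ χ′ ys) →
           Focused χ′ r → MonochromaticLine χ ⊎ Focused χ (suc r)
  extend {a} {m} {n} {c} {r} χ χ′ P nothing∈P agree F = split (any? λ i → colour⁺ i ≟ χ focus⁺)
    where
    open Focused F
    focus⁺ = fill P zero ++ focus

    line⁺ : Fin (suc r) → Vec (Maybe (Fin (suc a))) (m ℕ.+ n)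
    line⁺ zero    = P ++ map just focus
    line⁺ (suc i) = P ++ line i

    colour⁺ : Fin (suc r) → Fin c
    colour⁺ zero    = χ′ focus
    colour⁺ (suc i) = colour i

    active⁺ : ∀ i → nothing ∈ line⁺ i
    active⁺ zero    = ∈-++⁺ˡ nothing∈P
    active⁺ (suc i) = ∈-++⁺ˡ nothing∈P

    fill-++ : ∀ (Q : Vec _ n) x {ys} → fill Q x ≡ ys → fill (P ++ Q) x ≡ fill P x ++ ys
    fill-++ Q x eq = trans (map-++ (fromMaybe x) P Q) (cong (fill P x ++_) eq)

    end⁺ : ∀ i → fill (line⁺ i) zero ≡ focus⁺
    end⁺ zero    = fill-++ (map just focus) zero (fill-just focus zero)
    end⁺ (suc i) = fill-++ (line i) zero (end i)

    body⁺ : ∀ i x → χ (fill (line⁺ i) (suc x)) ≡ colour⁺ i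
    body⁺ zero    x = trans (cong χ (fill-++ (map just focus) (suc x) (fill-just focus (suc x))))
                            (agree x focus)
    body⁺ (suc i) x = trans (cong χ (fill-++ (line i) (suc x) refl)) (trans (agree x _) (body i x))

    distinct⁺ : ∀ i j → colour⁺ i ≡ colour⁺ j → i ≡ j
    distinct⁺ zero    zero    _  = refl
    distinct⁺ zero    (suc j) eq = contradiction (sym eq) (fresh j)
    distinct⁺ (suc i) zero    eq = contradiction eq (fresh i)
    distinct⁺ (suc i) (suc j) eq = cong suc (distinct eq)

    split : Dec (∃[ i ] colour⁺ i ≡ χ focus⁺) → MonochromaticLine χ ⊎ Focused χ (suc r)
    split (yes (i , eq)) = inj₁ (line⁺ i , active⁺ i , λ x y → trans (mono x) (sym (mono y)))
      where
      mono : ∀ x → χ (fill (line⁺ i) x) ≡ colour⁺ i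
      mono zero    = trans (cong χ (end⁺ i)) (sym eq)
      mono (suc x) = body⁺ i x
    split (no none) = inj₂ record
      { focus = focus⁺ ; line = line⁺ ; colour = colour⁺ ; active = active⁺ ; end = end⁺
      ; body = body⁺ ; distinct = λ {i} {j} → distinct⁺ i j ; fresh = λ i eq → none (i , eq) }

  HalesJewett : ℕ → ℕ → Set
  HalesJewett a c = ∃[ n ] ∀ (χ : Vec (Fin a) n → Fin c) → MonochromaticLine χ

  focusing : (∀ c → HalesJewett (suc a) c) → ∀ c r →
             ∃[ n ] ∀ (χ : Vec (Fin (suc (suc a))) n → Fin c) → MonochromaticLine χ ⊎ Focused χ r
  focusing hj c zero = 0 , λ χ → inj₂ record
    { focus = [] ; line = λ () ; colour = λ () ; active = λ () ; end = λ () ; body = λ ()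
    ; distinct = λ {} ; fresh = λ () }
  focusing {a} hj c (suc r) = M ℕ.+ N , step
    where
    N = proj₁ (focusing hj c r)
    suffixes : Finite (Vec (Fin (suc (suc a))) N)
    suffixes = Vec-finite Fin-finite
    profiles : Finite (Vec (Fin c) (Finite.size suffixes))
    profiles = Vec-finite Fin-finite
    open Finite
    -- The suffix length `N` is fixed first, because the colour of a prefix is the whole colouring
    -- that it induces on the suffixes.
    M = proj₁ (hj (size profiles))

    step : ∀ χ → MonochromaticLine χ ⊎ Focused χ (suc r)
    step χ = [ inj₁ ∘ prefix , extend χ χ′ P nothing∈P agree ]′ (proj₂ (focusing hj c r) χ′)
      where
      -- Only prefixes without the letter `zero` are coloured: they use one letter fewer, so the
      -- induction hypothesis applies, and `zero` stays free for the focus.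
      profile : Vec (Fin (suc a)) M → Vec (Fin c) (size suffixes)
      profile xs = tabulate λ i → χ (map suc xs ++ decode suffixes i)

      monochromatic = proj₂ (hj (size profiles)) (encode profiles ∘ profile)
      P₀ = proj₁ monochromatic
      P  = map (Maybe.map suc) P₀

      nothing∈P : nothing ∈ P
      nothing∈P = ∈-map⁺ (Maybe.map suc) (proj₁ (proj₂ monochromatic))

      lookup-profile : ∀ xs ys → lookup (profile xs) (encode suffixes ys) ≡ χ (map suc xs ++ ys)
      lookup-profile xs ys = trans (lookup∘tabulate _ (encode suffixes ys))
        (cong (λ zs → χ (map suc xs ++ zs)) (decode-encode suffixes ys))

      fill-P : ∀ x → fill P (suc x) ≡ map suc (fill P₀ x)
      fill-P x = trans (sym (map-∘ _ _ P₀)) (trans (map-cong (λ { nothing → refl ; (just _) → refl }) P₀)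
        (map-∘ _ _ P₀))

      χ′ : Vec (Fin (suc (suc a))) N → Fin c
      χ′ ys = χ (fill P (suc zero) ++ ys)

      agree : ∀ x ys → χ (fill P (suc x) ++ ys) ≡ χ′ ys
      agree x ys = begin
        χ (fill P (suc x) ++ ys)
          ≡⟨ cong (λ zs → χ (zs ++ ys)) (fill-P x) ⟩
        χ (map suc (fill P₀ x) ++ ys)
          ≡⟨ lookup-profile (fill P₀ x) ys ⟨
        lookup (profile (fill P₀ x)) (encode suffixes ys)
          ≡⟨ cong (λ v → lookup v (encode suffixes ys))
               (encode-injective profiles {profile (fill P₀ x)} {profile (fill P₀ zero)}
                 (proj₂ (proj₂ monochromatic) x zero)) ⟩
        lookup (profile (fill P₀ zero)) (encode suffixes ys)
          ≡⟨ lookup-profile (fill P₀ zero) ys ⟩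
        χ (map suc (fill P₀ zero) ++ ys)
          ≡⟨ cong (λ zs → χ (zs ++ ys)) (fill-P zero) ⟨
        χ′ ys
          ∎
        where open ≡-Reasoning

      prefix : MonochromaticLine χ′ → MonochromaticLine χ
      prefix (Q , nothing∈Q , mono) =
        map just u ++ Q , ∈-++⁺ʳ (map just u) nothing∈Q ,
        λ x y → trans (cong χ (split x)) (trans (mono x y) (cong χ (sym (split y))))
        where
        u = fill P (suc zero)
        split : ∀ x → fill (map just u ++ Q) x ≡ u ++ fill Q x
        split x = trans (map-++ (fromMaybe x) (map just u) Q) (cong (_++ fill Q x) (fill-just u x))

  -- By pigeonhole: `c` focused lines and their focus would show `suc c` different colours.
  hales-jewett-step : (∀ c → HalesJewett (suc a) c) → ∀ c → HalesJewett (suc (suc a)) c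
  hales-jewett-step hj c = N , λ χ → [ id , impossible χ ]′ (focus χ)
    where
    N     = proj₁ (focusing hj c c)
    focus = proj₂ (focusing hj c c)

    impossible : ∀ χ → Focused χ c → MonochromaticLine χ
    impossible χ F = contradiction (injective⇒≤ injective) ℕₚ.1+n≰n
      where
      open Focused F renaming (focus to f)
      colours : Fin (suc c) → Fin c
      colours zero    = χ f
      colours (suc i) = colour i
      injective : ∀ {i j} → colours i ≡ colours j → i ≡ j
      injective {zero}  {zero}  _  = refl
      injective {zero}  {suc j} eq = contradiction (sym eq) (fresh j)
      injective {suc i} {zero}  eq = contradiction eq (fresh i)
      injective {suc i} {suc j} eq = cong suc (distinct eq)

  hales-jewett : ∀ a c → HalesJewett a c
  hales-jewett zero    c = 1 , λ χ → nothing ∷ [] , here refl , λ ()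
  -- A base case of its own: the focusing step compares with the letter `suc zero`, which needs two
  -- letters.
  hales-jewett (suc zero) c = 1 , λ χ → nothing ∷ [] , here refl , λ { zero zero → refl }
  hales-jewett (suc (suc a)) c = hales-jewett-step (hales-jewett (suc a)) c

  substitute : Vec (A ⊎ B) n → (B → A) → Vec A n
  substitute P η = map [ id , η ]′ P

  -- A line over the alphabet of words of length `k` is a `k`-dimensional subspace over `A`: each
  -- active letter unfolds to a block that contains all `k` variables.
  hales-jewett-subspace : Finite A → Finite B → ∀ k →
    ∃[ m ] ∀ (χ : Vec A m → B) → ∃[ P ] (∀ (l : Fin k) → inj₂ l ∈ P) ×
      (∀ η η′ → χ (substitute P (lookup η)) ≡ χ (substitute P (lookup η′)))
  hales-jewett-subspace {A} {B} finA finB k = N ℕ.* k , subspace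
    where
    open Finite
    words : Finite (Vec A k)
    words = Vec-finite finA
    N = proj₁ (hales-jewett (size words) (size finB))

    subspace : (χ : Vec A (N ℕ.* k) → B) → ∃[ P ] (∀ (l : Fin k) → inj₂ l ∈ P) ×
      (∀ η η′ → χ (substitute P (lookup η)) ≡ χ (substitute P (lookup η′)))
    subspace χ = concat (map block Q) ,
      (λ l → Anyₚ.concat⁺ (Any.map (λ { refl → ∈-tabulate⁺ inj₂ l }) (∈-map⁺ block nothing∈Q))) ,
      λ η η′ → encode-injective finB (trans (cong (encode finB ∘ χ) (expand η))
        (trans (mono (encode words η) (encode words η′)) (cong (encode finB ∘ χ) (sym (expand η′)))))
      where
      monochromatic = proj₂ (hales-jewett (size words) (size finB))
                        (encode finB ∘ χ ∘ concat ∘ map (decode words))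
      Q         = proj₁ monochromatic
      nothing∈Q = proj₁ (proj₂ monochromatic)
      mono      = proj₂ (proj₂ monochromatic)

      block : Maybe (Fin (size words)) → Vec (A ⊎ Fin k) k
      block (just i) = map inj₁ (decode words i)
      block nothing  = tabulate inj₂

      substitute-block : ∀ η j → substitute (block j) (lookup η) ≡
                                 decode words (fromMaybe (encode words η) j)
      substitute-block η (just i) = trans (sym (map-∘ _ inj₁ (decode words i))) (map-id _)
      substitute-block η nothing  = trans (sym (tabulate-∘ _ inj₂))
        (trans (tabulate∘lookup η) (sym (decode-encode words η)))

      expand : ∀ η → substitute (concat (map block Q)) (lookup η) ≡
                     concat (map (decode words) (fill Q (encode words η)))
      expand η = trans (map-concat _ (map block Q)) (cong concat (trans (sym (map-∘ _ block Q))
        (trans (map-cong (substitute-block η) Q) (map-∘ (decode words) _ Q))))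

open HalesJewett

-- Vectors over a finite field and injective linear maps

module LinearAlgebra {q : ℕ} (𝔽 : FiniteField q) where

  open FiniteField 𝔽 using (commutativeRing; 1≢0; invertible) public
  open CommutativeRing commutativeRing
    using (_+_; _*_; -_; 0#; 1#; +-identityˡ; +-identityʳ; +-assoc; +-comm; -‿inverseʳ;
           *-identityˡ; *-identityʳ; *-assoc; *-comm; zeroˡ; zeroʳ; distribˡ; distribʳ) public
  open import Algebra.Properties.Ring (CommutativeRing.ring commutativeRing)
    using (-‿distribˡ-*; -‿involutive) public
  open import Algebra.Properties.Semiring.Sum (CommutativeRing.semiring commutativeRing)
    using (sum; sum-syntax; sum-cong-≗; ∑-distrib-+; *-distribˡ-sum; sum-replicate-zero) public

  F : Set
  F = Fin q

  private
    variable
      m n d k : ℕ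

  infixl 6 _⊕_
  infixr 7 _⊙_

  0⃗ : Vec F n
  0⃗ = replicate _ 0#

  _⊕_ : Vec F n → Vec F n → Vec F n
  _⊕_ = zipWith _+_

  _⊙_ : F → Vec F n → Vec F n
  a ⊙ x = map (a *_) x

  unit : Fin n → Vec F n
  unit zero    = 1# ∷ 0⃗
  unit (suc i) = 0# ∷ unit i

  lookup-ext : {x y : Vec F n} → (∀ i → lookup x i ≡ lookup y i) → x ≡ y
  lookup-ext {x = x} {y} eq =
    trans (sym (tabulate∘lookup x)) (trans (tabulate-cong eq) (tabulate∘lookup y))

  lookup-⊕ : (x y : Vec F n) (i : Fin n) → lookup (x ⊕ y) i ≡ lookup x i + lookup y i
  lookup-⊕ x y i = lookup-zipWith _+_ i x y

  lookup-⊙ : (a : F) (x : Vec F n) (i : Fin n) → lookup (a ⊙ x) i ≡ a * lookup x i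
  lookup-⊙ a x i = lookup-map i (a *_) x

  lookup-0⃗ : (i : Fin n) → lookup 0⃗ i ≡ 0#
  lookup-0⃗ i = lookup-replicate i 0#

  unit-same : (i : Fin n) → lookup (unit i) i ≡ 1#
  unit-same zero    = refl
  unit-same (suc i) = unit-same i

  unit-other : {i j : Fin n} → i ≢ j → lookup (unit i) j ≡ 0#
  unit-other {i = zero}  {zero}  i≢j = contradiction refl i≢j
  unit-other {i = zero}  {suc j} i≢j = lookup-0⃗ j
  unit-other {i = suc i} {zero}  i≢j = refl
  unit-other {i = suc i} {suc j} i≢j = unit-other (i≢j ∘ cong suc)

  vectors : Finite (Vec F n)
  vectors = Vec-finite Fin-finite

  nonzero-entry : {x : Vec F n} → x ≢ 0⃗ → ∃[ i ] lookup x i ≢ 0#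
  nonzero-entry {x = x} x≢0 with any? (λ i → ¬? (lookup x i ≟ 0#))
  ... | yes found = found
  ... | no none   = contradiction (lookup-ext zero-entry) x≢0
    where
    zero-entry : ∀ i → lookup x i ≡ lookup 0⃗ i
    zero-entry i with lookup x i ≟ 0#
    ... | yes eq = trans eq (sym (lookup-0⃗ i))
    ... | no neq = contradiction (i , neq) none

  *-nonzero : ∀ {a b} → a ≢ 0# → b ≢ 0# → a * b ≢ 0#
  *-nonzero {a} {b} a≢0 b≢0 ab≡0 = b≢0 (begin
    b              ≡⟨ *-identityˡ b ⟨
    1# * b         ≡⟨ cong (_* b) (proj₂ (invertible a≢0)) ⟨
    u * a * b      ≡⟨ *-assoc u a b ⟩
    u * (a * b)    ≡⟨ cong (u *_) ab≡0 ⟩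
    u * 0#         ≡⟨ zeroʳ u ⟩
    0#             ∎)
    where
    open ≡-Reasoning
    u = proj₁ (invertible a≢0)

  *-zero : ∀ {a b} → a * b ≡ 0# → b ≢ 0# → a ≡ 0#
  *-zero {a} ab≡0 b≢0 with a ≟ 0#
  ... | yes a≡0 = a≡0
  ... | no a≢0  = contradiction ab≡0 (*-nonzero a≢0 b≢0)

  inverse : ∀ {a} → a ≢ 0# → F
  inverse a≢0 = proj₁ (invertible a≢0)

  inverse-nonzero : ∀ {a} (a≢0 : a ≢ 0#) → inverse a≢0 ≢ 0#
  inverse-nonzero {a} a≢0 u≡0 =
    1≢0 (trans (sym (proj₂ (invertible a≢0))) (trans (cong (_* a) u≡0) (zeroˡ a)))

  0⊙ : (x : Vec F n) → 0# ⊙ x ≡ 0⃗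
  0⊙ x = lookup-ext λ i → trans (lookup-⊙ 0# x i) (trans (zeroˡ _) (sym (lookup-0⃗ i)))

  ⊙0 : (a : F) → a ⊙ 0⃗ {n} ≡ 0⃗
  ⊙0 a = lookup-ext λ i → trans (lookup-⊙ a 0⃗ i)
    (trans (cong (a *_) (lookup-0⃗ i)) (trans (zeroʳ a) (sym (lookup-0⃗ i))))

  1⊙ : (x : Vec F n) → 1# ⊙ x ≡ x
  1⊙ x = lookup-ext λ i → trans (lookup-⊙ 1# x i) (*-identityˡ _)

  ⊙-assoc : (a b : F) (x : Vec F n) → a ⊙ b ⊙ x ≡ (a * b) ⊙ x
  ⊙-assoc a b x = lookup-ext λ i → trans (lookup-⊙ a (b ⊙ x) i) (trans (cong (a *_) (lookup-⊙ b x i))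
    (trans (sym (*-assoc a b _)) (sym (lookup-⊙ (a * b) x i))))

  ⊙-inverse : ∀ {a} (a≢0 : a ≢ 0#) (x : Vec F n) → inverse a≢0 ⊙ a ⊙ x ≡ x
  ⊙-inverse a≢0 x = trans (⊙-assoc _ _ x) (trans (cong (_⊙ x) (proj₂ (invertible a≢0))) (1⊙ x))

  ⊕-identityˡ : (x : Vec F n) → 0⃗ ⊕ x ≡ x
  ⊕-identityˡ x = lookup-ext λ i → trans (lookup-⊕ 0⃗ x i)
    (trans (cong (_+ lookup x i) (lookup-0⃗ i)) (+-identityˡ _))

  ⊕-identityʳ : (x : Vec F n) → x ⊕ 0⃗ ≡ x
  ⊕-identityʳ x = lookup-ext λ i → trans (lookup-⊕ x 0⃗ i)
    (trans (cong (lookup x i +_) (lookup-0⃗ i)) (+-identityʳ _))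

  unit-nonzero : (i : Fin n) → unit i ≢ 0⃗
  unit-nonzero i eq = 1≢0 (trans (sym (unit-same i)) (trans (cong (λ x → lookup x i) eq) (lookup-0⃗ i)))

  a-1a : ∀ a → a + (- 1#) * a ≡ 0#
  a-1a a = trans (cong (a +_) (trans (sym (-‿distribˡ-* 1# a)) (cong -_ (*-identityˡ a)))) (-‿inverseʳ a)

  ⊖-self : (x : Vec F n) → x ⊕ (- 1#) ⊙ x ≡ 0⃗
  ⊖-self x = lookup-ext λ i → trans (lookup-⊕ x _ i) (trans (cong (lookup x i +_) (lookup-⊙ (- 1#) x i))
    (trans (a-1a _) (sym (lookup-0⃗ i))))

  ⊖-cancel : (x y : Vec F n) → x ⊕ (- 1#) ⊙ y ≡ 0⃗ → x ≡ y
  ⊖-cancel x y eq = lookup-ext λ i → begin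
    lookup x i                                        ≡⟨ +-identityʳ _ ⟨
    lookup x i + 0#                                   ≡⟨ cong (lookup x i +_) (trans (+-comm _ _) (a-1a (lookup y i))) ⟨
    lookup x i + ((- 1#) * lookup y i + lookup y i)   ≡⟨ +-assoc _ _ _ ⟨
    lookup x i + (- 1#) * lookup y i + lookup y i     ≡⟨ cong (λ z → lookup x i + z + lookup y i) (lookup-⊙ (- 1#) y i) ⟨
    lookup x i + lookup ((- 1#) ⊙ y) i + lookup y i   ≡⟨ cong (_+ lookup y i) (lookup-⊕ x _ i) ⟨
    lookup (x ⊕ (- 1#) ⊙ y) i + lookup y i            ≡⟨ cong (λ z → lookup z i + lookup y i) eq ⟩
    lookup {n = _} 0⃗ i + lookup y i                   ≡⟨ cong (_+ lookup y i) (lookup-0⃗ i) ⟩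
    0# + lookup y i                                   ≡⟨ +-identityˡ _ ⟩
    lookup y i                                        ∎
    where open ≡-Reasoning

  ⊖-involutive : (x : Vec F n) → (- 1#) ⊙ (- 1#) ⊙ x ≡ x
  ⊖-involutive x = trans (⊙-assoc (- 1#) (- 1#) x) (trans (cong (_⊙ x)
    (trans (sym (-‿distribˡ-* 1# (- 1#))) (trans (cong -_ (*-identityˡ _)) (-‿involutive 1#)))) (1⊙ x))

  sum-single : {t : Fin n → F} (i : Fin n) → (∀ j → j ≢ i → t j ≡ 0#) → sum t ≡ t i
  sum-single {suc n} {t} zero    eq = trans (cong (t zero +_) (trans (sum-cong-≗ λ j → eq (suc j) λ ())
    (sum-replicate-zero n))) (+-identityʳ _)
  sum-single {suc n} {t} (suc i) eq = trans (cong₂ _+_ (eq zero λ ())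
    (sum-single {t = t ∘ suc} i λ j j≢i → eq (suc j) (j≢i ∘ suc-injective))) (+-identityˡ _)

  -- Linear maps

  record IsLinear (f : Vec F m → Vec F n) : Set where
    field
      ⊕-homo : ∀ x y → f (x ⊕ y) ≡ f x ⊕ f y
      ⊙-homo : ∀ a x → f (a ⊙ x) ≡ a ⊙ f x

    0⃗-homo : f 0⃗ ≡ 0⃗
    0⃗-homo = trans (cong f (sym (0⊙ 0⃗))) (trans (⊙-homo 0# 0⃗) (0⊙ _))

  open IsLinear public

  -- A subspace of dimension `m` together with a basis, the images of the unit vectors. Passing to
  -- smaller subspaces is composition.
  infix 4 _↪_

  record _↪_ (m n : ℕ) : Set where
    field
      to     : Vec F m → Vec F n
      linear : IsLinear to
      kernel : ∀ {x} → to x ≡ 0⃗ → x ≡ 0⃗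

    injective : ∀ {x y} → to x ≡ to y → x ≡ y
    injective {x} {y} eq = ⊖-cancel x y (kernel (begin
      to (x ⊕ (- 1#) ⊙ y)       ≡⟨ ⊕-homo linear x _ ⟩
      to x ⊕ to ((- 1#) ⊙ y)    ≡⟨ cong₂ _⊕_ eq (⊙-homo linear (- 1#) y) ⟩
      to y ⊕ (- 1#) ⊙ to y      ≡⟨ ⊖-self (to y) ⟩
      0⃗                         ∎))
      where open ≡-Reasoning

  open _↪_ public

  id-↪ : n ↪ n
  id-↪ = record { to = id ; linear = record { ⊕-homo = λ _ _ → refl ; ⊙-homo = λ _ _ → refl } ; kernel = id }

  infixr 9 _∘↪_

  ∘-linear : {f : Vec F n → Vec F k} {g : Vec F m → Vec F n} →
             IsLinear f → IsLinear g → IsLinear (f ∘ g)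
  ∘-linear {f = f} f-lin g-lin = record
    { ⊕-homo = λ x y → trans (cong f (⊕-homo g-lin x y)) (⊕-homo f-lin _ _)
    ; ⊙-homo = λ a x → trans (cong f (⊙-homo g-lin a x)) (⊙-homo f-lin a _) }

  _∘↪_ : n ↪ k → m ↪ n → m ↪ k
  f ∘↪ g = record
    { to = to f ∘ to g ; linear = ∘-linear (linear f) (linear g) ; kernel = kernel g ∘ kernel f }

  private
    Fin-unique : ∀ {r} → r ≤ 1 → (i j : Fin r) → i ≡ j
    Fin-unique (ℕ.s≤s ℕ.z≤n) zero zero = refl

    q>1 : 1 ℕ.< q
    q>1 = ℕₚ.≰⇒> λ q≤1 → 1≢0 (Fin-unique q≤1 1# 0#)

    funToFin-cong : {f g : Fin m → Fin n} → f ≗ g → funToFin f ≡ funToFin g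
    funToFin-cong {zero}  eq = refl
    funToFin-cong {suc m} eq = cong₂ combine (eq zero) (funToFin-cong (eq ∘ suc))

  -- Over a finite field dimensions can be compared by counting: `q ^ m` vectors inject into
  -- `q ^ n`.
  ↪⇒≤ : m ↪ n → m ≤ n
  ↪⇒≤ {m} {n} f = ℕₚ.≮⇒≥ λ n<m →
    ℕₚ.<⇒≱ (ℕₚ.^-monoʳ-< q q>1 n<m) (injective⇒≤ code-injective)
    where
    open Finite (vectors {n}) using (encode; encode-injective)
    vector : Fin (q ℕ.^ m) → Vec F m
    vector i = tabulate (finToFun {q} {m} i)

    vector-injective : ∀ {i j} → vector i ≡ vector j → i ≡ j
    vector-injective {i} {j} eq = begin
      i                           ≡⟨ funToFin-finToFin {m} {q} i ⟨
      funToFin (finToFun {q} {m} i) ≡⟨ funToFin-cong (λ l → trans (sym (lookup∘tabulate _ l))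
                                       (trans (cong (λ x → lookup x l) eq) (lookup∘tabulate _ l))) ⟩
      funToFin (finToFun {q} {m} j) ≡⟨ funToFin-finToFin {m} {q} j ⟩
      j                           ∎
      where open ≡-Reasoning

    code-injective : ∀ {i j} → encode (to f (vector i)) ≡ encode (to f (vector j)) → i ≡ j
    code-injective {i} {j} eq = vector-injective (injective f
      (encode-injective {to f (vector i)} {to f (vector j)} eq))

  mat : (Fin m → Vec F n) → Vec F m → Vec F n
  mat w []      = 0⃗
  mat w (a ∷ x) = a ⊙ w zero ⊕ mat (w ∘ suc) x

  lookup-mat : (w : Fin m → Vec F n) (x : Vec F m) (j : Fin n) →
               lookup (mat w x) j ≡ ∑[ i < m ] (lookup x i * lookup (w i) j)
  lookup-mat w []      j = lookup-0⃗ j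
  lookup-mat w (a ∷ x) j = trans (lookup-⊕ (a ⊙ w zero) _ j)
    (cong₂ _+_ (lookup-⊙ a (w zero) j) (lookup-mat (w ∘ suc) x j))

  pointwise-linear : {f : Vec F m → Vec F n} →
    (∀ x y j → lookup (f (x ⊕ y)) j ≡ lookup (f x) j + lookup (f y) j) →
    (∀ a x j → lookup (f (a ⊙ x)) j ≡ a * lookup (f x) j) → IsLinear f
  pointwise-linear {f = f} f-⊕ f-⊙ = record
    { ⊕-homo = λ x y → lookup-ext λ j → trans (f-⊕ x y j) (sym (lookup-⊕ (f x) (f y) j))
    ; ⊙-homo = λ a x → lookup-ext λ j → trans (f-⊙ a x j) (sym (lookup-⊙ a (f x) j)) }

  map-linear : {A : Set} (xs : Vec A n) {f : Vec F m → A → F} →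
    (∀ x y a → f (x ⊕ y) a ≡ f x a + f y a) → (∀ c x a → f (c ⊙ x) a ≡ c * f x a) →
    IsLinear (λ x → map (f x) xs)
  map-linear xs {f} f-⊕ f-⊙ = pointwise-linear
    (λ x y j → trans (lookup-map j _ xs) (trans (f-⊕ x y _)
      (sym (cong₂ _+_ (lookup-map j _ xs) (lookup-map j _ xs)))))
    (λ c x j → trans (lookup-map j _ xs) (trans (f-⊙ c x _)
      (sym (cong (c *_) (lookup-map j _ xs)))))

  mat-linear : (w : Fin m → Vec F n) → IsLinear (mat w)
  mat-linear {m} w = pointwise-linear
    (λ x y j → trans (lookup-mat w (x ⊕ y) j) (trans
      (sum-cong-≗ λ i → trans (cong (_* lookup (w i) j) (lookup-⊕ x y i)) (distribʳ _ _ _))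
      (trans (∑-distrib-+ (λ i → lookup x i * lookup (w i) j) (λ i → lookup y i * lookup (w i) j))
        (sym (cong₂ _+_ (lookup-mat w x j) (lookup-mat w y j))))))
    (λ a x j → trans (lookup-mat w (a ⊙ x) j) (trans
      (sum-cong-≗ λ i → trans (cong (_* lookup (w i) j) (lookup-⊙ a x i)) (*-assoc _ _ _))
      (trans (sym (*-distribˡ-sum a (λ i → lookup x i * lookup (w i) j)))
        (sym (cong (a *_) (lookup-mat w x j))))))

  mat-commutes : {f : Vec F n → Vec F k} → IsLinear f → (w : Fin m → Vec F n) (x : Vec F m) →
                 f (mat w x) ≡ mat (f ∘ w) x
  mat-commutes f-lin w []      = 0⃗-homo f-lin
  mat-commutes f-lin w (a ∷ x) = trans (⊕-homo f-lin _ _)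
    (cong₂ _⊕_ (⊙-homo f-lin a _) (mat-commutes f-lin (w ∘ suc) x))

  mat-cong : {u w : Fin m → Vec F n} {x : Vec F m} →
             (∀ i → lookup x i ≡ 0# ⊎ u i ≡ w i) → mat u x ≡ mat w x
  mat-cong {x = []}            eq = refl
  mat-cong {u = u} {w} {a ∷ x} eq = cong₂ _⊕_ ([ (λ { refl → trans (0⊙ _) (sym (0⊙ _)) }) , cong (a ⊙_) ]′ (eq zero))
    (mat-cong {x = x} (eq ∘ suc))

  mat-unit : (w : Fin m → Vec F n) (i : Fin m) → mat w (unit i) ≡ w i
  mat-unit w zero    = trans (cong₂ _⊕_ (1⊙ _) (0⃗-homo (mat-linear (w ∘ suc)))) (⊕-identityʳ _)
  mat-unit w (suc i) = trans (cong₂ _⊕_ (0⊙ _) (mat-unit (w ∘ suc) i)) (⊕-identityˡ _)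

  mat-units : (x : Vec F m) → mat unit x ≡ x
  mat-units x = lookup-ext λ j → trans (lookup-mat unit x j) (trans
    (sum-single j λ i i≢j → trans (cong (lookup x i *_) (unit-other i≢j)) (zeroʳ _))
    (trans (cong (lookup x j *_) (unit-same j)) (*-identityʳ _)))

-- Sets as colours, and words with prescribed positions

map-≡-∈ : ∀ {A B : Set} {n} {f g : A → B} {x} {xs : Vec A n} → map f xs ≡ map g xs → x ∈ xs → f x ≡ g x
map-≡-∈ eq (here refl) = ∷-injectiveˡ eq
map-≡-∈ eq (there x∈xs) = map-≡-∈ (∷-injectiveʳ eq) x∈xs

indicator : ∀ {P : Set} → Dec P → Fin 2
indicator (yes _) = suc zero
indicator (no _)  = zero

indicator-transfer : ∀ {P Q : Set} {P? : Dec P} {Q? : Dec Q} → indicator P? ≡ indicator Q? → P → Q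
indicator-transfer {Q? = yes q} eq p = q
indicator-transfer {P? = yes _} {no _} () p
indicator-transfer {P? = no ¬p} {no _} eq p = contradiction p ¬p

module _ {A : Set} (fin : Finite A) where
  open Finite fin

  -- Codes a decidable set as an element of a finite type, so that it can serve as a colour.
  characteristic : {P : A → Set} → Decidable P → Vec (Fin 2) size
  characteristic P? = tabulate λ i → indicator (P? (decode i))

  characteristic-transfer : {P Q : A → Set} (P? : Decidable P) (Q? : Decidable Q) →
    characteristic P? ≡ characteristic Q? → ∀ {x} → P x → Q x
  characteristic-transfer {P} {Q} P? Q? eq {x} px = subst Q (decode-encode x)
    (indicator-transfer {P? = P? (decode (encode x))} {Q? (decode (encode x))}
      (trans (sym (lookup∘tabulate _ (encode x))) (trans (cong (λ v → lookup v (encode x)) eq)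
        (lookup∘tabulate _ (encode x))))
      (subst P (sym (decode-encode x)) px))

module _ {A : Set} {g n : ℕ} (σ : Fin g → Fin n) (d : A) where

  private
    entry : Vec A g → ∀ {i} → Dec (∃[ l ] σ l ≡ i) → A
    entry ζ (yes (l , _)) = lookup ζ l
    entry ζ (no _)        = d

  spread : Vec A g → Vec A n
  spread ζ = tabulate λ i → entry ζ (any? λ l → σ l ≟ i)

  -- Quantifying over `ζ` inside each case lets one case distinction serve several words at once, as
  -- the linearity proofs require.
  spread-cases : ∀ i → (∃[ l ] σ l ≡ i × ∀ ζ → lookup (spread ζ) i ≡ lookup ζ l) ⊎
                       ((∀ l → σ l ≢ i) × ∀ ζ → lookup (spread ζ) i ≡ d)
  spread-cases i with any? (λ l → σ l ≟ i) in eq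
  ... | yes (l , σl≡i) = inj₁ (l , σl≡i , λ ζ → trans (lookup∘tabulate _ i) (cong (entry ζ) eq))
  ... | no none        = inj₂ ((λ l h → none (l , h)) , λ ζ → trans (lookup∘tabulate _ i) (cong (entry ζ) eq))

  module _ (σ-injective : ∀ {i j} → σ i ≡ σ j → i ≡ j) where

    lookup-spread : ∀ ζ l → lookup (spread ζ) (σ l) ≡ lookup ζ l
    lookup-spread ζ l with spread-cases (σ l)
    ... | inj₁ (l′ , eq , val) = trans (val ζ) (cong (lookup ζ) (σ-injective eq))
    ... | inj₂ (off , _)       = contradiction refl (off l)

-- Cones, and their vectors with many nonzero coefficients

module RamseyForCones {q : ℕ} (𝔽 : FiniteField q) where

  open LinearAlgebra 𝔽
  open import Algebra.Solver.Ring.NaturalCoefficients.Default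
    (CommutativeRing.commutativeSemiring commutativeRing) using (solve; _:=_; _:+_; _:*_)

  private
    variable
      m n k g R : ℕ

  -- The cones in question consist of the vectors that are parallel to an
  -- element of a represented matroid, in coordinates on some subspace. The
  -- flats of a cone below are the three outcomes of the theorem, as subspaces.
  record IsCone (S : Vec F n → Set) : Set where
    field
      member? : Decidable S
      scale   : ∀ {a x} → a ≢ 0# → S x → S (a ⊙ x)

  open IsCone public

  Many : Vec F n → Set
  Many x = ∃[ i ] ∃[ j ] i ≢ j × lookup x i ≢ 0# × lookup x j ≢ 0#

  IndependentFlat : ∀ k → (Vec F n → Set) → Set
  IndependentFlat {n} k S =
    ∃ λ (φ : k ↪ n) → (∀ i → S (to φ (unit i))) × (∀ {x} → Many x → ¬ S (to φ x))

  ProjectiveFlat : ∀ k → (Vec F n → Set) → Set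
  ProjectiveFlat {n} k S = ∃ λ (φ : k ↪ n) → ∀ {x} → x ≢ 0⃗ → S (to φ x)

  -- The index is the rank of the part at infinity, so the flat has rank `suc k`. The kernel of
  -- `head` is the hyperplane to be removed.
  AffineFlat : ∀ k → (Vec F n → Set) → Set
  AffineFlat {n} k S = ∃ λ (φ : suc k ↪ n) →
    (∀ {x} → head x ≢ 0# → S (to φ x)) × (∀ {x} → x ≢ 0⃗ → head x ≡ 0# → ¬ S (to φ x))

  module _ {S : Vec F n → Set} where

    pullback : IsCone S → (f : m ↪ n) → IsCone (S ∘ to f)
    pullback cone f = record
      { member? = member? cone ∘ to f
      ; scale   = λ a≢0 s → subst S (sym (⊙-homo (linear f) _ _)) (scale cone a≢0 s) }

    complement : IsCone S → IsCone (¬_ ∘ S)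
    complement cone = record
      { member? = ¬? ∘ member? cone
      ; scale   = λ {a} {x} a≢0 ¬s s → ¬s (subst S (⊙-inverse a≢0 x) (scale cone (inverse-nonzero a≢0) s)) }

    independent-push : (f : m ↪ n) → IndependentFlat k (S ∘ to f) → IndependentFlat k S
    independent-push f (φ , units , rest) = f ∘↪ φ , units , rest

    independent⊎relation : IsCone S → (φ : k ↪ n) → (∀ i → S (to φ (unit i))) →
      IndependentFlat k S ⊎ ∃[ x ] Many x × S (to φ x)
    independent⊎relation cone φ units
      with Finite.any-finite? vectors (λ x → many? x ×-dec member? cone (to φ x))
      where
      many? : ∀ {n} → Decidable (Many {n})
      many? x = any? λ i → any? λ j → ¬? (i ≟ j) ×-dec ¬? (lookup x i ≟ 0#) ×-dec ¬? (lookup x j ≟ 0#)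
    ... | yes found = inj₂ found
    ... | no none   = inj₁ (φ , units , λ many s → none (_ , many , s))

  -- Long vectors in a cone without independent flats

  grid : ∀ k R → Vec (Fin k × Fin R) (k ℕ.* R)
  grid k R = tabulate (remQuot R)

  lookup-grid : {A : Set} (f : Fin k × Fin R → A) (h : Fin k) (j : Fin R) →
                lookup (map f (grid k R)) (combine h j) ≡ f (h , j)
  lookup-grid {R = R} f h j = trans (lookup-map (combine h j) f (grid _ R))
    (cong f (trans (lookup∘tabulate (remQuot R) _) (remQuot-combine h j)))

  grid-ext : (x y : Vec F (k ℕ.* R)) →
    (∀ h j → lookup x (combine h j) ≡ lookup y (combine h j)) → x ≡ y
  grid-ext {k} {R} x y eq = lookup-ext λ i →
    subst (λ i → lookup x i ≡ lookup y i) (combine-remQuot {k} R i)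
      (uncurry eq (remQuot {k} R i))

  blocks : Vec F k → (Fin k → Vec F R) → Vec F (k ℕ.* R)
  blocks {k} {R} x es = map (λ (h , j) → lookup x h * lookup (es h) j) (grid k R)

  lookup-blocks : (x : Vec F k) (es : Fin k → Vec F R) (h : Fin k) (j : Fin R) →
                  lookup (blocks x es) (combine h j) ≡ lookup x h * lookup (es h) j
  lookup-blocks x es = lookup-grid _

  blocks-ext : {x y : Vec F k} {es fs : Fin k → Vec F R} →
    (∀ h j → lookup x h * lookup (es h) j ≡ lookup y h * lookup (fs h) j) →
    blocks x es ≡ blocks y fs
  blocks-ext {x = x} {y} {es} {fs} eq = grid-ext (blocks x es) (blocks y fs) λ h j →
    trans (lookup-blocks x es h j) (trans (eq h j) (sym (lookup-blocks y fs h j)))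

  blocks-↪ : (es : Fin k → Vec F R) → (∀ h → es h ≢ 0⃗) → k ↪ k ℕ.* R
  blocks-↪ {k} {R} es es≢0 = record
    { to     = λ x → blocks x es
    ; linear = map-linear (grid k R)
        (λ x y (h , j) → trans (cong (_* lookup (es h) j) (lookup-⊕ x y h)) (distribʳ _ _ _))
        (λ c x (h , j) → trans (cong (_* lookup (es h) j) (lookup-⊙ c x h)) (*-assoc _ _ _))
    ; kernel = λ {x} eq → lookup-ext λ h → let (j , nz) = nonzero-entry (es≢0 h) in
        trans (*-zero (trans (sym (lookup-blocks x es h j))
                 (trans (cong (λ z → lookup z (combine h j)) eq) (lookup-0⃗ (combine h j)))) nz)
              (sym (lookup-0⃗ h)) }

  embed : Fin k → R ↪ k ℕ.* R
  embed {k} {R} i = record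
    { to     = λ e → blocks (unit i) (λ _ → e)
    ; linear = map-linear (grid k R)
        (λ x y (h , j) → trans (cong (lookup (unit i) h *_) (lookup-⊕ x y j)) (distribˡ _ _ _))
        (λ c x (h , j) → trans (cong (lookup (unit i) h *_) (lookup-⊙ c x j))
          (solve 3 (λ u c x → u :* (c :* x) := c :* (u :* x)) refl _ _ _))
    ; kernel = λ {x} eq → lookup-ext λ j → begin
        lookup x j                               ≡⟨ *-identityˡ _ ⟨
        1# * lookup x j                          ≡⟨ cong (_* lookup x j) (unit-same i) ⟨
        lookup (unit i) i * lookup x j           ≡⟨ lookup-blocks (unit i) (λ _ → x) i j ⟨
        lookup (blocks (unit i) (λ _ → x)) (combine i j)
                                                 ≡⟨ cong (λ z → lookup z (combine i j)) eq ⟩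
        lookup {n = k ℕ.* R} 0⃗ (combine i j)     ≡⟨ lookup-0⃗ (combine i j) ⟩
        0#                                       ≡⟨ lookup-0⃗ j ⟨
        lookup 0⃗ j                               ∎ }
    where open ≡-Reasoning

  embed-unit : (i : Fin k) (j : Fin R) → to (embed i) (unit j) ≡ unit (combine i j)
  embed-unit i j = grid-ext _ _ λ h l → trans (lookup-blocks (unit i) (λ _ → unit j) h l) (entry h l)
    where
    entry : ∀ h l → lookup (unit i) h * lookup (unit j) l ≡ lookup (unit (combine i j)) (combine h l)
    entry h l with i ≟ h | j ≟ l
    ... | yes refl | yes refl = trans (cong₂ _*_ (unit-same i) (unit-same j))
                                  (trans (*-identityˡ 1#) (sym (unit-same (combine i j))))
    ... | no i≢h | _ = trans (cong (_* _) (unit-other i≢h)) (trans (zeroˡ _)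
                         (sym (unit-other (i≢h ∘ proj₁ ∘ combine-injective i j h l))))
    ... | yes refl | no j≢l = trans (cong (_ *_) (unit-other j≢l)) (trans (zeroʳ _)
                         (sym (unit-other (j≢l ∘ proj₂ ∘ combine-injective i j i l))))

  blocks-unit : (es : Fin k → Vec F R) (i : Fin k) → blocks (unit i) es ≡ to (embed i) (es i)
  blocks-unit es i = blocks-ext {x = unit i} {unit i} {es} {λ _ → es i} entry
    where
    entry : ∀ h j → lookup (unit i) h * lookup (es h) j ≡ lookup (unit i) h * lookup (es i) j
    entry h j with i ≟ h
    ... | yes refl = refl
    ... | no i≢h   = trans (trans (cong (_* _) (unit-other i≢h)) (zeroˡ _))
                      (sym (trans (cong (_* _) (unit-other i≢h)) (zeroˡ _)))

  record Support (g : ℕ) (x : Vec F n) : Set where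
    field
      position           : Fin g → Fin n
      position-injective : ∀ {i j} → position i ≡ position j → i ≡ j
      nonzero-at         : ∀ i → lookup x (position i) ≢ 0#

  open Support public

  support-nonzero : {x : Vec F n} → Support (suc g) x → x ≢ 0⃗
  support-nonzero s refl = nonzero-at s zero (lookup-0⃗ (position s zero))

  -- Of the two blocks with nonzero coefficient, one contributes all its `suc g` positions and the
  -- other a single further one.
  support-blocks : {x : Vec F k} {es : Fin k → Vec F R} → Many x →
    (∀ h → Support (suc g) (es h)) → Support (suc (suc g)) (blocks x es)
  support-blocks {k = k} {x = x} {es} (h , h′ , h≢h′ , xh , xh′) s = record
    { position = pos ; position-injective = λ {i} {j} → pos-injective i j ; nonzero-at = nz }
    where
    pos : _ → _
    pos zero    = combine h′ (position (s h′) zero)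
    pos (suc l) = combine h (position (s h) l)

    pos-injective : ∀ i j → pos i ≡ pos j → i ≡ j
    pos-injective zero    zero    _  = refl
    pos-injective zero    (suc j) eq = contradiction (sym (proj₁ (combine-injective {m = k} _ _ _ _ eq))) h≢h′
    pos-injective (suc i) zero    eq = contradiction (proj₁ (combine-injective {m = k} _ _ _ _ eq)) h≢h′
    pos-injective (suc i) (suc j) eq =
      cong suc (position-injective (s h) (proj₂ (combine-injective {m = k} _ _ _ _ eq)))

    nz : ∀ i → lookup (blocks x es) (pos i) ≢ 0#
    nz zero    = subst (_≢ 0#) (sym (lookup-blocks x es h′ _)) (*-nonzero xh′ (nonzero-at (s h′) zero))
    nz (suc l) = subst (_≢ 0#) (sym (lookup-blocks x es h _)) (*-nonzero xh (nonzero-at (s h) l))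

  private
    all-⊎ : {A : Set} {B : Fin k → Set} → (∀ i → A ⊎ B i) → A ⊎ (∀ i → B i)
    all-⊎ {zero}  f = inj₂ λ ()
    all-⊎ {suc k} f with f zero | all-⊎ (f ∘ suc)
    ... | inj₁ a | _      = inj₁ a
    ... | inj₂ _ | inj₁ a = inj₁ a
    ... | inj₂ b | inj₂ bs = inj₂ λ { zero → b ; (suc i) → bs i }

  -- By induction, each of `k` disjoint blocks of the basis contains a vector of `S` with `suc g`
  -- nonzero entries, or an independent flat appears. Disjointness makes these `k` vectors
  -- independent; unless they span an independent flat, some combination in `S` involves two blocks
  -- and has one nonzero entry more.
  long-vector : ∀ k g → ∃[ R ] ∀ {S : Vec F R → Set} → IsCone S → (∀ i → S (unit i)) →
    IndependentFlat k S ⊎ ∃[ x ] S x × Support (suc g) x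
  long-vector k zero = 1 , λ cone units → inj₂ (unit zero , units zero , record
    { position = id ; position-injective = id ; nonzero-at = λ { zero → 1≢0 } })
  long-vector k (suc g) = k ℕ.* R₀ , step
    where
    R₀ = proj₁ (long-vector k g)
    step : ∀ {S : Vec F (k ℕ.* R₀) → Set} → IsCone S → (∀ i → S (unit i)) →
           IndependentFlat k S ⊎ ∃[ x ] S x × Support (suc (suc g)) x
    step {S} cone units = [ inj₁ , join ]′ (all-⊎ λ i → Sum.map₁ (independent-push {S = S} (embed i))
        (proj₂ (long-vector k g) (pullback cone (embed i))
          λ j → subst S (sym (embed-unit i j)) (units (combine i j))))
      where
      join : (∀ i → ∃[ x ] S (to (embed i) x) × Support (suc g) x) →
             IndependentFlat k S ⊎ ∃[ x ] S x × Support (suc (suc g)) x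
      join found = Sum.map₂ (λ (x , many , s) → blocks x es , s , support-blocks {x = x} {es} many support)
        (independent⊎relation cone (blocks-↪ es (support-nonzero ∘ support))
          λ i → subst S (sym (blocks-unit es i)) (proj₁ (proj₂ (found i))))
        where
        es : Fin k → Vec F R₀
        es i = proj₁ (found i)
        support : ∀ i → Support (suc g) (es i)
        support i = proj₂ (proj₂ (found i))

-- Cubes, affine subspaces and monochromatic points

bit : ∀ {q} (𝔽 : FiniteField q) → Fin 2 → Fin q
bit 𝔽 zero    = LinearAlgebra.0# 𝔽
bit 𝔽 (suc _) = LinearAlgebra.1# 𝔽

module Cubes {q : ℕ} (𝔽 : FiniteField q) where

  open LinearAlgebra 𝔽
  open RamseyForCones 𝔽
  open import Algebra.Solver.Ring.NaturalCoefficients.Default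
    (CommutativeRing.commutativeSemiring commutativeRing) using (solve; _:=_; _:+_; _:*_)
  open ≡-Reasoning

  private
    variable
      m n k g R : ℕ

  bits : Vec (Fin 2) n → Vec F n
  bits = map (bit 𝔽)

  -- In each of k blocks, a word ε chooses one of two standard basis vectors.
  -- Toggling the choice in a block where c is nonzero adds a multiple of the
  -- difference of the two, hence the vectors with coefficients c for all ε
  -- form a cube whose directions are independent.
  module Toggle (W : ℕ) (pair : Fin k → Fin 2 → Fin W) (distinct : ∀ h → pair h zero ≢ pair h (suc zero))
                (c : Vec F k) (support : Support (suc m) c) where

    open Support support renaming (position to σ; position-injective to σ-injective; nonzero-at to c≢0)

    choice : Vec (Fin 2) k → Fin k → Vec F W
    choice ε h = unit (pair h (lookup ε h))

    private
      off on difference : Fin k → Vec F W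
      off h        = unit (pair h zero)
      on h         = unit (pair h (suc zero))
      difference h = on h ⊕ (- 1#) ⊙ off h

      -- The block `σ zero` is never toggled. There the base vector of the cube appears alone, which
      -- keeps it independent of the directions.
      tail-spread : Vec F (suc m) → Vec F k
      tail-spread (_ ∷ t) = spread (σ ∘ suc) 0# t

      entry : Vec F (suc m) → Fin k × Fin W → F
      entry x (h , j) =
        lookup c h * (head x * lookup (off h) j + lookup (tail-spread x) h * lookup (difference h) j)

      tail-spread-⊕ : ∀ x y h → lookup (tail-spread (x ⊕ y)) h ≡ lookup (tail-spread x) h + lookup (tail-spread y) h
      tail-spread-⊕ (_ ∷ t) (_ ∷ u) h with spread-cases (σ ∘ suc) 0# h
      ... | inj₁ (l , _ , val) = trans (val _) (trans (lookup-⊕ t u l) (sym (cong₂ _+_ (val t) (val u))))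
      ... | inj₂ (_ , val)     = trans (val _) (sym (trans (cong₂ _+_ (val t) (val u)) (+-identityˡ 0#)))

      tail-spread-⊙ : ∀ a x h → lookup (tail-spread (a ⊙ x)) h ≡ a * lookup (tail-spread x) h
      tail-spread-⊙ a (_ ∷ t) h with spread-cases (σ ∘ suc) 0# h
      ... | inj₁ (l , _ , val) = trans (val _) (trans (lookup-⊙ a t l) (sym (cong (a *_) (val t))))
      ... | inj₂ (_ , val)     = trans (val _) (sym (trans (cong (a *_) (val t)) (zeroʳ a)))

      head-⊕ : (x y : Vec F (suc m)) → head (x ⊕ y) ≡ head x + head y
      head-⊕ (_ ∷ _) (_ ∷ _) = refl

      head-⊙ : ∀ a (x : Vec F (suc m)) → head (a ⊙ x) ≡ a * head x
      head-⊙ a (_ ∷ _) = refl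

      entry-⊕ : ∀ x y i → entry (x ⊕ y) i ≡ entry x i + entry y i
      entry-⊕ x y (h , j) = trans
        (cong₂ (λ a b → lookup c h * (a * lookup (off h) j + b * lookup (difference h) j))
          (head-⊕ x y) (tail-spread-⊕ x y h))
        (solve 7 (λ c a a′ b b′ u v → c :* ((a :+ a′) :* u :+ (b :+ b′) :* v)
          := c :* (a :* u :+ b :* v) :+ c :* (a′ :* u :+ b′ :* v)) refl _ _ _ _ _ _ _)

      entry-⊙ : ∀ a x i → entry (a ⊙ x) i ≡ a * entry x i
      entry-⊙ a x (h , j) = trans
        (cong₂ (λ a b → lookup c h * (a * lookup (off h) j + b * lookup (difference h) j))
          (head-⊙ a x) (tail-spread-⊙ a x h))
        (solve 6 (λ c s a b u v → c :* ((s :* a) :* u :+ (s :* b) :* v)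
          := s :* (c :* (a :* u :+ b :* v))) refl _ _ _ _ _ _)

      off-off : ∀ h → lookup (off h) (pair h zero) ≡ 1#
      off-off h = unit-same (pair h zero)

      off-on : ∀ h → lookup (off h) (pair h (suc zero)) ≡ 0#
      off-on h = unit-other (distinct h)

      difference-on : ∀ h → lookup (difference h) (pair h (suc zero)) ≡ 1#
      difference-on h = begin
        lookup (difference h) i             ≡⟨ lookup-⊕ (on h) _ i ⟩
        lookup (on h) i + lookup ((- 1#) ⊙ off h) i
                                            ≡⟨ cong₂ _+_ (unit-same i) (trans (lookup-⊙ (- 1#) (off h) i)
                                                (trans (cong ((- 1#) *_) (off-on h)) (zeroʳ _))) ⟩
        1# + 0#                             ≡⟨ +-identityʳ 1# ⟩
        1#                                  ∎
        where i = pair h (suc zero)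

      cancel : ∀ u v → u + (v + (- 1#) * u) ≡ v
      cancel u v = trans (solve 3 (λ u v w → u :+ (v :+ w) := v :+ (u :+ w)) refl u v _)
        (trans (cong (v +_) (a-1a u)) (+-identityʳ v))

    toggle : suc m ↪ k ℕ.* W
    toggle = record
      { to     = λ x → map (entry x) (grid k W)
      ; linear = map-linear (grid k W) entry-⊕ entry-⊙
      ; kernel = λ {x} → kernel′ x }
      where
      kernel′ : ∀ x → map (entry x) (grid k W) ≡ 0⃗ → x ≡ 0⃗
      kernel′ (a ∷ t) eq = cong₂ _∷_ a≡0 (lookup-ext λ l → trans (t≡0 l) (sym (lookup-0⃗ l)))
        where
        entry≡0 : ∀ h j → entry (a ∷ t) (h , j) ≡ 0#
        entry≡0 h j = trans (sym (lookup-grid (entry (a ∷ t)) h j))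
          (trans (cong (λ z → lookup z (combine h j)) eq) (lookup-0⃗ (combine h j)))

        inner≡0 : ∀ l j → a * lookup (off (σ l)) j +
                          lookup (tail-spread (a ∷ t)) (σ l) * lookup (difference (σ l)) j ≡ 0#
        inner≡0 l j = *-zero (trans (*-comm _ _) (entry≡0 (σ l) j)) (c≢0 l)

        -- Read off at the switched-on basis vector of the block, where `off` vanishes and
        -- `difference` is 1.
        t≡0 : ∀ l → lookup t l ≡ 0#
        t≡0 l = begin
          lookup t l                             ≡⟨ lookup-spread (σ ∘ suc) 0# (suc-injective ∘ σ-injective) t l ⟨
          T                                      ≡⟨ *-identityʳ T ⟨
          T * 1#                                 ≡⟨ +-identityˡ _ ⟨
          0# + T * 1#                            ≡⟨ cong (_+ T * 1#) (zeroʳ a) ⟨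
          a * 0# + T * 1#                        ≡⟨ cong₂ (λ u v → a * u + T * v) (off-on h) (difference-on h) ⟨
          a * lookup (off h) j + T * lookup (difference h) j
                                                 ≡⟨ inner≡0 (suc l) j ⟩
          0#                                     ∎
          where
          h = σ (suc l)
          j = pair h (suc zero)
          T = lookup (tail-spread (a ∷ t)) h

        T₀≡0 : lookup (tail-spread (a ∷ t)) (σ zero) ≡ 0#
        T₀≡0 with spread-cases (σ ∘ suc) 0# (σ zero)
        ... | inj₁ (l , eq , _) = contradiction (sym (σ-injective eq)) 0≢1+n
        ... | inj₂ (_ , val)    = val t

        a≡0 : a ≡ 0#
        a≡0 = begin
          a                                      ≡⟨ *-identityʳ a ⟨
          a * 1#                                 ≡⟨ +-identityʳ _ ⟨
          a * 1# + 0#                            ≡⟨ cong (a * 1# +_) (zeroˡ D) ⟨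
          a * 1# + 0# * D                        ≡⟨ cong₂ (λ u v → a * u + v * D) (off-off (σ zero)) T₀≡0 ⟨
          _                                      ≡⟨ inner≡0 zero (pair (σ zero) zero) ⟩
          0#                                     ∎
          where D = lookup (difference (σ zero)) (pair (σ zero) zero)

    toggle-bits : ∀ ε → to toggle (1# ∷ bits ε) ≡ blocks c (choice (spread (σ ∘ suc) zero ε))
    toggle-bits ε = grid-ext _ (blocks c (choice ε⁺)) λ h j → trans (lookup-grid (entry (1# ∷ bits ε)) h j)
      (trans (cong (lookup c h *_) (inner h j)) (sym (lookup-blocks c (choice ε⁺) h j)))
      where
      ε⁺ = spread (σ ∘ suc) zero ε

      spread-bits : ∀ h → lookup (spread (σ ∘ suc) 0# (bits ε)) h ≡ bit 𝔽 (lookup ε⁺ h)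
      spread-bits h with spread-cases (σ ∘ suc) 0# h | spread-cases (σ ∘ suc) (zero {1}) h
      ... | inj₁ (l , eq , val) | inj₁ (l′ , eq′ , val′) = trans (val _) (trans (lookup-map l (bit 𝔽) ε)
              (cong (bit 𝔽) (trans (cong (lookup ε) (suc-injective (σ-injective (trans eq (sym eq′))))) (sym (val′ ε)))))
      ... | inj₁ (l , eq , _) | inj₂ (none , _) = contradiction eq (none l)
      ... | inj₂ (none , _) | inj₁ (l , eq , _) = contradiction eq (none l)
      ... | inj₂ (_ , val) | inj₂ (_ , val′) = trans (val _) (cong (bit 𝔽) (sym (val′ ε)))

      select : ∀ h j b → 1# * lookup (off h) j + bit 𝔽 b * lookup (difference h) j ≡ lookup (unit (pair h b)) j
      select h j zero = trans (cong₂ _+_ (*-identityˡ _) (zeroˡ _)) (+-identityʳ _)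
      select h j (suc zero) = trans (cong₂ _+_ (*-identityˡ _) (trans (*-identityˡ _)
        (trans (lookup-⊕ (on h) _ j) (cong (lookup (on h) j +_) (lookup-⊙ (- 1#) (off h) j)))))
        (cancel (lookup (off h) j) (lookup (on h) j))

      inner : ∀ h j → 1# * lookup (off h) j + lookup (spread (σ ∘ suc) 0# (bits ε)) h * lookup (difference h) j ≡
                      lookup (choice ε⁺ h) j
      inner h j = trans (cong (λ b → 1# * lookup (off h) j + b * lookup (difference h) j) (spread-bits h))
        (select h j (lookup ε⁺ h))

  -- The windows of the proof are the sets of words of length m over {0,1};
  -- a combinatorial line over the alphabet {0,1}ˡ selects two elements of
  -- each of l windows at once.
  cube : ∀ k M → ∃[ N ] ∀ {S : Vec F N → Set} → IsCone S → (∀ i → S (unit i)) →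
    IndependentFlat k S ⊎ ∃ λ (ψ : suc M ↪ N) → ∀ ε → S (to ψ (1# ∷ bits ε))
  cube k M = ℓ ℕ.* W , step
    where
    open Finite
    ℓ = proj₁ (long-vector k M)
    coefficients : Finite (Vec F ℓ)
    coefficients = vectors
    -- Dimension 1 is enough: the value of the single variable is a letter of {0,1}^ℓ, which
    -- switches the `ℓ` columns independently of each other. The colours are the subsets of `F` ^
    -- `ℓ`.
    line = hales-jewett-subspace (Vec-finite {n = ℓ} (Fin-finite {2}))
             (Vec-finite {n = size coefficients} (Fin-finite {2})) 1
    windows : Finite (Vec (Fin 2) (proj₁ line))
    windows = Vec-finite Fin-finite
    W = size windows

    column : Vec (Vec (Fin 2) ℓ) (proj₁ line) → Fin ℓ → Fin W
    column w h = encode windows (map (λ u → lookup u h) w)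

    step : ∀ {S : Vec F (ℓ ℕ.* W) → Set} → IsCone S → (∀ i → S (unit i)) →
      IndependentFlat k S ⊎ ∃ λ (ψ : suc M ↪ ℓ ℕ.* W) → ∀ ε → S (to ψ (1# ∷ bits ε))
    step {S} cone units = [ (λ i → inj₁ (independent-push {S = S} (place-↪ w₀) i)) , inj₂ ∘ toggled ]′
        (proj₂ (long-vector k M) (pullback cone (place-↪ w₀)) λ i →
          subst S (sym (trans (blocks-unit (unit ∘ column w₀) i) (embed-unit i (column w₀ i)))) (units _))
      where
      place-↪ : ∀ w → ℓ ↪ ℓ ℕ.* W
      place-↪ w = blocks-↪ (unit ∘ column w) (unit-nonzero ∘ column w)

      placed? : ∀ w → Decidable (λ c → S (to (place-↪ w) c))
      placed? w c = member? cone (to (place-↪ w) c)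

      monochromatic = proj₂ line λ w → characteristic coefficients (placed? w)
      P    = proj₁ monochromatic
      1∈P  = proj₁ (proj₂ monochromatic) zero
      mono = proj₂ (proj₂ monochromatic)

      word : Vec (Fin 2) ℓ → Vec (Vec (Fin 2) ℓ) (proj₁ line)
      word ε = substitute P (lookup (ε ∷ []))

      w₀ = word (replicate _ zero)

      letter : Fin ℓ → Fin 2 → Vec (Fin 2) ℓ ⊎ Fin 1 → Fin 2
      letter h b = [ (λ u → lookup u h) , const b ]′

      pair : Fin ℓ → Fin 2 → Fin W
      pair h b = encode windows (map (letter h b) P)

      -- The two columns differ at an occurrence of the variable, where one has 0 and the other 1.
      distinct : ∀ h → pair h zero ≢ pair h (suc zero)
      distinct h eq with map-≡-∈ {f = letter h zero} {letter h (suc zero)}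
        (encode-injective windows {map (letter h zero) P} {map (letter h (suc zero)) P} eq) 1∈P
      ... | ()

      column-word : ∀ ε h → column (word ε) h ≡ pair h (lookup ε h)
      column-word ε h = cong (encode windows) (trans (sym (map-∘ _ _ P))
        (map-cong (λ { (inj₁ u) → refl ; (inj₂ zero) → refl }) P))

      toggled : (∃[ c ] S (to (place-↪ w₀) c) × Support (suc M) c) →
                ∃ λ (ψ : suc M ↪ ℓ ℕ.* W) → ∀ ε → S (to ψ (1# ∷ bits ε))
      toggled (c , s , support) = toggle , λ ε →
          subst S (sym (trans (toggle-bits ε) (chosen (spread (position support ∘ suc) zero ε)))) (everywhere _)
        where
        open Toggle W pair distinct c support

        -- The vector `c` was found for the word `w₀` alone; equality of the colours carries it to
        -- every word of the line.
        everywhere : ∀ ε → S (to (place-↪ (word ε)) c)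
        everywhere ε = characteristic-transfer coefficients (placed? w₀) (placed? (word ε))
          (mono (replicate _ zero ∷ []) (ε ∷ [])) {c} s

        chosen : ∀ ε → blocks c (choice ε) ≡ to (place-↪ (word ε)) c
        chosen ε = blocks-ext {x = c} {c} {choice ε} {unit ∘ column (word ε)} λ h j →
          cong (λ i → lookup c h * lookup (unit i) j) (sym (column-word ε h))

  -- The linear extension of the substitution of t into P: a constant b is the
  -- value at (1, t), so that the value at (a, t) is a * b.
  pattern-↪ : (P : Vec (F ⊎ Fin k) n) → (∃[ b ] b ≢ 0# × inj₁ b ∈ P) → (∀ l → inj₂ l ∈ P) →
              suc k ↪ n
  pattern-↪ {k} P (b , b≢0 , b∈P) variables = record
    { to     = λ x → map (coordinate x) P
    ; linear = map-linear P coordinate-⊕ coordinate-⊙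
    ; kernel = λ {x} → kernel′ x }
    where
    coordinate : Vec F (suc k) → F ⊎ Fin k → F
    coordinate x = [ (head x *_) , (λ l → lookup x (suc l)) ]′

    coordinate-⊕ : ∀ x y i → coordinate (x ⊕ y) i ≡ coordinate x i + coordinate y i
    coordinate-⊕ (a ∷ x) (b ∷ y) (inj₁ c) = distribʳ c a b
    coordinate-⊕ (a ∷ x) (b ∷ y) (inj₂ l) = lookup-⊕ x y l

    coordinate-⊙ : ∀ c x i → coordinate (c ⊙ x) i ≡ c * coordinate x i
    coordinate-⊙ c (a ∷ x) (inj₁ b) = *-assoc c a b
    coordinate-⊙ c (a ∷ x) (inj₂ l) = lookup-⊙ c x l

    kernel′ : ∀ x → map (coordinate x) P ≡ 0⃗ → x ≡ 0⃗
    kernel′ (a ∷ t) eq = cong₂ _∷_ (*-zero (vanish b∈P) b≢0)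
      (lookup-ext λ l → trans (vanish (variables l)) (sym (lookup-0⃗ l)))
      where
      vanish : ∀ {i} → i ∈ P → coordinate (a ∷ t) i ≡ 0#
      vanish = map-≡-∈ {f = coordinate (a ∷ t)} {const 0#} (trans eq (sym (map-const P 0#)))

  dot : Vec F R → Vec (Fin 2) R → F
  dot []      []      = 0#
  dot (a ∷ e) (b ∷ η) = a * bit 𝔽 b + dot e η

  indicator-word : Fin R → Vec (Fin 2) R
  indicator-word zero    = suc zero ∷ replicate _ zero
  indicator-word (suc i) = zero ∷ indicator-word i

  dot-⊕ : (e f : Vec F R) (η : Vec (Fin 2) R) → dot (e ⊕ f) η ≡ dot e η + dot f η
  dot-⊕ []      []      []      = sym (+-identityˡ 0#)
  dot-⊕ (a ∷ e) (a′ ∷ f) (b ∷ η) = trans (cong ((a + a′) * bit 𝔽 b +_) (dot-⊕ e f η))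
    (solve 5 (λ a a′ b d d′ → (a :+ a′) :* b :+ (d :+ d′) := (a :* b :+ d) :+ (a′ :* b :+ d′)) refl _ _ _ _ _)

  dot-⊙ : (c : F) (e : Vec F R) (η : Vec (Fin 2) R) → dot (c ⊙ e) η ≡ c * dot e η
  dot-⊙ c []      []      = sym (zeroʳ c)
  dot-⊙ c (a ∷ e) (b ∷ η) = trans (cong (c * a * bit 𝔽 b +_) (dot-⊙ c e η))
    (solve 4 (λ c a b d → c :* a :* b :+ c :* d := c :* (a :* b :+ d)) refl _ _ _ _)

  dot-0⃗ : (η : Vec (Fin 2) R) → dot 0⃗ η ≡ 0#
  dot-0⃗ []      = refl
  dot-0⃗ (b ∷ η) = trans (cong₂ _+_ (zeroˡ _) (dot-0⃗ η)) (+-identityˡ 0#)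

  dot-unit : (i : Fin R) (η : Vec (Fin 2) R) → dot (unit i) η ≡ bit 𝔽 (lookup η i)
  dot-unit zero    (b ∷ η) = trans (cong₂ _+_ (*-identityˡ _) (dot-0⃗ η)) (+-identityʳ _)
  dot-unit (suc i) (b ∷ η) = trans (cong₂ _+_ (zeroˡ _) (dot-unit i η)) (+-identityˡ _)

  dot-zero : (e : Vec F R) → dot e (replicate _ zero) ≡ 0#
  dot-zero []      = refl
  dot-zero (a ∷ e) = trans (cong₂ _+_ (zeroʳ a) (dot-zero e)) (+-identityˡ 0#)

  dot-indicator : (e : Vec F R) (i : Fin R) → dot e (indicator-word i) ≡ lookup e i
  dot-indicator (a ∷ e) zero    = trans (cong₂ _+_ (*-identityʳ a) (dot-zero e)) (+-identityʳ a)
  dot-indicator (a ∷ e) (suc i) = trans (cong₂ _+_ (zeroʳ a) (dot-indicator e i)) (+-identityˡ _)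

  -- Isolates what the construction of affine subspaces asks of the field: words over {0,1} must
  -- reach every scalar. Primality enters through this property.
  Covering : ℕ → Set
  Covering g = ∀ {R} {e : Vec F R} → Support g e → ∀ t → ∃[ η ] dot e η ≡ t

  -- The vectors (1, unit i, η i) with words η i over {0,1} lie in the cone;
  -- by the Hales–Jewett theorem the coefficients e of the combinations that
  -- also do may be assumed not to depend on the words η.
  module _ {g : ℕ} (covering : Covering (suc g)) (k K : ℕ) where

    private
      open Finite
      R₀ = proj₁ (long-vector k g)
      coefficients : Finite (Vec F R₀)
      coefficients = vectors
      subspace = hales-jewett-subspace (Vec-finite {n = R₀} (Fin-finite {2}))
                   (Vec-finite {n = size coefficients} (Fin-finite {2})) K
      M = R₀ ℕ.+ proj₁ subspace

      -- A letter of {0,1}^`R₀` holds one coordinate of all `R₀` vectors at once. The all-ones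
      -- letter is their leading coordinate 1, and the indicator words form an identity block, from
      -- which a combination's coefficients can be read back.
      extend-word : {A : Set} → (Vec (Fin 2) R₀ → A) → Vec A (proj₁ subspace) → Vec A (suc M)
      extend-word f w = f (replicate _ (suc zero)) ∷ (tabulate (f ∘ indicator-word) ++ w)

      map-extend-word : {A B : Set} (f : A → B) (h : Vec (Fin 2) R₀ → A) (w : Vec A (proj₁ subspace)) →
                        map f (extend-word h w) ≡ extend-word (f ∘ h) (map f w)
      map-extend-word f h w = cong (f (h _) ∷_)
        (trans (map-++ f (tabulate (h ∘ indicator-word)) w) (cong (_++ map f w) (sym (tabulate-∘ f _))))

      indicator∈ : {A : Set} (f : Vec (Fin 2) R₀ → A) (w : Vec A (proj₁ subspace)) →
                   ∀ i → f (indicator-word i) ∈ extend-word f w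
      indicator∈ f w i = there (∈-++⁺ˡ (∈-tabulate⁺ (f ∘ indicator-word) i))

      extend∈ : {A : Set} (f : Vec (Fin 2) R₀ → A) {w : Vec A (proj₁ subspace)} {x : A} →
                x ∈ w → x ∈ extend-word f w
      extend∈ f x∈w = there (∈-++⁺ʳ (tabulate (f ∘ indicator-word)) x∈w)

    cube⇒affine : ∀ {S : Vec F (suc M) → Set} → IsCone S → (∀ ε → S (1# ∷ bits ε)) →
      IndependentFlat k S ⊎ ∃ λ (ψ : suc K ↪ suc M) → ∀ t → S (to ψ (1# ∷ t))
    cube⇒affine {S} cone bits∈S = [ (λ i → inj₁ (independent-push {S = S} (combine-↪ w₀) i)) , inj₂ ∘ affine ]′
        (proj₂ (long-vector k g) (pullback cone (combine-↪ w₀)) λ i →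
          subst S (sym (combine-unit w₀ i)) (bits∈S _))
      where
      combine-↪ : ∀ w → R₀ ↪ suc M
      combine-↪ w = record
        { to     = λ e → map (dot e) (extend-word id w)
        ; linear = map-linear (extend-word id w) dot-⊕ dot-⊙
        ; kernel = λ {e} eq → lookup-ext λ i → trans (sym (dot-indicator e i))
            (trans (map-≡-∈ {f = dot e} {const 0#} (trans eq (sym (map-const (extend-word id w) 0#)))
                     (indicator∈ id w i))
                   (sym (lookup-0⃗ i))) }

      combine-unit : ∀ w i → to (combine-↪ w) (unit i) ≡
                             1# ∷ bits (map (λ η → lookup η i) (tabulate indicator-word ++ w))
      combine-unit w i = trans (map-cong (dot-unit i) (extend-word id w))
        (cong₂ _∷_ (cong (bit 𝔽) (lookup-replicate i (suc zero))) (map-∘ (bit 𝔽) _ _))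

      combination? : ∀ w → Decidable (λ e → S (to (combine-↪ w) e))
      combination? w e = member? cone (to (combine-↪ w) e)

      monochromatic = proj₂ subspace λ w → characteristic coefficients (combination? w)
      P         = proj₁ monochromatic
      variables = proj₁ (proj₂ monochromatic)
      mono      = proj₂ (proj₂ monochromatic)

      word : Vec (Vec (Fin 2) R₀) K → Vec (Vec (Fin 2) R₀) (proj₁ subspace)
      word η = substitute P (lookup η)

      η₀ = replicate K (replicate R₀ zero)
      w₀ = word η₀

      affine : (∃[ e ] S (to (combine-↪ w₀) e) × Support (suc g) e) →
               ∃ λ (ψ : suc K ↪ suc M) → ∀ t → S (to ψ (1# ∷ t))
      affine (e , s , support) = ψ , λ t → subst S (sym (reached t)) (everywhere (words t))
        where
        everywhere : ∀ η → S (to (combine-↪ (word η)) e)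
        everywhere η = characteristic-transfer coefficients (combination? w₀) (combination? (word η))
          (mono η₀ η) {e} s

        pattern-of : Vec (Vec (Fin 2) R₀ ⊎ Fin K) (suc M)
        pattern-of = extend-word inj₁ P

        evaluated : Vec (F ⊎ Fin K) (suc M)
        evaluated = map (Sum.map₁ (dot e)) pattern-of

        -- At the indicator letter of `i₀` the pattern has the constant `lookup e i₀`, which is
        -- nonzero; so the base point is independent of the directions given by the variables.
        i₀ = position support zero

        ψ = pattern-↪ evaluated
          (dot e (indicator-word i₀) , subst (_≢ 0#) (sym (dot-indicator e i₀)) (nonzero-at support zero) ,
            ∈-map⁺ (Sum.map₁ (dot e)) {v = inj₁ (indicator-word i₀)} (indicator∈ inj₁ P i₀))
          λ l → ∈-map⁺ (Sum.map₁ (dot e)) {v = inj₂ l} (extend∈ inj₁ (variables l))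

        -- Each coordinate of `t` becomes a subset sum of the entries of `e`: the variables range
        -- over words, but their values under `dot e` exhaust `F`.
        words : Vec F K → Vec (Vec (Fin 2) R₀) K
        words t = tabulate λ l → proj₁ (covering support (lookup t l))

        reached : ∀ t → to ψ (1# ∷ t) ≡ to (combine-↪ (word (words t))) e
        reached t = begin
          to ψ (1# ∷ t)             ≡⟨ map-∘ _ _ pattern-of ⟨
          map _ pattern-of          ≡⟨ map-cong value pattern-of ⟩
          map (dot e ∘ [ id , lookup (words t) ]′) pattern-of
                                    ≡⟨ map-∘ (dot e) _ pattern-of ⟩
          map (dot e) (substitute pattern-of (lookup (words t)))
                                    ≡⟨ cong (map (dot e)) (map-extend-word [ id , lookup (words t) ]′ inj₁ P) ⟩
          to (combine-↪ (word (words t))) e  ∎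
          where
          value : ∀ i → [ (1# *_) , (λ l → lookup t l) ]′ (Sum.map₁ (dot e) i) ≡
                        dot e ([ id , lookup (words t) ]′ i)
          value (inj₁ η) = *-identityˡ _
          value (inj₂ l) = sym (trans (cong (dot e) (lookup∘tabulate _ l))
            (proj₂ (covering support (lookup t l))))

    affine-subspace : ∃[ N ] ∀ {S : Vec F N → Set} → IsCone S → (∀ i → S (unit i)) →
      IndependentFlat k S ⊎ ∃ λ (ψ : suc K ↪ N) → ∀ t → S (to ψ (1# ∷ t))
    affine-subspace = proj₁ (cube k M) , λ {S} cone units →
      [ inj₁ , (λ (ψ , bits∈S) → Sum.map (independent-push {S = S} ψ) (λ (φ , all) → ψ ∘↪ φ , all)
          (cube⇒affine (pullback cone ψ) bits∈S)) ]′
        (proj₂ (cube k M) cone units)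

  -- The Ramsey theorem for points of projective spaces

  cons-↪ : m ↪ n → suc m ↪ suc n
  cons-↪ φ = record
    { to     = to′
    ; linear = record
      { ⊕-homo = λ { (a ∷ x) (b ∷ y) → cong (a + b ∷_) (⊕-homo (linear φ) x y) }
      ; ⊙-homo = λ { c (a ∷ x) → cong (c * a ∷_) (⊙-homo (linear φ) c x) } }
    ; kernel = λ { {a ∷ x} eq → cong₂ _∷_ (∷-injectiveˡ eq) (kernel φ (∷-injectiveʳ eq)) } }
    where
    to′ : _ → _
    to′ (a ∷ x) = a ∷ to φ x

  zero-↪ : n ↪ suc n
  zero-↪ = record
    { to     = 0# ∷_
    ; linear = record
      { ⊕-homo = λ x y → cong (_∷ x ⊕ y) (sym (+-identityˡ 0#))
      ; ⊙-homo = λ a x → cong (_∷ a ⊙ x) (sym (zeroʳ a)) }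
    ; kernel = ∷-injectiveʳ }

  spread-↪ : (σ : Fin m → Fin n) → (∀ {i j} → σ i ≡ σ j → i ≡ j) → m ↪ n
  spread-↪ σ σ-injective = record
    { to     = spread σ 0#
    ; linear = pointwise-linear spread-⊕ spread-⊙
    ; kernel = λ {x} eq → lookup-ext λ l → trans (sym (lookup-spread σ 0# σ-injective x l))
        (trans (cong (λ z → lookup z (σ l)) eq) (trans (lookup-0⃗ (σ l)) (sym (lookup-0⃗ l)))) }
    where
    spread-⊕ : ∀ x y i → lookup (spread σ 0# (x ⊕ y)) i ≡ lookup (spread σ 0# x) i + lookup (spread σ 0# y) i
    spread-⊕ x y i with spread-cases σ 0# i
    ... | inj₁ (l , _ , val) = trans (val _) (trans (lookup-⊕ x y l) (sym (cong₂ _+_ (val x) (val y))))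
    ... | inj₂ (_ , val)     = trans (val _) (sym (trans (cong₂ _+_ (val x) (val y)) (+-identityˡ 0#)))

    spread-⊙ : ∀ a x i → lookup (spread σ 0# (a ⊙ x)) i ≡ a * lookup (spread σ 0# x) i
    spread-⊙ a x i with spread-cases σ 0# i
    ... | inj₁ (l , _ , val) = trans (val _) (trans (lookup-⊙ a x l) (sym (cong (a *_) (val x))))
    ... | inj₂ (_ , val)     = trans (val _) (sym (trans (cong (a *_) (val x)) (zeroʳ a)))

  normalise : ∀ {a} (a≢0 : a ≢ 0#) (x : Vec F n) → a ∷ x ≡ a ⊙ (1# ∷ inverse a≢0 ⊙ x)
  normalise {a = a} a≢0 x = cong₂ _∷_ (sym (*-identityʳ a)) (sym (begin
    a ⊙ inverse a≢0 ⊙ x      ≡⟨ ⊙-assoc a _ x ⟩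
    (a * inverse a≢0) ⊙ x    ≡⟨ cong (_⊙ x) (trans (*-comm a _) (proj₂ (invertible a≢0))) ⟩
    1# ⊙ x                   ≡⟨ 1⊙ x ⟩
    x                        ∎))

  cone-head : {S : Vec F n → Set} → IsCone S → (ψ : suc k ↪ n) → (∀ t → S (to ψ (1# ∷ t))) →
              ∀ x → head x ≢ 0# → S (to ψ x)
  cone-head {S = S} cone ψ all (a ∷ x) a≢0 =
    subst (S ∘ to ψ) (sym (normalise a≢0 x)) (scale (pullback cone ψ) a≢0 (all _))

  -- A vector over the subspace found at infinity either lies at infinity itself or has nonzero
  -- head, and then it is a multiple of a point of the affine chart.
  cone-extend : {S : Vec F n → Set} → IsCone S → (ψ : suc k ↪ n) → (∀ t → S (to ψ (1# ∷ t))) →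
                ProjectiveFlat m (S ∘ to (ψ ∘↪ zero-↪)) → ProjectiveFlat (suc m) S
  cone-extend {S = S} cone ψ all (φ , all-in) = ψ ∘↪ cons-↪ φ , λ {x} → extended x
    where
    extended : ∀ x → x ≢ 0⃗ → S (to ψ (to (cons-↪ φ) x))
    extended (a ∷ x) ax≢0 with a ≟ 0#
    ... | yes refl = all-in λ { refl → ax≢0 refl }
    ... | no a≢0   = cone-head cone ψ all (a ∷ to φ x) a≢0

  -- Hales-Jewett with `F` itself as alphabet, applied to the vectors of head 1: a combinatorial
  -- subspace is in particular an affine subspace.
  monochromatic-affine : ∀ K → ∃[ n ] ∀ {S : Vec F n → Set} → IsCone S →
    ∃ λ (ψ : suc K ↪ n) → (∀ t → S (to ψ (1# ∷ t))) ⊎ (∀ t → ¬ S (to ψ (1# ∷ t)))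
  monochromatic-affine K = suc (proj₁ subspace) , found
    where
    subspace = hales-jewett-subspace (Fin-finite {q}) (Fin-finite {2}) K

    found : ∀ {S : Vec F (suc (proj₁ subspace)) → Set} → IsCone S →
      ∃ λ (ψ : suc K ↪ suc (proj₁ subspace)) → (∀ t → S (to ψ (1# ∷ t))) ⊎ (∀ t → ¬ S (to ψ (1# ∷ t)))
    found {S} cone = ψ , uniform
      where
      χ : Vec F (proj₁ subspace) → Fin 2
      χ w = indicator (member? cone (1# ∷ w))
      P         = proj₁ (proj₂ subspace χ)
      variables = proj₁ (proj₂ (proj₂ subspace χ))
      mono      = proj₂ (proj₂ (proj₂ subspace χ))

      -- The leading 1 of the chart is the nonzero constant that `pattern-↪` asks for.
      ψ = pattern-↪ (inj₁ 1# ∷ P) (1# , 1≢0 , here refl) (λ l → there (variables l))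

      ψ-1 : ∀ t → to ψ (1# ∷ t) ≡ 1# ∷ substitute P (lookup t)
      ψ-1 t = cong₂ _∷_ (*-identityˡ 1#)
        (map-cong (λ { (inj₁ b) → *-identityˡ b ; (inj₂ l) → refl }) P)

      uniform : (∀ t → S (to ψ (1# ∷ t))) ⊎ (∀ t → ¬ S (to ψ (1# ∷ t)))
      uniform with member? cone (1# ∷ substitute P (lookup 0⃗))
      ... | yes s = inj₁ λ t → subst S (sym (ψ-1 t))
            (indicator-transfer {P? = member? cone _} {member? cone _} (mono 0⃗ t) s)
      ... | no ¬s = inj₂ λ t s → ¬s
            (indicator-transfer {P? = member? cone _} {member? cone _} (mono t 0⃗) (subst S (ψ-1 t) s))

  -- Induction on both ranks. An affine chart that lies inside `S` or outside it adds 1 to the rank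
  -- of a subspace of the same kind at infinity, so one of the two targets drops by one there. Since
  -- the side is not known beforehand, the part at infinity has dimension `n₁ ℕ.+ n₂`, with room for
  -- either case.
  points-ramsey : ∀ a b → ∃[ n ] ∀ {S : Vec F n → Set} → IsCone S →
    ProjectiveFlat a S ⊎ ProjectiveFlat b (¬_ ∘ S)
  points-ramsey zero    b       = 0 , λ cone → inj₁ (id-↪ , λ { {[]} x≢0 → contradiction refl x≢0 })
  points-ramsey (suc a) zero    = 0 , λ cone → inj₂ (id-↪ , λ { {[]} x≢0 → contradiction refl x≢0 })
  points-ramsey (suc a) (suc b) = proj₁ flat , λ {S} cone → split cone (proj₂ flat cone)
    where
    n₁ = proj₁ (points-ramsey a (suc b))
    n₂ = proj₁ (points-ramsey (suc a) b)
    flat = monochromatic-affine (n₁ ℕ.+ n₂)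

    left : n₁ ↪ n₁ ℕ.+ n₂
    left = spread-↪ (_↑ˡ n₂) (↑ˡ-injective n₂ _ _)
    right : n₂ ↪ n₁ ℕ.+ n₂
    right = spread-↪ (n₁ ↑ʳ_) (↑ʳ-injective n₁ _ _)

    split : ∀ {S : Vec F (proj₁ flat) → Set} → IsCone S →
      (∃ λ (ψ : suc (n₁ ℕ.+ n₂) ↪ proj₁ flat) → (∀ t → S (to ψ (1# ∷ t))) ⊎ (∀ t → ¬ S (to ψ (1# ∷ t)))) →
      ProjectiveFlat (suc a) S ⊎ ProjectiveFlat (suc b) (¬_ ∘ S)
    split cone (ψ , inj₁ all) = Sum.map
      (λ (φ , all-in) → cone-extend cone ψ all (left ∘↪ φ , all-in))
      (λ (φ , all-out) → (ψ ∘↪ zero-↪) ∘↪ left ∘↪ φ , all-out)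
      (proj₂ (points-ramsey a (suc b)) (pullback cone ((ψ ∘↪ zero-↪) ∘↪ left)))
    split cone (ψ , inj₂ all) = Sum.map
      (λ (φ , all-in) → (ψ ∘↪ zero-↪) ∘↪ right ∘↪ φ , all-in)
      (λ (φ , all-out) → cone-extend (complement cone) ψ all (right ∘↪ φ , all-out))
      (proj₂ (points-ramsey (suc a) b) (pullback cone ((ψ ∘↪ zero-↪) ∘↪ right)))

  unavoidable : ∀ {g} → Covering (suc g) → ∀ k → ∃[ N ] ∀ {S : Vec F N → Set} → IsCone S → (∀ i → S (unit i)) →
    IndependentFlat (suc k) S ⊎ AffineFlat k S ⊎ ProjectiveFlat (suc k) S
  unavoidable covering k = proj₁ affine , λ cone units →
    [ inj₁ , (λ (ψ , all) → inj₂ (conclude cone ψ all)) ]′ (proj₂ affine cone units)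
    where
    -- Outside `S` rank `k` is enough: the base point of the affine subspace supplies the missing
    -- dimension.
    ramsey = points-ramsey (suc k) k
    affine = affine-subspace covering (suc k) (proj₁ ramsey)

    conclude : ∀ {n} {S : Vec F n → Set} → IsCone S → (ψ : suc (proj₁ ramsey) ↪ n) →
               (∀ t → S (to ψ (1# ∷ t))) → AffineFlat k S ⊎ ProjectiveFlat (suc k) S
    conclude {S = S} cone ψ all with proj₂ ramsey (pullback cone (ψ ∘↪ zero-↪))
    ... | inj₁ (φ , all-in)  = inj₂ ((ψ ∘↪ zero-↪) ∘↪ φ , all-in)
    ... | inj₂ (φ , all-out) = inj₁ (ψ ∘↪ cons-↪ φ ,
      (λ { {a ∷ x} a≢0 → cone-head cone ψ all (a ∷ to φ x) a≢0 }) ,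
      (λ { {a ∷ x} ax≢0 refl → all-out λ { refl → ax≢0 refl } }))

-- Subsets given by decidable predicates

subset : ∀ {n} {P : Fin n → Set} → Decidable P → Subset n
subset P? = tabulate (does ∘ P?)

∈-subset⁺ : ∀ {n} {P : Fin n → Set} (P? : Decidable P) {i} → P i → i Subset.∈ subset P?
∈-subset⁺ P? {i} p = lookup⇒[]= i _ (trans (lookup∘tabulate _ i) true-at)
  where
  true-at : does (P? i) ≡ true
  true-at with P? i
  ... | yes _ = refl
  ... | no ¬p = contradiction p ¬p

∈-subset⁻ : ∀ {n} {P : Fin n → Set} (P? : Decidable P) {i} → i Subset.∈ subset P? → P i
∈-subset⁻ P? {i} i∈ with P? i | trans (sym (lookup∘tabulate (does ∘ P?) i)) ([]=⇒lookup i∈)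
... | yes p | _ = p

injection⇒≤∣∣ : ∀ {g n} (σ : Fin g → Fin n) → (∀ {i j} → σ i ≡ σ j → i ≡ j) →
                (X : Subset n) → (∀ i → σ i Subset.∈ X) → g ≤ ∣ X ∣
injection⇒≤∣∣ {zero}  σ inj X σ∈X = ℕ.z≤n
injection⇒≤∣∣ {suc g} σ inj X σ∈X = ℕₚ.≤-trans (ℕ.s≤s (injection⇒≤∣∣ (σ ∘ suc) (suc-injective ∘ inj)
    (X Subset.- σ zero) λ i → x∈p∧x≢y⇒x∈p-y (σ∈X (suc i)) λ eq → case inj eq of λ ()))
  (x∈p⇒∣p-x∣<∣p∣ (σ∈X zero))

-- Subset sums in a prime field

module PrimeField {p : ℕ} (p-prime : Prime p) where

  open LinearAlgebra (GF p-prime)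
  open RamseyForCones (GF p-prime)
  open Cubes (GF p-prime)

  private
    instance
      p≢0 : NonZero p
      p≢0 = prime⇒nonZero p-prime

    -- In GF(p) every `t` is a repeated sum of `a`, with as many summands as the residue
    -- `t * inverse a≢0` says.
    closed⇒full : ∀ {P : F → Set} {a} → a ≢ 0# → P 0# → (∀ {t} → P t → P (t + a)) → ∀ t → P t
    closed⇒full {P} {a} a≢0 p₀ closed t = subst P eq (multiples (toℕ (t * inverse a≢0)))
      where
      open ≡-Reasoning
      multiples : ∀ j → P ((j mod p) * a)
      multiples zero    = subst P (sym (zeroˡ a)) p₀
      multiples (suc j) = subst P (sym (begin
        (suc j mod p) * a          ≡⟨ cong (λ j → (j mod p) * a) (ℕₚ.+-comm 1 j) ⟩
        ((j ℕ.+ 1) mod p) * a      ≡⟨ cong (_* a) (Modular.mod-+ p j 1) ⟨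
        ((j mod p) + 1#) * a       ≡⟨ distribʳ a _ 1# ⟩
        (j mod p) * a + 1# * a     ≡⟨ cong ((j mod p) * a +_) (*-identityˡ a) ⟩
        (j mod p) * a + a          ∎)) (closed (multiples j))
      eq : (toℕ (t * inverse a≢0) mod p) * a ≡ t
      eq = begin
        (toℕ (t * inverse a≢0) mod p) * a   ≡⟨ cong (_* a) (Modular.mod-toℕ p _) ⟩
        t * inverse a≢0 * a                 ≡⟨ *-assoc t _ a ⟩
        t * (inverse a≢0 * a)               ≡⟨ cong (t *_) (proj₂ (invertible a≢0)) ⟩
        t * 1#                              ≡⟨ *-identityʳ t ⟩
        t                                   ∎

  Sums : ∀ {R} → Vec F R → F → Set
  Sums e t = ∃[ η ] dot e η ≡ t

  sums? : ∀ {R} (e : Vec F R) → Decidable (Sums e)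
  sums? e t = Finite.any-finite? (Vec-finite Fin-finite) λ η → dot e η ≟ t

  nonzeros : ∀ {R} → Vec F R → Subset R
  nonzeros e = subset λ i → ¬? (lookup e i ≟ 0#)

  -- The case of two-element sets of the Cauchy–Davenport theorem: a set of
  -- sums that is not the whole field is not closed under adding a ≢ 0, so
  -- that a further summand a makes it larger.
  cauchy-davenport : ∀ {R} (e : Vec F R) → (∀ t → Sums e t) ⊎ ∣ nonzeros e ∣ < ∣ subset (sums? e) ∣
  cauchy-davenport [] = inj₂ (ℕₚ.≤-trans (ℕₚ.≤-reflexive (sym (∣⁅x⁆∣≡1 0#)))
    (p⊆q⇒∣p∣≤∣q∣ λ t∈ → ∈-subset⁺ (sums? []) ([] , sym (x∈⁅y⁆⇒x≡y 0# t∈))))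
  cauchy-davenport (a ∷ e) with cauchy-davenport e
  ... | inj₁ full = inj₁ λ t → let (η , eq) = full t in
        zero ∷ η , trans (cong (_+ dot e η) (zeroʳ a)) (trans (+-identityˡ _) eq)
  ... | inj₂ lt = grow
    where
    without : ∀ {t} → Sums e t → Sums (a ∷ e) t
    without (η , eq) = zero ∷ η , trans (cong (_+ dot e η) (zeroʳ a)) (trans (+-identityˡ _) eq)

    with-a : ∀ {t} → Sums e t → Sums (a ∷ e) (t + a)
    with-a (η , eq) = suc zero ∷ η , trans (cong₂ _+_ (*-identityʳ a) eq) (+-comm a _)

    sums⊆ : subset (sums? e) ⊆ subset (sums? (a ∷ e))
    sums⊆ = ∈-subset⁺ (sums? (a ∷ e)) ∘ without ∘ ∈-subset⁻ (sums? e)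

    grow : (∀ t → Sums (a ∷ e) t) ⊎ ∣ nonzeros (a ∷ e) ∣ < ∣ subset (sums? (a ∷ e)) ∣
    grow with a ≟ 0#
    ... | yes _ = inj₂ (ℕₚ.≤-trans lt (p⊆q⇒∣p∣≤∣q∣ sums⊆))
    ... | no a≢0 with any? (λ t → sums? e t ×-dec ¬? (sums? e (t + a)))
    ...   | yes (t , s , ¬s) = inj₂ (ℕₚ.≤-trans (ℕ.s≤s lt) (p⊂q⇒∣p∣<∣q∣
            (sums⊆ , t + a , ∈-subset⁺ (sums? (a ∷ e)) (with-a s) , ¬s ∘ ∈-subset⁻ (sums? e))))
    ...   | no none = inj₁ (without ∘ closed⇒full a≢0 (replicate _ zero , dot-zero e) closed)
      where
      closed : ∀ {t} → Sums e t → Sums e (t + a)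
      closed {t} s with sums? e (t + a)
      ... | yes s′ = s′
      ... | no ¬s  = contradiction (t , s , ¬s) none

  -- If some scalar were missed, the subset sums would outnumber the `suc p` nonzero summands, yet
  -- there are only `p` scalars.
  covering : Covering (suc p)
  covering {e = e} support = [ id , (λ lt → contradiction (many lt) ℕₚ.1+n≰n) ]′ (cauchy-davenport e)
    where
    many : ∣ nonzeros e ∣ < ∣ subset (sums? e) ∣ → suc p ≤ p
    many lt = ℕₚ.≤-trans (injection⇒≤∣∣ (position support) (position-injective support) (nonzeros e)
        λ i → ∈-subset⁺ (λ i → ¬? (lookup e i ≟ 0#)) (nonzero-at support i))
      (ℕₚ.≤-trans (ℕₚ.<⇒≤ lt) (∣p∣≤n (subset (sums? e))))

-- Rank as the maximum size of an independent subset

module Rank {n : ℕ} (M : Matroid n) (X : Subset n) where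

  open Matroid M

  private
    subsets-complete : ∀ {n} (I : Subset n) → I List.∈ subsets n
    subsets-complete []            = ListAny.here refl
    subsets-complete (outside ∷ I) = Listₚ.∈-++⁺ˡ (Listₚ.∈-map⁺ (outside ∷_) (subsets-complete I))
    subsets-complete (inside ∷ I)  =
      Listₚ.∈-++⁺ʳ (List.map (outside ∷_) (subsets _)) (Listₚ.∈-map⁺ (inside ∷_) (subsets-complete I))

    candidate? : Decidable (λ I → I ⊆ X × Indep I)
    candidate? I = (I ⊆? X) ×-dec indep? I

    candidates = List.filter candidate? (subsets n)

    bounded-by : ∀ {P : ℕ → Set} → (∀ {I} → Indep I → I ⊆ X → P ∣ I ∣) → All P (List.map ∣_∣ candidates)
    bounded-by {P} bound = All.tabulate λ s∈ → let (I , I∈ , eq) = Listₚ.∈-map⁻ ∣_∣ s∈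
                                                   (_ , I⊆X , ind) = Listₚ.∈-filter⁻ candidate? {xs = subsets n} I∈
                                               in subst P (sym eq) (bound ind I⊆X)

  rank-lower : ∀ {I} → Indep I → I ⊆ X → ∣ I ∣ ≤ rank M X
  rank-lower {I} ind I⊆X = v≤max⁺ 0 _ (inj₂ (ListAny.map (ℕₚ.≤-reflexive)
    (Listₚ.∈-map⁺ ∣_∣ (Listₚ.∈-filter⁺ candidate? (subsets-complete I) (I⊆X , ind)))))

  rank-upper : ∀ {r} → (∀ {I} → Indep I → I ⊆ X → ∣ I ∣ ≤ r) → rank M X ≤ r
  rank-upper bound = max≤v⁺ ℕ.z≤n (bounded-by bound)

  rank-attained : ∀ {r} → r ≤ rank M X → ∃[ I ] Indep I × I ⊆ X × r ≤ ∣ I ∣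
  rank-attained {zero}  _ = Subset.⊥ , ∅-indep , (λ x∈⊥ → contradiction x∈⊥ ∉⊥) , ℕ.z≤n
  rank-attained {suc r} r≤ with anySubset? (λ I → (I ⊆? X) ×-dec indep? I ×-dec (suc r ℕₚ.≤? ∣ I ∣))
  ... | yes (I , I⊆X , ind , le) = I , ind , I⊆X , le
  ... | no none = contradiction (ℕₚ.≤-trans r≤ (rank-upper λ {I} ind I⊆X →
          ℕₚ.≮⇒≥ λ lt → none (I , I⊆X , ind , lt))) ℕₚ.1+n≰n

-- Independence, parallel vectors and flats of represented matroids

module Geometry {q : ℕ} (𝔽 : FiniteField q) where

  open LinearAlgebra 𝔽
  open RamseyForCones 𝔽
  open Cubes 𝔽 using (zero-↪; spread-↪)

  private
    variable
      m n d k r : ℕ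

  Independent : (Fin n → Vec F d) → Subset n → Set
  Independent {n} w X = ∀ (c : Vec F n) → (∀ i → i Subset.∉ X → lookup c i ≡ 0#) → mat w c ≡ 0⃗ → c ≡ 0⃗

  linearlyIndependent⇔ : (v : Fin n → Fin d → F) (X : Subset n) →
    LinearlyIndependent 𝔽 v X ⇔ Independent (tabulate ∘ v) X
  linearlyIndependent⇔ {n} {d} v X = mk⇔
    (λ ind c sup eq → lookup-ext λ i → trans
      (ind (lookup c) sup (λ j → trans (sym (combination c j)) (trans (cong (λ z → lookup z j) eq) (lookup-0⃗ j))) i)
      (sym (lookup-0⃗ i)))
    (λ ind c sup eq i → trans (sym (lookup∘tabulate c i)) (trans (cong (λ z → lookup z i)
      (ind (tabulate c) (λ i i∉X → trans (lookup∘tabulate c i) (sup i i∉X))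
        (lookup-ext λ j → trans (combination (tabulate c) j) (trans
          (sum-cong-≗ (λ i → cong (_* v i j) (lookup∘tabulate c i)))
          (trans (eq j) (sym (lookup-0⃗ j))))))) (lookup-0⃗ i)))
    where
    combination : (c : Vec F n) (j : Fin d) → lookup (mat (tabulate ∘ v) c) j ≡ ∑[ i < n ] (lookup c i * v i j)
    combination c j = trans (lookup-mat (tabulate ∘ v) c j)
      (sum-cong-≗ λ i → cong (lookup c i *_) (lookup∘tabulate (v i) j))

  infix 4 _∥_

  _∥_ : Vec F d → Vec F d → Set
  x ∥ y = ∃[ s ] s ≢ 0# × x ≡ s ⊙ y

  ∥-sym : {x y : Vec F d} → x ∥ y → y ∥ x
  ∥-sym {y = y} (s , s≢0 , refl) = inverse s≢0 , inverse-nonzero s≢0 , sym (⊙-inverse s≢0 y)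

  ∥-trans : {x y z : Vec F d} → x ∥ y → y ∥ z → x ∥ z
  ∥-trans {z = z} (s , s≢0 , refl) (t , t≢0 , refl) = s * t , *-nonzero s≢0 t≢0 , ⊙-assoc s t z

  ∥-reflexive : {x y : Vec F d} → x ≡ y → x ∥ y
  ∥-reflexive refl = 1# , 1≢0 , sym (1⊙ _)

  ∥-to : (φ : m ↪ n) {x y : Vec F m} → x ∥ y → to φ x ∥ to φ y
  ∥-to φ (s , s≢0 , refl) = s , s≢0 , ⊙-homo (linear φ) s _

  ∥-injective : (φ : m ↪ n) {x y : Vec F m} → to φ x ∥ to φ y → x ∥ y
  ∥-injective φ (s , s≢0 , eq) = s , s≢0 , injective φ (trans eq (sym (⊙-homo (linear φ) s _)))

  ∥-unit : {i j : Fin n} → unit i ∥ unit j → i ≡ j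
  ∥-unit {i = i} {j} (s , s≢0 , eq) with j ≟ i
  ... | yes j≡i = sym j≡i
  ... | no j≢i  = contradiction (begin
    1#                     ≡⟨ unit-same i ⟨
    lookup (unit i) i      ≡⟨ cong (λ x → lookup x i) eq ⟩
    lookup (s ⊙ unit j) i  ≡⟨ lookup-⊙ s (unit j) i ⟩
    s * lookup (unit j) i  ≡⟨ cong (s *_) (unit-other j≢i) ⟩
    s * 0#                 ≡⟨ zeroʳ s ⟩
    0#                     ∎) 1≢0
    where open ≡-Reasoning

  sum-zero : {t : Fin n → F} → (∀ i → t i ≡ 0#) → sum t ≡ 0#
  sum-zero {n} eq = trans (sum-cong-≗ eq) (sum-replicate-zero n)

  -- A relation among the v e pushes forward to one among the vectors w i
  -- parallel to them.
  transfer : {v : Fin n → Vec F d} {w : Fin m → Vec F d} {X : Subset n} {Y : Subset m} →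
    (∀ {e} → e Subset.∈ X → ∃[ i ] i Subset.∈ Y × v e ∥ w i) →
    (∀ {e e′ i} → e Subset.∈ X → e′ Subset.∈ X → v e ∥ w i → v e′ ∥ w i → e ≡ e′) →
    Independent w Y → Independent v X
  transfer {n} {d} {m} {v} {w} {X} {Y} parallel distinct ind c sup eq =
    lookup-ext λ e → trans (vanish e (image e)) (sym (lookup-0⃗ e))
    where
    open ≡-Reasoning
    Image : Fin n → Set
    Image e = (∃[ i ] e Subset.∈ X × i Subset.∈ Y × v e ∥ w i) ⊎ e Subset.∉ X

    image : ∀ e → Image e
    image e with e ∈? X
    ... | yes e∈X = let (i , i∈Y , par) = parallel e∈X in inj₁ (i , e∈X , i∈Y , par)
    ... | no e∉X  = inj₂ e∉X

    column : ∀ {e} → Image e → Vec F m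
    column (inj₁ (i , _ , _ , s , _)) = s ⊙ unit i
    column (inj₂ _)                   = 0⃗

    u : Fin n → Vec F m
    u e = column (image e)

    mat-column : ∀ e → (im : Image e) → lookup c e ≡ 0# ⊎ mat w (column im) ≡ v e
    mat-column e (inj₁ (i , _ , _ , s , _ , eq)) =
      inj₂ (trans (⊙-homo (mat-linear w) s (unit i)) (trans (cong (s ⊙_) (mat-unit w i)) (sym eq)))
    mat-column e (inj₂ e∉X) = inj₁ (sup e e∉X)

    column-entry : ∀ {e i} (im : Image e) → (∀ i′ → e Subset.∈ X → i′ Subset.∈ Y → v e ∥ w i′ → i′ ≢ i) →
                   lookup c e * lookup (column im) i ≡ 0#
    column-entry {e} {i} (inj₁ (i′ , e∈X , i′∈Y , par@(s , _))) off = trans (cong (lookup c e *_)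
      (trans (lookup-⊙ s (unit i′) i) (trans (cong (s *_) (unit-other (off i′ e∈X i′∈Y par))) (zeroʳ s)))) (zeroʳ _)
    column-entry {e} {i} (inj₂ e∉X) off = trans (cong (_* lookup {n = m} 0⃗ i) (sup e e∉X)) (zeroˡ _)

    pushed : mat u c ≡ 0⃗
    pushed = ind (mat u c)
      (λ i i∉Y → trans (lookup-mat u c i) (sum-zero λ e →
        column-entry (image e) λ { i′ _ i′∈Y _ refl → i∉Y i′∈Y }))
      (trans (mat-commutes (mat-linear w) u c) (trans (mat-cong {x = c} λ e → mat-column e (image e)) eq))

    vanish : ∀ e → Image e → lookup c e ≡ 0#
    vanish e (inj₂ e∉X) = sup e e∉X
    vanish e (inj₁ (i , e∈X , _ , par)) = at-column (image e) refl
      where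
      at-column : (im : Image e) → im ≡ image e → lookup c e ≡ 0#
      at-column (inj₂ e∉X) _ = sup e e∉X
      -- By `distinct`, no other element of `X` is parallel to `w j`, so entry `j` of the pushed
      -- relation is `lookup c e` times the nonzero scalar `s`.
      at-column (inj₁ (j , e∈X , _ , par@(s , s≢0 , _))) im≡ = *-zero (begin
        lookup c e * lookup (s ⊙ unit j) j   ≡⟨ cong (λ im → lookup c e * lookup (column im) j) im≡ ⟩
        lookup c e * lookup (u e) j          ≡⟨ sum-single e (λ e′ e′≢e → column-entry (image e′)
                                                  λ { i′ e′∈X _ par′ refl → e′≢e (distinct e′∈X e∈X par′ par) }) ⟨
        ∑[ e < n ] (lookup c e * lookup (u e) j)   ≡⟨ lookup-mat u c j ⟨
        lookup (mat u c) j                   ≡⟨ trans (cong (λ z → lookup z j) pushed) (lookup-0⃗ j) ⟩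
        0#                                   ∎)
        λ eq → s≢0 (trans (sym (*-identityʳ s)) (trans (cong (s *_) (sym (unit-same j)))
          (trans (sym (lookup-⊙ s (unit j) j)) eq)))

  independent-image : (φ : m ↪ d) {w : Fin n → Vec F m} {X : Subset n} →
    Independent (to φ ∘ w) X ⇔ Independent w X
  independent-image φ {w} = mk⇔
    (λ ind c sup eq → ind c sup (trans (sym (mat-commutes (linear φ) w c))
      (trans (cong (to φ) eq) (0⃗-homo (linear φ)))))
    (λ ind c sup eq → ind c sup (kernel φ (trans (mat-commutes (linear φ) w c) eq)))

  independent-units : {X : Subset n} → Independent unit X
  independent-units c sup eq = trans (sym (mat-units c)) eq

  insert : (J : Subset n) → Vec F ∣ J ∣ → Vec F n
  insert []            y       = []
  insert (inside ∷ J)  (a ∷ y) = a ∷ insert J y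
  insert (outside ∷ J) y       = 0# ∷ insert J y

  insert-↪ : (J : Subset n) → ∣ J ∣ ↪ n
  insert-↪ J = record
    { to     = insert J
    ; linear = record { ⊕-homo = insert-⊕ J ; ⊙-homo = insert-⊙ J }
    ; kernel = λ {x} → insert-kernel J x }
    where
    insert-⊕ : (J : Subset n) → ∀ x y → insert J (x ⊕ y) ≡ insert J x ⊕ insert J y
    insert-⊕ []            x       y       = refl
    insert-⊕ (inside ∷ J)  (a ∷ x) (b ∷ y) = cong (a + b ∷_) (insert-⊕ J x y)
    insert-⊕ (outside ∷ J) x       y       = cong₂ _∷_ (sym (+-identityˡ 0#)) (insert-⊕ J x y)

    insert-⊙ : (J : Subset n) → ∀ a x → insert J (a ⊙ x) ≡ a ⊙ insert J x
    insert-⊙ []            a x       = refl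
    insert-⊙ (inside ∷ J)  a (b ∷ x) = cong (a * b ∷_) (insert-⊙ J a x)
    insert-⊙ (outside ∷ J) a x       = cong₂ _∷_ (sym (zeroʳ a)) (insert-⊙ J a x)

    insert-kernel : (J : Subset n) → ∀ x → insert J x ≡ 0⃗ → x ≡ 0⃗
    insert-kernel []            []      _  = refl
    insert-kernel (inside ∷ J)  (a ∷ x) eq = cong₂ _∷_ (∷-injectiveˡ eq) (insert-kernel J x (∷-injectiveʳ eq))
    insert-kernel (outside ∷ J) x       eq = insert-kernel J x (∷-injectiveʳ eq)

  insert-outside : (J : Subset n) (y : Vec F ∣ J ∣) → ∀ i → i Subset.∉ J → lookup (insert J y) i ≡ 0#
  insert-outside (inside ∷ J)  (a ∷ y) zero    i∉J = contradiction here i∉J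
  insert-outside (inside ∷ J)  (a ∷ y) (suc i) i∉J = insert-outside J y i (i∉J ∘ there)
  insert-outside (outside ∷ J) y       zero    i∉J = refl
  insert-outside (outside ∷ J) y       (suc i) i∉J = insert-outside J y i (i∉J ∘ there)

  insert-unit : (J : Subset n) (i : Fin ∣ J ∣) → ∃[ e ] e Subset.∈ J × insert J (unit i) ≡ unit e
  insert-unit (inside ∷ J)  zero    = zero , here , cong (1# ∷_) (0⃗-homo (linear (insert-↪ J)))
  insert-unit (inside ∷ J)  (suc i) = let (e , e∈J , eq) = insert-unit J i in suc e , there e∈J , cong (0# ∷_) eq
  insert-unit (outside ∷ J) i       = let (e , e∈J , eq) = insert-unit J i in suc e , there e∈J , cong (0# ∷_) eq

  independent-↪ : {v : Fin n → Vec F d} {J : Subset n} → Independent v J → ∣ J ∣ ↪ d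
  independent-↪ {v = v} {J} ind = record
    { to     = mat v ∘ insert J
    ; linear = ∘-linear (mat-linear v) (linear (insert-↪ J))
    ; kernel = λ {y} eq → kernel (insert-↪ J) (ind (insert J y) (insert-outside J y) eq) }

  -- Vectors in the image of `Φ` can be read in `r` coordinates. They stay independent there, and
  -- dimensions compare.
  independent-in-image : (Φ : r ↪ d) {v : Fin n → Vec F d} {J : Subset n} → Independent v J →
    (∀ {e} → e Subset.∈ J → ∃[ x ] v e ≡ to Φ x) → ∣ J ∣ ≤ r
  independent-in-image {r} {d} {n} Φ {v} {J} ind image = ↪⇒≤ (independent-↪ {v = coordinates} {J}
      λ c sup eq → ind c sup (begin
        mat v c                        ≡⟨ mat-cong {x = c} (λ e → Sum.map₁ (sup e) (agree e)) ⟩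
        mat (to Φ ∘ coordinates) c     ≡⟨ mat-commutes (linear Φ) coordinates c ⟨
        to Φ (mat coordinates c)       ≡⟨ cong (to Φ) eq ⟩
        to Φ 0⃗                         ≡⟨ 0⃗-homo (linear Φ) ⟩
        0⃗                              ∎))
    where
    open ≡-Reasoning
    coordinates : Fin n → Vec F r
    coordinates e with e ∈? J
    ... | yes e∈J = proj₁ (image e∈J)
    ... | no _    = 0⃗

    agree : ∀ e → e Subset.∉ J ⊎ v e ≡ to Φ (coordinates e)
    agree e with e ∈? J
    ... | yes e∈J = inj₂ (proj₂ (image e∈J))
    ... | no e∉J  = inj₁ e∉J

  module Represented (M : Matroid n) (v : Fin n → Vec F d)
    (represents : ∀ X → Matroid.Indep M X ⇔ (X ⊆ Matroid.E M × Independent v X)) where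

    open Matroid M
    open Rank M

    indep⁺ : ∀ {X} → X ⊆ E → Independent v X → Indep X
    indep⁺ X⊆E ind = Equivalence.from (represents _) (X⊆E , ind)

    indep⁻ : ∀ {X} → Indep X → Independent v X
    indep⁻ = proj₂ ∘ Equivalence.to (represents _)

    -- Distinct unit vectors are not parallel, so the chosen elements are distinct; `transfer` to
    -- the images of the unit vectors makes them independent.
    embedding⇒≤rank : (Φ : r ↪ d) {X : Subset n} → X ⊆ E →
      (∀ i → ∃[ e ] e Subset.∈ X × to Φ (unit i) ∥ v e) → r ≤ rank M X
    embedding⇒≤rank {r} Φ {X} X⊆E basis = ℕₚ.≤-trans
        (injection⇒≤∣∣ β β-injective I λ i → ∈-subset⁺ β-image? (i , refl))
        (rank-lower X (indep⁺ (X⊆E ∘ I⊆X) independent) I⊆X)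
      where
      β : Fin r → Fin n
      β i = proj₁ (basis i)

      parallel : ∀ i → v (β i) ∥ to Φ (unit i)
      parallel i = ∥-sym (proj₂ (proj₂ (basis i)))

      same : ∀ {e e′ i j} → v e ∥ to Φ (unit i) → e ≡ e′ → v e′ ∥ to Φ (unit j) → i ≡ j
      same p refl p′ = ∥-unit (∥-injective Φ (∥-trans (∥-sym p) p′))

      β-injective : ∀ {i j} → β i ≡ β j → i ≡ j
      β-injective {i} {j} eq = same (parallel i) eq (parallel j)

      β-image? : Decidable (λ e → ∃[ i ] β i ≡ e)
      β-image? e = any? λ i → β i ≟ e

      I = subset β-image?

      I⊆X : I ⊆ X
      I⊆X e∈I = let (i , eq) = ∈-subset⁻ β-image? e∈I in subst (Subset._∈ X) eq (proj₁ (proj₂ (basis i)))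

      independent : Independent v I
      independent = transfer {w = to Φ ∘ unit} {Y = ⊤}
        (λ e∈I → let (i , eq) = ∈-subset⁻ β-image? e∈I in
          i , ∈⊤ , subst (λ e → v e ∥ to Φ (unit i)) eq (parallel i))
        (λ e∈I e′∈I p p′ → let (j , eq) = ∈-subset⁻ β-image? e∈I
                               (j′ , eq′) = ∈-subset⁻ β-image? e′∈I in
          trans (sym eq) (trans (cong β (trans (same (parallel j) eq p) (sym (same (parallel j′) eq′ p′)))) eq′))
        (Equivalence.from (independent-image Φ) independent-units)

    -- `τ` is a change of basis. The images of the unit vectors under `Φ` need not be elements of
    -- the matroid: in an affine geometry most of them lie at infinity.
    module _ (Φ : k ↪ d) (τ : k ↪ k) {X : Subset n} (X⊆E : X ⊆ E)
      (image : ∀ {e} → e Subset.∈ X → ∃[ x ] v e ≡ to Φ x)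
      (complete : ∀ {e} → e Subset.∈ E → ∃[ x ] v e ≡ to Φ x → e Subset.∈ X)
      (basis : ∀ i → ∃[ e ] e Subset.∈ X × to Φ (to τ (unit i)) ∥ v e) where

      rank-subspace : rank M X ≡ k
      rank-subspace = ℕₚ.≤-antisym
        (rank-upper X λ ind J⊆X → independent-in-image Φ (indep⁻ ind) (image ∘ J⊆X))
        (embedding⇒≤rank (Φ ∘↪ τ) X⊆E basis)

      -- An element outside `X` extends the basis by an independent vector: a relation with nonzero
      -- coefficient at `v e` would put `v e` into the image of `Φ`, hence `e` into `X`.
      flat-subspace : Flat M X
      flat-subspace = X⊆E , λ {e} e∈E e∉X → ℕₚ.≤-trans (ℕ.s≤s (ℕₚ.≤-reflexive rank-subspace))
          (embedding⇒≤rank (extended e∈E e∉X) (λ f∈ → case x∈p∪q⁻ X ⁅ e ⁆ f∈ of λ where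
              (inj₁ f∈X) → X⊆E f∈X
              (inj₂ f∈e) → subst (Subset._∈ E) (sym (x∈⁅y⁆⇒x≡y e f∈e)) e∈E)
            λ i → extended-basis e∈E e∉X i)
        where
        open ≡-Reasoning
        columns : Fin n → Fin (suc k) → Vec F d
        columns e zero    = v e
        columns e (suc i) = to Φ (to τ (unit i))

        columns-tail : ∀ x → mat (to (Φ ∘↪ τ) ∘ unit) x ≡ to Φ (to τ x)
        columns-tail x = trans (sym (mat-commutes (linear (Φ ∘↪ τ)) unit x)) (cong (to (Φ ∘↪ τ)) (mat-units x))

        extended : ∀ {e} → e Subset.∈ E → e Subset.∉ X → suc k ↪ d
        extended {e} e∈E e∉X = record
          { to = mat (columns e) ; linear = mat-linear (columns e) ; kernel = λ {x} → kernel′ x }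
          where
          kernel′ : ∀ x → mat (columns e) x ≡ 0⃗ → x ≡ 0⃗
          kernel′ (a ∷ x) eq with a ≟ 0#
          ... | yes refl = cong (0# ∷_) (kernel (Φ ∘↪ τ) (begin
                to Φ (to τ x)                                  ≡⟨ columns-tail x ⟨
                mat (columns e ∘ suc) x                        ≡⟨ ⊕-identityˡ _ ⟨
                0⃗ ⊕ mat (columns e ∘ suc) x                    ≡⟨ cong (_⊕ mat (columns e ∘ suc) x) (0⊙ (v e)) ⟨
                0# ⊙ v e ⊕ mat (columns e ∘ suc) x             ≡⟨ eq ⟩
                0⃗                                              ∎))
          ... | no a≢0 = contradiction (complete e∈E (inverse a≢0 ⊙ (- 1#) ⊙ to τ x , (begin
                v e
                  ≡⟨ ⊙-inverse a≢0 (v e) ⟨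
                inverse a≢0 ⊙ a ⊙ v e
                  ≡⟨ cong (inverse a≢0 ⊙_) (⊖-cancel _ _
                       (trans (cong (a ⊙ v e ⊕_) (⊖-involutive (to Φ (to τ x)))) eq′)) ⟩
                inverse a≢0 ⊙ (- 1#) ⊙ to Φ (to τ x)
                  ≡⟨ cong (inverse a≢0 ⊙_) (⊙-homo (linear Φ) _ _) ⟨
                inverse a≢0 ⊙ to Φ ((- 1#) ⊙ to τ x)
                  ≡⟨ ⊙-homo (linear Φ) _ _ ⟨
                to Φ (inverse a≢0 ⊙ (- 1#) ⊙ to τ x)
                  ∎))) e∉X
            where
            eq′ : a ⊙ v e ⊕ to Φ (to τ x) ≡ 0⃗
            eq′ = trans (cong (a ⊙ v e ⊕_) (sym (columns-tail x))) eq

        extended-basis : ∀ {e} (e∈E : e Subset.∈ E) (e∉X : e Subset.∉ X) (i : Fin (suc k)) →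
          ∃[ f ] f Subset.∈ X ∪ ⁅ e ⁆ × to (extended e∈E e∉X) (unit i) ∥ v f
        extended-basis {e} _ _ zero    = e , x∈p∪q⁺ (inj₂ (x∈⁅x⁆ e)) , ∥-reflexive (mat-unit (columns e) zero)
        extended-basis {e} _ _ (suc i) = let (f , f∈X , par) = basis i in
          f , x∈p∪q⁺ (inj₁ f∈X) , subst (_∥ v f) (sym (mat-unit (columns e) (suc i))) par

  -- Two matroids represented by parallel families of vectors

  module _ (M : Matroid n) (N : Matroid m) (v : Fin n → Vec F d) (w : Fin m → Vec F d)
    (independent-M : ∀ {X} → X ⊆ Matroid.E M → Matroid.Indep M X ⇔ Independent v X)
    (independent-N : ∀ {Y} → Y ⊆ Matroid.E N → Matroid.Indep N Y ⇔ Independent w Y)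
    (v-simple : ∀ {e f} → e Subset.∈ Matroid.E M → f Subset.∈ Matroid.E M → v e ∥ v f → e ≡ f)
    (w-simple : ∀ {i j} → i Subset.∈ Matroid.E N → j Subset.∈ Matroid.E N → w i ∥ w j → i ≡ j)
    (v⇒w : ∀ {e} → e Subset.∈ Matroid.E M → ∃[ i ] i Subset.∈ Matroid.E N × v e ∥ w i)
    (w⇒v : ∀ {i} → i Subset.∈ Matroid.E N → ∃[ e ] e Subset.∈ Matroid.E M × w i ∥ v e)
    where

    private
      element-≡ : ∀ {n} {L : Matroid n} {x y : Element L} → proj₁ x ≡ proj₁ y → x ≡ y
      element-≡ {x = _ , p} {_ , q} refl = cong (_ ,_) ([]=-irrelevant p q)

      toN : Element M → Element N
      toN (e , e∈) = let (i , i∈ , _) = v⇒w e∈ in i , i∈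

      toM : Element N → Element M
      toM (i , i∈) = let (e , e∈ , _) = w⇒v i∈ in e , e∈

      toN-∥ : ∀ x → v (proj₁ x) ∥ w (proj₁ (toN x))
      toN-∥ (e , e∈) = proj₂ (proj₂ (v⇒w e∈))

      toM-∥ : ∀ y → w (proj₁ y) ∥ v (proj₁ (toM y))
      toM-∥ (i , i∈) = proj₂ (proj₂ (w⇒v i∈))

      toN-toM : ∀ y → toN (toM y) ≡ y
      toN-toM y = element-≡ {L = N} (w-simple (proj₂ (toN (toM y))) (proj₂ y)
        (∥-sym (∥-trans (toM-∥ y) (toN-∥ (toM y)))))

      toM-toN : ∀ x → toM (toN x) ≡ x
      toM-toN x = element-≡ {L = M} (v-simple (proj₂ (toM (toN x))) (proj₂ x)
        (∥-sym (∥-trans (toN-∥ x) (toM-∥ (toN x)))))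

    -- Each element corresponds to the one parallel to it, unique as neither family has parallel
    -- pairs. `transfer` in either direction then compares independence.
    parallel⇒≅ : M ≅ N
    parallel⇒≅ = record
      { bijection = mk↔ₛ′ toN toM toN-toM toM-toN
      ; preserves = λ {X} {Y} X⊆E Y⊆E same →
          let open Equivalence
              M⇒N : Independent v X → Independent w Y
              M⇒N = transfer {v = w} {v} {Y} {X}
                (λ {i} i∈Y → let y = i , Y⊆E i∈Y in proj₁ (toM y) ,
                  from (same (toM y)) (subst (Subset._∈ Y) (sym (cong proj₁ (toN-toM y))) i∈Y) , toM-∥ y)
                (λ i∈Y j∈Y p q → w-simple (Y⊆E i∈Y) (Y⊆E j∈Y) (∥-trans p (∥-sym q)))
              N⇒M : Independent w Y → Independent v X
              N⇒M = transfer {v = v} {w} {X} {Y}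
                (λ {e} e∈X → let x = e , X⊆E e∈X in proj₁ (toN x) , to (same x) e∈X , toN-∥ x)
                (λ e∈X f∈X p q → v-simple (X⊆E e∈X) (X⊆E f∈X) (∥-trans p (∥-sym q)))
          in mk⇔ (from (independent-N Y⊆E) ∘ M⇒N ∘ to (independent-M X⊆E))
                 (from (independent-M X⊆E) ∘ N⇒M ∘ to (independent-N Y⊆E)) }

-- Points of a projective geometry and its hyperplane at infinity

module ProjectiveGeometry {q : ℕ} (𝔽 : FiniteField q) where

  open LinearAlgebra 𝔽
  open RamseyForCones 𝔽
  open Cubes 𝔽 using (zero-↪)
  open Geometry 𝔽

  private
    variable
      k : ℕ

  pointᵥ : ∀ k → Fin (#points 𝔽 k) → Vec F k
  pointᵥ k i = tabulate (point 𝔽 k i)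

  pointᵥ-nonzero : (i : Fin (#points 𝔽 k)) → pointᵥ k i ≢ 0⃗
  pointᵥ-nonzero {k} i eq = let (j , nz) = point-nonzero 𝔽 k i in
    nz (trans (sym (lookup∘tabulate _ j)) (trans (cong (λ x → lookup x j) eq) (lookup-0⃗ j)))

  pointᵥ-simple : {i j : Fin (#points 𝔽 k)} → pointᵥ k i ∥ pointᵥ k j → i ≡ j
  pointᵥ-simple {k} {i} {j} (s , _ , eq) = point-unique 𝔽 k i j s λ l →
    trans (sym (lookup∘tabulate _ l)) (trans (cong (λ x → lookup x l) eq)
      (trans (lookup-⊙ s (pointᵥ k j) l) (cong (s *_) (lookup∘tabulate _ l))))

  pointᵥ-exists : {x : Vec F k} → x ≢ 0⃗ → ∃[ i ] x ∥ pointᵥ k i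
  pointᵥ-exists {k} {x} x≢0 = let (i , s , eq) = point-exists 𝔽 k (lookup x) (nonzero-entry x≢0)
                                  x≡ = lookup-ext λ j → trans (eq j) (sym (trans (lookup-⊙ s (pointᵥ k i) j)
                                         (cong (s *_) (lookup∘tabulate (point 𝔽 k i) j)))) in
    i , s , (λ s≡0 → x≢0 (trans x≡ (trans (cong (_⊙ pointᵥ k i) s≡0) (0⊙ _)))) , x≡

  PG-independent : ∀ k X → Matroid.Indep (PG 𝔽 k) X ⇔ Independent (pointᵥ k) X
  PG-independent k X = linearlyIndependent⇔ (point 𝔽 k) X

  PG-represents : ∀ k X → Matroid.Indep (PG 𝔽 k) X ⇔ (X ⊆ ⊤ × Independent (pointᵥ k) X)
  PG-represents k X = let equivalent = PG-independent k X in
    mk⇔ (λ ind → (λ {_} _ → ∈⊤) , Equivalence.to equivalent ind) (Equivalence.from equivalent ∘ proj₂)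

  at-infinity? : ∀ k → Decidable (λ (i : Fin (#points 𝔽 (suc k))) → head (pointᵥ (suc k) i) ≡ 0#)
  at-infinity? k i = head (pointᵥ (suc k) i) ≟ 0#

  infinity : ∀ k → Subset (#points 𝔽 (suc k))
  infinity k = subset (at-infinity? k)

  -- The subspace criterion is applied to the geometry itself, represented by its own points:
  -- `zero-↪` gives rank `k` at infinity and `id-↪` the full rank `suc k`.
  infinity-hyperplane : ∀ k → Hyperplane (PG 𝔽 (suc k)) (infinity k)
  infinity-hyperplane k =
      flat-subspace zero-↪ id-↪ (λ _ → ∈⊤) image (λ _ → complete) basis ,
      trans (cong suc (rank-subspace zero-↪ id-↪ (λ _ → ∈⊤) image (λ _ → complete) basis))
        (sym (rank-subspace id-↪ id-↪ (λ _ → ∈⊤) (λ _ → _ , refl) (λ _ _ → ∈⊤)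
          λ i → let (j , par) = pointᵥ-exists (unit-nonzero i) in j , ∈⊤ , par))
    where
    open Represented (PG 𝔽 (suc k)) (pointᵥ (suc k)) (PG-represents (suc k))

    image : ∀ {i} → i Subset.∈ infinity k → ∃[ x ] pointᵥ (suc k) i ≡ to zero-↪ x
    image {i} i∈ = _ , cong (_∷ tabulate (point 𝔽 (suc k) i ∘ suc)) (∈-subset⁻ (at-infinity? k) i∈)

    complete : ∀ {i} → ∃[ x ] pointᵥ (suc k) i ≡ to zero-↪ x → i Subset.∈ infinity k
    complete (_ , eq) = ∈-subset⁺ (at-infinity? k) (cong head eq)

    basis : ∀ i → ∃[ j ] j Subset.∈ infinity k × (0# ∷ unit i) ∥ pointᵥ (suc k) j
    basis i with pointᵥ-exists {x = 0# ∷ unit i} (λ eq → unit-nonzero i (∷-injectiveʳ eq))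
    ... | j , s , s≢0 , eq = j , ∈-subset⁺ (at-infinity? k)
      (*-zero (trans (*-comm _ s) (sym (cong head eq))) s≢0) , s , s≢0 , eq

x∈p─q⇒x∉q : ∀ {n} (p q : Subset n) {x} → x Subset.∈ p ─ q → x Subset.∉ q
x∈p─q⇒x∉q (_ ∷ p) (inside ∷ q)  {zero}  () _
x∈p─q⇒x∉q (_ ∷ p) (outside ∷ q) {zero}  _ ()
x∈p─q⇒x∉q (_ ∷ p) (_ ∷ q)       {suc x} (there x∈) (there x∈q) = x∈p─q⇒x∉q p q x∈ x∈q

-- From subspaces of the cone to flats of the matroid

module Flats {q : ℕ} (𝔽 : FiniteField q) where

  open LinearAlgebra 𝔽
  open RamseyForCones 𝔽
  open Cubes 𝔽 using (spread-↪)
  open Geometry 𝔽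
  open ProjectiveGeometry 𝔽

  module _ {n d : ℕ} (M : Matroid n) (v : Fin n → Vec F d)
    (represents : ∀ X → Matroid.Indep M X ⇔ (X ⊆ Matroid.E M × Independent v X))
    (simple : Simple M) where

    open Matroid M
    open Represented M v represents

    v-nonzero : ∀ {e} → e Subset.∈ E → v e ≢ 0⃗
    v-nonzero {e} e∈E ve≡0 = unit-nonzero e (indep⁻ (proj₁ simple e∈E) (unit e)
      (λ i i∉ → unit-other {i = e} λ { refl → i∉ (x∈⁅x⁆ e) }) (trans (mat-unit v e) ve≡0))

    v-simple : ∀ {e f} → e Subset.∈ E → f Subset.∈ E → v e ∥ v f → e ≡ f
    v-simple {e} {f} e∈E f∈E (s , s≢0 , eq) with e ≟ f
    ... | yes e≡f = e≡f
    ... | no e≢f  = ∥-unit (s , s≢0 , ⊖-cancel (unit e) (s ⊙ unit f) (indep⁻ (proj₂ simple e∈E f∈E e≢f) c support (begin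
        mat v c
          ≡⟨ ⊕-homo (mat-linear v) (unit e) _ ⟩
        mat v (unit e) ⊕ mat v ((- 1#) ⊙ s ⊙ unit f)
          ≡⟨ cong (mat v (unit e) ⊕_) (⊙-homo (mat-linear v) (- 1#) (s ⊙ unit f)) ⟩
        mat v (unit e) ⊕ (- 1#) ⊙ mat v (s ⊙ unit f)
          ≡⟨ cong (λ x → mat v (unit e) ⊕ (- 1#) ⊙ x) (⊙-homo (mat-linear v) s (unit f)) ⟩
        mat v (unit e) ⊕ (- 1#) ⊙ s ⊙ mat v (unit f)
          ≡⟨ cong₂ (λ x y → x ⊕ (- 1#) ⊙ s ⊙ y) (mat-unit v e) (mat-unit v f) ⟩
        v e ⊕ (- 1#) ⊙ s ⊙ v f
          ≡⟨ cong (λ x → v e ⊕ (- 1#) ⊙ x) eq ⟨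
        v e ⊕ (- 1#) ⊙ v e
          ≡⟨ ⊖-self (v e) ⟩
        0⃗
          ∎)))
      where
      open ≡-Reasoning
      c = unit e ⊕ (- 1#) ⊙ s ⊙ unit f
      support : ∀ i → i Subset.∉ ⁅ e ⁆ ∪ ⁅ f ⁆ → lookup c i ≡ 0#
      support i i∉ = begin
        lookup c i                                      ≡⟨ lookup-⊕ (unit e) _ i ⟩
        lookup (unit e) i + lookup ((- 1#) ⊙ s ⊙ unit f) i
          ≡⟨ cong₂ _+_ (unit-other {i = e} λ { refl → i∉ (x∈p∪q⁺ (inj₁ (x∈⁅x⁆ e))) })
               (trans (lookup-⊙ (- 1#) (s ⊙ unit f) i) (cong ((- 1#) *_) (trans (lookup-⊙ s (unit f) i)
                 (cong (s *_) (unit-other {i = f} λ { refl → i∉ (x∈p∪q⁺ {p = ⁅ e ⁆} (inj₂ (x∈⁅x⁆ f))) }))))) ⟩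
        0# + (- 1#) * (s * 0#)                          ≡⟨ +-identityˡ _ ⟩
        (- 1#) * (s * 0#)                               ≡⟨ trans (cong ((- 1#) *_) (zeroʳ s)) (zeroʳ _) ⟩
        0#                                              ∎

    -- The set `S` of the whole argument, read in the coordinates of `Φ`.
    OnPoint : ∀ {m} → m ↪ d → Vec F m → Set
    OnPoint Φ x = ∃[ e ] e Subset.∈ E × to Φ x ∥ v e

    onPoint-cone : ∀ {m} (Φ : m ↪ d) → IsCone (OnPoint Φ)
    onPoint-cone Φ = record
      { member? = λ x → any? λ e → (e ∈? E) ×-dec any? λ s → ¬? (s ≟ 0#) ×-dec ≡-dec _≟_ (to Φ x) (s ⊙ v e)
      ; scale   = λ { {a} {x} a≢0 (e , e∈E , par) → e , e∈E , ∥-trans (a , a≢0 , ⊙-homo (linear Φ) a x) par } }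

    module _ {k : ℕ} (Φ : k ↪ d) where

      inSubspace? : Decidable (λ e → e Subset.∈ E × ∃[ x ] v e ≡ to Φ x)
      inSubspace? e = (e ∈? E) ×-dec Finite.any-finite? vectors λ x → ≡-dec _≟_ (v e) (to Φ x)

      span : Subset n
      span = subset inSubspace?

      span⊆E : span ⊆ E
      span⊆E = proj₁ ∘ ∈-subset⁻ inSubspace?

      span-image : ∀ {e} → e Subset.∈ span → ∃[ x ] v e ≡ to Φ x
      span-image = proj₂ ∘ ∈-subset⁻ inSubspace?

      in-span : ∀ {e x} → e Subset.∈ E → to Φ x ∥ v e → e Subset.∈ span
      in-span {x = x} e∈E par with ∥-sym par
      ... | s , _ , eq = ∈-subset⁺ inSubspace? (e∈E , s ⊙ x , trans eq (sym (⊙-homo (linear Φ) s x)))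

      span-flat : (τ : k ↪ k) → (∀ i → OnPoint Φ (to τ (unit i))) → Flat M span × rank M span ≡ k
      span-flat τ units = flat-subspace Φ τ span⊆E span-image complete basis ,
                          rank-subspace Φ τ span⊆E span-image complete basis
        where
        complete : ∀ {e} → e Subset.∈ E → ∃[ x ] v e ≡ to Φ x → e Subset.∈ span
        complete e∈E image = ∈-subset⁺ inSubspace? (e∈E , image)
        basis : ∀ i → ∃[ e ] e Subset.∈ span × to Φ (to τ (unit i)) ∥ v e
        basis i = let (e , e∈E , par) = units i in e , in-span e∈E par , par

      span-point : ∀ {e} → e Subset.∈ span → ∃[ x ] x ≢ 0⃗ × v e ≡ to Φ x
      span-point e∈ = let (x , eq) = span-image e∈ in
        x , (λ x≡0 → v-nonzero (span⊆E e∈) (trans eq (trans (cong (to Φ) x≡0) (0⃗-homo (linear Φ))))) , eq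

      -- No element of the subspace has two nonzero coordinates, so each is parallel to the image of
      -- a unit vector, and these images are independent.
      span-independent : (∀ {x} → Many x → ¬ OnPoint Φ x) → Indep span
      span-independent few = indep⁺ span⊆E (transfer {w = to Φ ∘ unit} {Y = ⊤} parallel
          (λ e∈ f∈ p r → v-simple (span⊆E e∈) (span⊆E f∈) (∥-trans p (∥-sym r)))
          (Equivalence.from (independent-image Φ) independent-units))
        where
        parallel : ∀ {e} → e Subset.∈ span → ∃[ i ] i Subset.∈ ⊤ × v e ∥ to Φ (unit i)
        parallel {e} e∈ with span-point e∈
        ... | x , x≢0 , eq with nonzero-entry x≢0
        ...   | i , xi≢0 = i , ∈⊤ , subst (_∥ to Φ (unit i)) (sym eq) (∥-to Φ (lookup x i , xi≢0 ,
                  lookup-ext λ j → trans (entry j) (sym (lookup-⊙ (lookup x i) (unit i) j))))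
          where
          entry : ∀ j → lookup x j ≡ lookup x i * lookup (unit i) j
          entry j with i ≟ j | lookup x j ≟ 0#
          ... | yes refl | _ = sym (trans (cong (lookup x i *_) (unit-same i)) (*-identityʳ _))
          ... | no i≢j | yes xj≡0 = trans xj≡0 (sym (trans (cong (lookup x i *_) (unit-other i≢j)) (zeroʳ _)))
          ... | no i≢j | no xj≢0  = contradiction (e , span⊆E e∈ , ∥-reflexive (sym eq)) (few (i , j , i≢j , xi≢0 , xj≢0))

      -- Keeping `N` general serves both conclusions: the whole projective geometry and its
      -- restriction to the complement of `infinity`.
      span-≅ : (N : Matroid (#points 𝔽 k)) →
        (∀ {Y} → Y ⊆ Matroid.E N → Matroid.Indep N Y ⇔ Independent (pointᵥ k) Y) →
        (∀ {i} → OnPoint Φ (pointᵥ k i) ⇔ i Subset.∈ Matroid.E N) →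
        M ↾ span ≅ N
      span-≅ N independent-N on-point = parallel⇒≅ (M ↾ span) N v (to Φ ∘ pointᵥ k)
        (λ {X} X⊆ → mk⇔ (indep⁻ ∘ proj₁) λ ind →
          indep⁺ (proj₁ ∘ x∈p∩q⁻ E span ∘ X⊆) ind , λ {_} x∈X → proj₂ (x∈p∩q⁻ E span (X⊆ x∈X)))
        (λ Y⊆ → let open Equivalence in
          mk⇔ (from (independent-image Φ) ∘ to (independent-N Y⊆)) (from (independent-N Y⊆) ∘ to (independent-image Φ)))
        (λ e∈ f∈ → v-simple (proj₁ (x∈p∩q⁻ E span e∈)) (proj₁ (x∈p∩q⁻ E span f∈)))
        (λ _ _ → pointᵥ-simple ∘ ∥-injective Φ)
        v⇒w
        (λ i∈ → let (e , e∈E , par) = Equivalence.from on-point i∈ in e , x∈p∩q⁺ (e∈E , in-span e∈E par) , par)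
        where
        v⇒w : ∀ {e} → e Subset.∈ E Subset.∩ span → ∃[ i ] i Subset.∈ Matroid.E N × v e ∥ to Φ (pointᵥ k i)
        v⇒w {e} e∈ with span-point (proj₂ (x∈p∩q⁻ E span e∈))
        ... | x , x≢0 , eq with pointᵥ-exists x≢0
        ...   | i , par = i , Equivalence.to on-point (e , proj₁ (x∈p∩q⁻ E span e∈) , ∥-sym par′) , par′
          where par′ = subst (_∥ to Φ (pointᵥ k i)) (sym eq) (∥-to Φ par)

    Conclusion : ℕ → Set
    Conclusion k = ∃[ X ] Flat M X × rank M X ≡ k ×
      (Indep X ⊎ IsAffineGeometry 𝔽 k (M ↾ X) ⊎ (M ↾ X) ≅ PG 𝔽 k)

    module _ {m k : ℕ} (B : m ↪ d) where

      independentFlat⇒ : IndependentFlat k (OnPoint B) → Conclusion k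
      independentFlat⇒ (φ , units , few) = let (flat , rank≡k) = span-flat Φ id-↪ units in
        span Φ , flat , rank≡k , inj₁ (span-independent Φ few)
        where Φ = B ∘↪ φ

      projectiveFlat⇒ : ProjectiveFlat k (OnPoint B) → Conclusion k
      projectiveFlat⇒ (φ , all) = let (flat , rank≡k) = span-flat Φ id-↪ (λ i → all (unit-nonzero i)) in
        span Φ , flat , rank≡k , inj₂ (inj₂ (span-≅ Φ (PG 𝔽 k)
          (λ {Y} _ → PG-independent k Y)
          (mk⇔ (λ _ → ∈⊤) (λ _ → all (pointᵥ-nonzero _)))))
        where Φ = B ∘↪ φ

      affineFlat⇒ : AffineFlat k (OnPoint B) → Conclusion (suc k)
      affineFlat⇒ (φ , off , on) = let (flat , rank≡k) = span-flat Φ shear (λ i → off (shear-unit i)) in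
        span Φ , flat , rank≡k , inj₂ (inj₁ (infinity k , infinity-hyperplane k , span-≅ Φ N independent-N on-point))
        where
        Φ = B ∘↪ φ
        N = PG 𝔽 (suc k) ↾ (⊤ ─ infinity k)

        independent-N : ∀ {Y} → Y ⊆ Matroid.E N → Matroid.Indep N Y ⇔ Independent (pointᵥ (suc k)) Y
        independent-N {Y} Y⊆ = let equivalent = PG-independent (suc k) Y in
          mk⇔ (Equivalence.to equivalent ∘ proj₁)
              (λ ind → Equivalence.from equivalent ind , λ {_} i∈Y → proj₂ (x∈p∩q⁻ ⊤ (⊤ ─ infinity k) (Y⊆ i∈Y)))

        on-point : ∀ {i} → OnPoint Φ (pointᵥ (suc k) i) ⇔ i Subset.∈ Matroid.E N
        on-point {i} = mk⇔
          (λ onᵢ → x∈p∩q⁺ (∈⊤ , x∈p∧x∉q⇒x∈p─q ∈⊤ λ i∈ →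
            on (pointᵥ-nonzero i) (∈-subset⁻ (at-infinity? k) i∈) onᵢ))
          (λ i∈ → off λ eq → x∈p─q⇒x∉q ⊤ (infinity k) (proj₂ (x∈p∩q⁻ ⊤ _ i∈)) (∈-subset⁺ (at-infinity? k) eq))

        -- Fixes the first unit vector and adds it to each of the others. The result is a basis off
        -- the hyperplane at infinity, as the flat requires: the other unit vectors themselves lie
        -- at infinity, where the cone has no points.
        shear : suc k ↪ suc k
        shear = record
          { to     = λ { (a ∷ x) → sum (lookup (a ∷ x)) ∷ x }
          ; linear = record
            { ⊕-homo = λ { x@(_ ∷ x′) y@(_ ∷ y′) → cong (_∷ x′ ⊕ y′)
                (trans (sum-cong-≗ (lookup-⊕ x y)) (∑-distrib-+ (lookup x) (lookup y))) }
            ; ⊙-homo = λ { c x@(_ ∷ x′) → cong (_∷ c ⊙ x′)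
                (trans (sum-cong-≗ (lookup-⊙ c x)) (sym (*-distribˡ-sum c (lookup x)))) } }
          ; kernel = λ { {a ∷ x} eq → cong₂ _∷_
              (trans (sym (+-identityʳ a)) (trans (cong (a +_) (sym (sum-zero λ i →
                trans (cong (λ z → lookup z i) (∷-injectiveʳ eq)) (lookup-0⃗ i)))) (∷-injectiveˡ eq)))
              (∷-injectiveʳ eq) } }

        shear-unit : ∀ i → head (to shear (unit i)) ≢ 0#
        shear-unit i eq = 1≢0 (begin
          1#                       ≡⟨ unit-same i ⟨
          lookup (unit i) i        ≡⟨ sum-single i (λ j j≢i → unit-other (j≢i ∘ sym)) ⟨
          sum (lookup (unit i))    ≡⟨ head-shear (unit i) ⟨
          head (to shear (unit i)) ≡⟨ eq ⟩
          0#                       ∎)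
          where
          open ≡-Reasoning
          head-shear : ∀ x → head (to shear x) ≡ sum (lookup x)
          head-shear (_ ∷ _) = refl

    -- The elements of an independent set serve as coordinate vectors, so that every unit vector
    -- lies in the cone.
    unavoidable-flats : ∀ {N k} →
      (∀ {S : Vec F N → Set} → IsCone S → (∀ i → S (unit i)) →
        IndependentFlat (suc k) S ⊎ AffineFlat k S ⊎ ProjectiveFlat (suc k) S) →
      N ≤ rank M E → Conclusion (suc k)
    unavoidable-flats {N} ramsey N≤rank with Rank.rank-attained M E N≤rank
    ... | I , ind , I⊆E , N≤∣I∣ = [ independentFlat⇒ B , [ affineFlat⇒ B , projectiveFlat⇒ B ]′ ]′
            (ramsey (onPoint-cone B) units)
      where
      -- The set `I` may have more than `N` elements, while the Ramsey statement is about dimension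
      -- exactly `N`.
      σ : Fin N → Fin ∣ I ∣
      σ i = inject≤ i N≤∣I∣

      σ-injective : ∀ {i j} → σ i ≡ σ j → i ≡ j
      σ-injective = inject≤-injective N≤∣I∣ N≤∣I∣ _ _

      B : N ↪ d
      B = independent-↪ {v = v} {I} (indep⁻ ind) ∘↪ spread-↪ σ σ-injective

      spread-unit : ∀ i → spread σ 0# (unit i) ≡ unit (σ i)
      spread-unit i = lookup-ext entry
        where
        entry : ∀ j → lookup (spread σ 0# (unit i)) j ≡ lookup (unit (σ i)) j
        entry j with spread-cases σ 0# j
        ... | inj₂ (off , val) = trans (val _) (sym (unit-other (off i)))
        ... | inj₁ (l , refl , val) with i ≟ l
        ...   | yes refl = trans (val _) (trans (unit-same i) (sym (unit-same (σ i))))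
        ...   | no i≢l   = trans (val _) (trans (unit-other i≢l) (sym (unit-other (i≢l ∘ σ-injective))))

      units : ∀ i → OnPoint B (unit i)
      units i = let (e , e∈I , eq) = insert-unit I (σ i) in e , I⊆E e∈I ,
        ∥-reflexive (trans (cong (mat v ∘ insert I) (spread-unit i)) (trans (cong (mat v) eq) (mat-unit v e)))

open Matroid

theorem1p2 : ∀ (p : ℕ) (p-prime : Prime p) (k : ℕ) → 1 ≤ k →
    ∃[ N ] (∀ {n} (M : Matroid n) → Simple M → Representable (GF p-prime) M →
    N ≤ rank M (E M) →
    ∃[ F ] Flat M F × rank M F ≡ k ×
    (Indep M F ⊎ IsAffineGeometry (GF p-prime) k (M ↾ F) ⊎ (M ↾ F) ≅ PG (GF p-prime) k))
-- `unavoidable` is indexed by the rank minus one, the rank at infinity in the affine case.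
theorem1p2 p p-prime (suc k) _ = proj₁ ramsey , λ M simple (d , v , represents) →
    Flats.unavoidable-flats (GF p-prime) M (tabulate ∘ v) (λ X →
      mk⇔ (Product.map₂ (to (linearlyIndependent⇔ v X)) ∘ to (represents X))
          (from (represents X) ∘ Product.map₂ (from (linearlyIndependent⇔ v X))))
      simple (proj₂ ramsey)
  where
  open Equivalence
  open Geometry (GF p-prime) using (linearlyIndependent⇔)
  ramsey = Cubes.unavoidable (GF p-prime) (PrimeField.covering p-prime) k
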